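{- Total freeness does not imply the existence of a non-trivial universal derivation: there exist a field $\mathbb{K}$ of characteristic zero, an integer $\ell\ge 1$, and a totally free arrangement $\mathscr{A}$ in $V=\mathbb{K}^\ell$ such that for every multiplicity $m:\mathscr{A}\to\mathbb{Z}_{\ge 0}$ with $m\not\equiv 0$ there is no $m$-universal derivation $\theta\neq\theta_E$ in $D(\mathscr{A},m+\mathbf{1})$.
   Context: For a field $\mathbb{K}$ of characteristic zero and $V=\mathbb{K}^\ell$, let $S=\mathbb{K}[x_1,\ldots,x_\ell]$ and $\mathrm{Der}_S=\bigoplus_{i=1}^{\ell}S\,\partial_{x_i}$. A (central) arrangement $\mathscr{A}$ is a finite set of linear hyperplanes in $V$, assumed essential: $\bigcap_{H\in\mathscr{A}}H=\{0\}$ (so $\mathscr{A}\ne\emptyset$ as $\ell\ge 1$). For $H\in\mathscr{A}$ fix $\alpha_H\in V^*$ with $\ker\alpha_H=H$. A multiplicity is a map $m:\mathscr{A}\to\mathbb{Z}_{\ge 0}$; $\mathbf{1}$ is the multiplicity with constant value $1$. $D(\mathscr{A},m)=\{\theta\in\mathrm{Der}_S\mid\theta(\alpha_H)\in S\alpha_H^{m(H)}\ \forall H\in\mathscr{A}\}$. $(\mathscr{A},m)$ is free if $D(\mathscr{A},m)$ is a free $S$-module, and $\mathscr{A}$ is totally free if $(\mathscr{A},m)$ is free for every multiplicity $m:\mathscr{A}\to\mathbb{Z}_{\ge 0}$. A nonzero derivation $\theta$ is homogeneous of degree $k$ if every nonzero $\theta(\alpha)$, $\alpha\in V^*$, is a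 homogeneous polynomial of degree $k$. For $\varphi\in\mathrm{Der}_S$ and $\theta=\sum_i f_i\partial_{x_i}$ put $\nabla_\varphi\theta=\sum_i\varphi(f_i)\partial_{x_i}$. A homogeneous $\theta\in D(\mathscr{A},m+\mathbf{1})$ is $m$-universal if $\mathrm{Der}_S\to D(\mathscr{A},m)$, $\varphi\mapsto\nabla_\varphi\theta$, is an isomorphism of $S$-modules. $\theta_E=\sum_i x_i\partial_{x_i}$ is the Euler derivation. -}

module Defs where

open import Algebra.Apartness.Bundles using (HeytingField; module HeytingCommutativeRing)
open import Algebra.Bundles using (Ring; CommutativeRing; AbelianGroup)
import Algebra.Definitions.RawMonoid as RawMonoidDefs
open import Algebra.Module.Bundles using (LeftModule)
open import Algebra.Module.Morphism.Structures using (module LeftModuleMorphisms)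
import Algebra.Properties.CommutativeSemigroup as CommutativeSemigroupProperties
import Algebra.Properties.Group as GroupProperties
import Algebra.Properties.Ring as RingProperties
import Algebra.Properties.Semiring.Divisibility as SemiringDivisibility
import Algebra.Properties.Semiring.Exp as SemiringExp
import Algebra.Properties.Semiring.Mult as SemiringMult
import Algebra.Properties.Semiring.Sum as SemiringSum
open import Data.Fin.Base using (Fin; zero; suc)
open import Data.List.Base using (List; []; _∷_; map)
open import Data.Nat.Base using (ℕ; zero; suc)
open import Data.Product.Base using (Σ; ∃; ∃-syntax; _×_; _,_; proj₁)
open import Data.Vec.Base as Vec using (Vec; []; _∷_)
open import Function.Definitions using (Injective)
open import Level using (Level; _⊔_) renaming (suc to lsuc)
open import Relation.Binary.PropositionalEquality.Core using (_≡_; _≢_)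
import Relation.Binary.Reasoning.Setoid as SetoidReasoning
open import Relation.Nullary.Negation.Core using (¬_)
open import Relation.Unary using (Pred; _≐_)

private
  variable
    c ℓ ℓ₁ ℓ₂ : Level

module Univariate (R : CommutativeRing c ℓ) where

  open CommutativeRing R
  open CommutativeSemigroupProperties +-commutativeSemigroup using (interchange)
  open RingProperties ring using (-0#≈0#)

  -- A list is a sequence of coefficients, constant term first.  Trailing
  -- zeros are allowed, so equality compares coefficients.

  Poly : Set c
  Poly = List Carrier

  coeff : Poly → ℕ → Carrier
  coeff []      _       = 0#
  coeff (a ∷ p) zero    = a
  coeff (a ∷ p) (suc n) = coeff p n

  infix 4 _≋_
  record _≋_ (p q : Poly) : Set ℓ where
    constructor mk≋
    field
      coeffs : ∀ n → coeff p n ≈ coeff q n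
  open _≋_ public

  infixl 6 _⊕_
  _⊕_ : Poly → Poly → Poly
  []      ⊕ q       = q
  (a ∷ p) ⊕ []      = a ∷ p
  (a ∷ p) ⊕ (b ∷ q) = (a + b) ∷ (p ⊕ q)

  scale : Carrier → Poly → Poly
  scale a = map (a *_)

  ⊖_ : Poly → Poly
  ⊖_ = map (-_)

  -- (a + x p) q = a q + x (p q)

  infixl 7 _⊗_
  _⊗_ : Poly → Poly → Poly
  []      ⊗ q = []
  (a ∷ p) ⊗ q = scale a q ⊕ (0# ∷ (p ⊗ q))

  -- (a + x p)′ = p + x p′

  deriv : Poly → Poly
  deriv []      = []
  deriv (a ∷ p) = p ⊕ (0# ∷ deriv p)

  coeff-⊕ : ∀ p q n → coeff (p ⊕ q) n ≈ coeff p n + coeff q n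
  coeff-⊕ []      q       n       = sym (+-identityˡ _)
  coeff-⊕ (a ∷ p) []      n       = sym (+-identityʳ _)
  coeff-⊕ (a ∷ p) (b ∷ q) zero    = refl
  coeff-⊕ (a ∷ p) (b ∷ q) (suc n) = coeff-⊕ p q n

  coeff-scale : ∀ a p n → coeff (scale a p) n ≈ a * coeff p n
  coeff-scale a []      n       = sym (zeroʳ a)
  coeff-scale a (b ∷ p) zero    = refl
  coeff-scale a (b ∷ p) (suc n) = coeff-scale a p n

  coeff-⊖ : ∀ p n → coeff (⊖ p) n ≈ - coeff p n
  coeff-⊖ []      n       = sym -0#≈0#
  coeff-⊖ (a ∷ p) zero    = refl
  coeff-⊖ (a ∷ p) (suc n) = coeff-⊖ p n

  ≋-refl : ∀ {p} → p ≋ p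
  ≋-refl = mk≋ λ _ → refl

  ≋-sym : ∀ {p q} → p ≋ q → q ≋ p
  ≋-sym e = mk≋ λ n → sym (coeffs e n)

  ≋-trans : ∀ {p q r} → p ≋ q → q ≋ r → p ≋ r
  ≋-trans e f = mk≋ λ n → trans (coeffs e n) (coeffs f n)

  ∷-cong : ∀ {a b p q} → a ≈ b → p ≋ q → (a ∷ p) ≋ (b ∷ q)
  ∷-cong a≈b p≋q = mk≋ λ { zero → a≈b ; (suc n) → coeffs p≋q n }

  ∷-zero : ∀ {p} → p ≋ [] → (0# ∷ p) ≋ []
  ∷-zero e = mk≋ λ { zero → refl ; (suc n) → coeffs e n }

  ⊕-cong : ∀ {p p′ q q′} → p ≋ p′ → q ≋ q′ → p ⊕ q ≋ p′ ⊕ q′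
  ⊕-cong {p} {p′} {q} {q′} e f = mk≋ λ n →
    trans (coeff-⊕ p q n)
      (trans (+-cong (coeffs e n) (coeffs f n)) (sym (coeff-⊕ p′ q′ n)))

  ⊕-congˡ : ∀ p {q q′} → q ≋ q′ → p ⊕ q ≋ p ⊕ q′
  ⊕-congˡ p e = ⊕-cong (≋-refl {p}) e

  ⊕-congʳ : ∀ q {p p′} → p ≋ p′ → p ⊕ q ≋ p′ ⊕ q
  ⊕-congʳ q e = ⊕-cong e (≋-refl {q})

  scale-cong : ∀ {a b p q} → a ≈ b → p ≋ q → scale a p ≋ scale b q
  scale-cong {a} {b} {p} {q} a≈b e = mk≋ λ n →
    trans (coeff-scale a p n)
      (trans (*-cong a≈b (coeffs e n)) (sym (coeff-scale b q n)))

  ⊖-cong : ∀ {p q} → p ≋ q → ⊖ p ≋ ⊖ q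
  ⊖-cong {p} {q} e = mk≋ λ n →
    trans (coeff-⊖ p n) (trans (-‿cong (coeffs e n)) (sym (coeff-⊖ q n)))

  ⊕-assoc : ∀ p q r → (p ⊕ q) ⊕ r ≋ p ⊕ (q ⊕ r)
  ⊕-assoc p q r = mk≋ λ n →
    trans (coeff-⊕ (p ⊕ q) r n)
      (trans (+-congʳ (coeff-⊕ p q n))
        (trans (+-assoc _ _ _)
          (sym (trans (coeff-⊕ p (q ⊕ r) n) (+-congˡ (coeff-⊕ q r n))))))

  ⊕-comm : ∀ p q → p ⊕ q ≋ q ⊕ p
  ⊕-comm p q = mk≋ λ n →
    trans (coeff-⊕ p q n) (trans (+-comm _ _) (sym (coeff-⊕ q p n)))

  ⊕-identityʳ : ∀ p → p ⊕ [] ≋ p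
  ⊕-identityʳ p = mk≋ λ n → trans (coeff-⊕ p [] n) (+-identityʳ _)

  ⊕-inverseˡ : ∀ p → (⊖ p) ⊕ p ≋ []
  ⊕-inverseˡ p = mk≋ λ n →
    trans (coeff-⊕ (⊖ p) p n) (trans (+-congʳ (coeff-⊖ p n)) (-‿inverseˡ _))

  ⊕-abelianGroup : AbelianGroup c ℓ
  ⊕-abelianGroup = record
    { Carrier = Poly
    ; _≈_ = _≋_
    ; _∙_ = _⊕_
    ; ε = []
    ; _⁻¹ = ⊖_
    ; isAbelianGroup = record
      { isGroup = record
        { isMonoid = record
          { isSemigroup = record
            { isMagma = record
              { isEquivalence = record
                { refl = ≋-refl ; sym = ≋-sym ; trans = ≋-trans }
              ; ∙-cong = ⊕-cong
              }
            ; assoc = ⊕-assoc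
            }
          ; identity = (λ p → ≋-refl) , ⊕-identityʳ
          }
        ; inverse = ⊕-inverseˡ , λ p → ≋-trans (⊕-comm p (⊖ p)) (⊕-inverseˡ p)
        ; ⁻¹-cong = ⊖-cong
        }
      ; comm = ⊕-comm
      }
    }

  private
    module ⊕ = CommutativeSemigroupProperties
      (AbelianGroup.commutativeSemigroup ⊕-abelianGroup)
    open SetoidReasoning (AbelianGroup.setoid ⊕-abelianGroup)

  scale-distribˡ : ∀ a p q → scale a (p ⊕ q) ≋ scale a p ⊕ scale a q
  scale-distribˡ a p q = mk≋ λ n →
    trans (coeff-scale a (p ⊕ q) n)
      (trans (*-congˡ (coeff-⊕ p q n))
        (trans (distribˡ _ _ _)
          (sym (trans (coeff-⊕ (scale a p) (scale a q) n)
            (+-cong (coeff-scale a p n) (coeff-scale a q n))))))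

  scale-0# : ∀ p → scale 0# p ≋ []
  scale-0# p = mk≋ λ n → trans (coeff-scale 0# p n) (zeroˡ _)

  scale-1# : ∀ p → scale 1# p ≋ p
  scale-1# p = mk≋ λ n → trans (coeff-scale 1# p n) (*-identityˡ _)

  scale-* : ∀ a b p → scale (a * b) p ≋ scale a (scale b p)
  scale-* a b p = mk≋ λ n →
    trans (coeff-scale (a * b) p n)
      (trans (*-assoc _ _ _)
        (sym (trans (coeff-scale a (scale b p) n) (*-congˡ (coeff-scale b p n)))))

  shift-⊕ : ∀ p q → (0# ∷ (p ⊕ q)) ≋ (0# ∷ p) ⊕ (0# ∷ q)
  shift-⊕ p q = ∷-cong (sym (+-identityˡ 0#)) ≋-refl

  ⊗-congˡ : ∀ p {q q′} → q ≋ q′ → p ⊗ q ≋ p ⊗ q′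
  ⊗-congˡ []      e = ≋-refl
  ⊗-congˡ (a ∷ p) e = ⊕-cong (scale-cong refl e) (∷-cong refl (⊗-congˡ p e))

  ⊗-zeroʳ : ∀ p → p ⊗ [] ≋ []
  ⊗-zeroʳ []      = ≋-refl
  ⊗-zeroʳ (a ∷ p) = ∷-zero (⊗-zeroʳ p)

  ⊗-∷ : ∀ p b q → p ⊗ (b ∷ q) ≋ scale b p ⊕ (0# ∷ (p ⊗ q))
  ⊗-∷ []      b q = ≋-sym (∷-zero ≋-refl)
  ⊗-∷ (a ∷ p) b q = ∷-cong (+-congʳ (*-comm a b)) (begin
    scale a q ⊕ (p ⊗ (b ∷ q))                   ≈⟨ ⊕-cong ≋-refl (⊗-∷ p b q) ⟩
    scale a q ⊕ (scale b p ⊕ (0# ∷ (p ⊗ q)))    ≈⟨ ⊕.x∙yz≈y∙xz (scale a q) (scale b p) _ ⟩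
    scale b p ⊕ (scale a q ⊕ (0# ∷ (p ⊗ q)))    ∎)

  ⊗-comm : ∀ p q → p ⊗ q ≋ q ⊗ p
  ⊗-comm []      q = ≋-sym (⊗-zeroʳ q)
  ⊗-comm (a ∷ p) q = ≋-trans
    (⊕-cong ≋-refl (∷-cong refl (⊗-comm p q)))
    (≋-sym (⊗-∷ q a p))

  ⊗-cong : ∀ {p p′ q q′} → p ≋ p′ → q ≋ q′ → p ⊗ q ≋ p′ ⊗ q′
  ⊗-cong {p} {p′} {q} {q′} e f = begin
    p ⊗ q    ≈⟨ ⊗-congˡ p f ⟩
    p ⊗ q′   ≈⟨ ⊗-comm p q′ ⟩
    q′ ⊗ p   ≈⟨ ⊗-congˡ q′ e ⟩
    q′ ⊗ p′  ≈⟨ ⊗-comm q′ p′ ⟩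
    p′ ⊗ q′  ∎

  ⊗-distribˡ : ∀ p q r → p ⊗ (q ⊕ r) ≋ (p ⊗ q) ⊕ (p ⊗ r)
  ⊗-distribˡ []      q r = ≋-refl
  ⊗-distribˡ (a ∷ p) q r = begin
    scale a (q ⊕ r) ⊕ (0# ∷ (p ⊗ (q ⊕ r)))
      ≈⟨ ⊕-cong (scale-distribˡ a q r)
           (≋-trans (∷-cong refl (⊗-distribˡ p q r)) (shift-⊕ (p ⊗ q) (p ⊗ r))) ⟩
    (scale a q ⊕ scale a r) ⊕ ((0# ∷ (p ⊗ q)) ⊕ (0# ∷ (p ⊗ r)))
      ≈⟨ ⊕.interchange (scale a q) (scale a r) _ _ ⟩
    (scale a q ⊕ (0# ∷ (p ⊗ q))) ⊕ (scale a r ⊕ (0# ∷ (p ⊗ r))) ∎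

  ⊗-distribʳ : ∀ r p q → (p ⊕ q) ⊗ r ≋ (p ⊗ r) ⊕ (q ⊗ r)
  ⊗-distribʳ r p q = begin
    (p ⊕ q) ⊗ r          ≈⟨ ⊗-comm (p ⊕ q) r ⟩
    r ⊗ (p ⊕ q)          ≈⟨ ⊗-distribˡ r p q ⟩
    (r ⊗ p) ⊕ (r ⊗ q)    ≈⟨ ⊕-cong (⊗-comm r p) (⊗-comm r q) ⟩
    (p ⊗ r) ⊕ (q ⊗ r)    ∎

  scale-⊗ : ∀ a p q → scale a p ⊗ q ≋ scale a (p ⊗ q)
  scale-⊗ a []      q = ≋-refl
  scale-⊗ a (b ∷ p) q = begin
    scale (a * b) q ⊕ (0# ∷ (scale a p ⊗ q))
      ≈⟨ ⊕-cong (scale-* a b q) (∷-cong (sym (zeroʳ a)) (scale-⊗ a p q)) ⟩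
    scale a (scale b q) ⊕ scale a (0# ∷ (p ⊗ q))
      ≈⟨ scale-distribˡ a (scale b q) (0# ∷ (p ⊗ q)) ⟨
    scale a (scale b q ⊕ (0# ∷ (p ⊗ q))) ∎

  shift-⊗ : ∀ p q → (0# ∷ p) ⊗ q ≋ 0# ∷ (p ⊗ q)
  shift-⊗ p q = ⊕-cong (scale-0# q) ≋-refl

  ⊗-assoc : ∀ p q r → (p ⊗ q) ⊗ r ≋ p ⊗ (q ⊗ r)
  ⊗-assoc []      q r = ≋-refl
  ⊗-assoc (a ∷ p) q r = begin
    (scale a q ⊕ (0# ∷ (p ⊗ q))) ⊗ r
      ≈⟨ ⊗-distribʳ r (scale a q) (0# ∷ (p ⊗ q)) ⟩
    (scale a q ⊗ r) ⊕ ((0# ∷ (p ⊗ q)) ⊗ r)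
      ≈⟨ ⊕-cong (scale-⊗ a q r)
           (≋-trans (shift-⊗ (p ⊗ q) r) (∷-cong refl (⊗-assoc p q r))) ⟩
    scale a (q ⊗ r) ⊕ (0# ∷ (p ⊗ (q ⊗ r))) ∎

  ⊗-identityˡ : ∀ p → (1# ∷ []) ⊗ p ≋ p
  ⊗-identityˡ p = ≋-trans
    (⊕-cong (scale-1# p) (∷-zero ≋-refl)) (⊕-identityʳ p)

  polynomialRing : CommutativeRing c ℓ
  polynomialRing = record
    { Carrier = Poly
    ; _≈_ = _≋_
    ; _+_ = _⊕_
    ; _*_ = _⊗_
    ; -_ = ⊖_
    ; 0# = []
    ; 1# = 1# ∷ []
    ; isCommutativeRing = record
      { isRing = record
        { +-isAbelianGroup = AbelianGroup.isAbelianGroup ⊕-abelianGroup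
        ; *-cong = ⊗-cong
        ; *-assoc = ⊗-assoc
        ; *-identity = ⊗-identityˡ ,
            λ p → ≋-trans (⊗-comm p (1# ∷ [])) (⊗-identityˡ p)
        ; distrib = ⊗-distribˡ , ⊗-distribʳ
        }
      ; *-comm = ⊗-comm
      }
    }

record IsDerivation (R : CommutativeRing c ℓ)
                    (D : CommutativeRing.Carrier R → CommutativeRing.Carrier R)
                    : Set (c ⊔ ℓ) where
  open CommutativeRing R
  field
    D-cong  : ∀ {x y} → x ≈ y → D x ≈ D y
    D-+     : ∀ x y → D (x + y) ≈ D x + D y
    leibniz : ∀ x y → D (x * y) ≈ D x * y + x * D y

  D-0# : D 0# ≈ 0#
  D-0# = identityʳ-unique (D 0#) (D 0#)
    (trans (sym (D-+ 0# 0#)) (D-cong (+-identityˡ 0#)))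
    where open GroupProperties +-group using (identityʳ-unique)

module UnivariateDerivations (R : CommutativeRing c ℓ) where

  open CommutativeRing R
  open Univariate R
  private
    module P = CommutativeRing polynomialRing
    module ⊕ = CommutativeSemigroupProperties P.+-commutativeSemigroup
  open SetoidReasoning P.setoid

  deriv-zero : ∀ p → p ≋ [] → deriv p ≋ []
  deriv-zero []      e = ≋-refl
  deriv-zero (a ∷ p) e = ≋-trans
    (⊕-cong p≋[] (∷-zero (deriv-zero p p≋[]))) ≋-refl
    where
    p≋[] : p ≋ []
    p≋[] = mk≋ λ n → coeffs e (suc n)

  deriv-cong : ∀ {p q} → p ≋ q → deriv p ≋ deriv q
  deriv-cong {[]}    {q}     e = ≋-sym (deriv-zero q (≋-sym e))
  deriv-cong {a ∷ p} {[]}    e = deriv-zero (a ∷ p) e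
  deriv-cong {a ∷ p} {b ∷ q} e = ⊕-cong p≋q (∷-cong refl (deriv-cong p≋q))
    where
    p≋q : p ≋ q
    p≋q = mk≋ λ n → coeffs e (suc n)

  deriv-⊕ : ∀ p q → deriv (p ⊕ q) ≋ deriv p ⊕ deriv q
  deriv-⊕ []      q       = ≋-refl
  deriv-⊕ (a ∷ p) []      = ≋-sym (⊕-identityʳ _)
  deriv-⊕ (a ∷ p) (b ∷ q) = begin
    (p ⊕ q) ⊕ (0# ∷ deriv (p ⊕ q))
      ≈⟨ ⊕-cong ≋-refl
           (≋-trans (∷-cong refl (deriv-⊕ p q)) (shift-⊕ (deriv p) (deriv q))) ⟩
    (p ⊕ q) ⊕ ((0# ∷ deriv p) ⊕ (0# ∷ deriv q))
      ≈⟨ ⊕.interchange p q _ _ ⟩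
    (p ⊕ (0# ∷ deriv p)) ⊕ (q ⊕ (0# ∷ deriv q)) ∎

  deriv-scale : ∀ a p → deriv (scale a p) ≋ scale a (deriv p)
  deriv-scale a []      = ≋-refl
  deriv-scale a (b ∷ p) = begin
    scale a p ⊕ (0# ∷ deriv (scale a p))
      ≈⟨ ⊕-cong ≋-refl (∷-cong (sym (zeroʳ a)) (deriv-scale a p)) ⟩
    scale a p ⊕ scale a (0# ∷ deriv p)
      ≈⟨ scale-distribˡ a p (0# ∷ deriv p) ⟨
    scale a (p ⊕ (0# ∷ deriv p)) ∎

  deriv-leibniz : ∀ p q → deriv (p ⊗ q) ≋ (deriv p ⊗ q) ⊕ (p ⊗ deriv q)
  deriv-leibniz []      q = ≋-refl
  deriv-leibniz (a ∷ p) q = begin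
    deriv (scale a q ⊕ (0# ∷ pq))
      ≈⟨ deriv-⊕ (scale a q) (0# ∷ pq) ⟩
    deriv (scale a q) ⊕ (pq ⊕ (0# ∷ deriv pq))
      ≈⟨ ⊕-cong (deriv-scale a q) (⊕-cong ≋-refl
           (≋-trans (∷-cong refl (deriv-leibniz p q)) (shift-⊕ p′q pq′))) ⟩
    scale a (deriv q) ⊕ (pq ⊕ ((0# ∷ p′q) ⊕ (0# ∷ pq′)))
      ≈⟨ ⊕-congˡ (scale a (deriv q)) (⊕-assoc pq (0# ∷ p′q) (0# ∷ pq′)) ⟨
    scale a (deriv q) ⊕ ((pq ⊕ (0# ∷ p′q)) ⊕ (0# ∷ pq′))
      ≈⟨ ⊕.x∙yz≈y∙xz (scale a (deriv q)) (pq ⊕ (0# ∷ p′q)) _ ⟩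
    (pq ⊕ (0# ∷ p′q)) ⊕ (scale a (deriv q) ⊕ (0# ∷ pq′))
      ≈⟨ ⊕-congʳ _ (⊕-congˡ pq (shift-⊗ (deriv p) q)) ⟨
    (pq ⊕ ((0# ∷ deriv p) ⊗ q)) ⊕ ((a ∷ p) ⊗ deriv q)
      ≈⟨ ⊕-congʳ _ (⊗-distribʳ q p (0# ∷ deriv p)) ⟨
    ((p ⊕ (0# ∷ deriv p)) ⊗ q) ⊕ ((a ∷ p) ⊗ deriv q) ∎
    where
    pq p′q pq′ : Poly
    pq  = p ⊗ q
    p′q = deriv p ⊗ q
    pq′ = p ⊗ deriv q

  deriv-isDerivation : IsDerivation polynomialRing deriv
  deriv-isDerivation = record
    { D-cong = deriv-cong ; D-+ = deriv-⊕ ; leibniz = deriv-leibniz }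

  module _ {D : Carrier → Carrier} (isD : IsDerivation R D) where

    open IsDerivation isD

    coeff-map : ∀ p n → coeff (map D p) n ≈ D (coeff p n)
    coeff-map []      n       = sym D-0#
    coeff-map (a ∷ p) zero    = refl
    coeff-map (a ∷ p) (suc n) = coeff-map p n

    map-cong : ∀ {p q} → p ≋ q → map D p ≋ map D q
    map-cong {p} {q} e = mk≋ λ n →
      trans (coeff-map p n) (trans (D-cong (coeffs e n)) (sym (coeff-map q n)))

    map-⊕ : ∀ p q → map D (p ⊕ q) ≋ map D p ⊕ map D q
    map-⊕ p q = mk≋ λ n →
      trans (coeff-map (p ⊕ q) n)
        (trans (D-cong (coeff-⊕ p q n))
          (trans (D-+ _ _)
            (sym (trans (coeff-⊕ (map D p) (map D q) n)
              (+-cong (coeff-map p n) (coeff-map q n))))))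

    map-scale : ∀ a p → map D (scale a p) ≋ scale (D a) p ⊕ scale a (map D p)
    map-scale a []      = ≋-refl
    map-scale a (b ∷ p) = ∷-cong (leibniz a b) (map-scale a p)

    map-leibniz : ∀ p q → map D (p ⊗ q) ≋ (map D p ⊗ q) ⊕ (p ⊗ map D q)
    map-leibniz []      q = ≋-refl
    map-leibniz (a ∷ p) q = begin
      map D (scale a q ⊕ (0# ∷ (p ⊗ q)))
        ≈⟨ map-⊕ (scale a q) (0# ∷ (p ⊗ q)) ⟩
      map D (scale a q) ⊕ (D 0# ∷ map D (p ⊗ q))
        ≈⟨ ⊕-cong (map-scale a q)
             (≋-trans (∷-cong D-0# (map-leibniz p q))
               (shift-⊕ (map D p ⊗ q) (p ⊗ map D q))) ⟩
      (scale (D a) q ⊕ scale a (map D q)) ⊕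
        ((0# ∷ (map D p ⊗ q)) ⊕ (0# ∷ (p ⊗ map D q)))
        ≈⟨ ⊕.interchange (scale (D a) q) _ _ _ ⟩
      (scale (D a) q ⊕ (0# ∷ (map D p ⊗ q))) ⊕
        (scale a (map D q) ⊕ (0# ∷ (p ⊗ map D q))) ∎

    map-isDerivation : IsDerivation polynomialRing (map D)
    map-isDerivation = record
      { D-cong = map-cong ; D-+ = map-⊕ ; leibniz = map-leibniz }

module _ {R : Ring c ℓ} {m ℓm} (M : LeftModule R m ℓm) where

  open Ring R using (Carrier; _≈_; 0#)
  open LeftModule M
  open RawMonoidDefs +ᴹ-rawMonoid using (sum)

  record IsBasis {I : Set m} (e : I → Carrierᴹ) : Set (c ⊔ ℓ ⊔ m ⊔ ℓm) where
    field
      independent : ∀ {n} (ι : Fin n → I) → Injective _≡_ _≡_ ι →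
                    ∀ (a : Fin n → Carrier) →
                    sum (λ k → a k *ₗ e (ι k)) ≈ᴹ 0ᴹ → ∀ k → a k ≈ 0#
      spanning    : ∀ x → ∃[ n ] Σ (Fin n → I) λ ι → Σ (Fin n → Carrier) λ a →
                    x ≈ᴹ sum (λ k → a k *ₗ e (ι k))

  IsFree : Set (c ⊔ ℓ ⊔ lsuc m ⊔ ℓm)
  IsFree = Σ (Set m) λ I → Σ (I → Carrierᴹ) IsBasis

module _ {R : Ring c ℓ} {m ℓm} (M : LeftModule R m ℓm) where

  open Ring R using (Carrier)
  open LeftModule M

  record IsSubmodule {p} (P : Pred Carrierᴹ p) : Set (c ⊔ m ⊔ p) where
    field
      +-closed : ∀ {x y} → P x → P y → P (x +ᴹ y)
      0-closed : P 0ᴹ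
      neg-closed : ∀ {x} → P x → P (-ᴹ x)
      *-closed : ∀ a {x} → P x → P (a *ₗ x)

  submodule : ∀ {p} {P : Pred Carrierᴹ p} → IsSubmodule P → LeftModule R (m ⊔ p) ℓm
  submodule {P = P} isSub = record
    { Carrierᴹ = Σ Carrierᴹ P
    ; _≈ᴹ_ = λ (x , _) (y , _) → x ≈ᴹ y
    ; _+ᴹ_ = λ (x , px) (y , py) → x +ᴹ y , +-closed px py
    ; _*ₗ_ = λ a (x , px) → a *ₗ x , *-closed a px
    ; 0ᴹ = 0ᴹ , 0-closed
    ; -ᴹ_ = λ (x , px) → -ᴹ x , neg-closed px
    ; isLeftModule = record
      { isLeftSemimodule = record
        { +ᴹ-isCommutativeMonoid = record
          { isMonoid = record
            { isSemigroup = record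
              { isMagma = record
                { isEquivalence = record
                  { refl = ≈ᴹ-refl ; sym = ≈ᴹ-sym ; trans = ≈ᴹ-trans }
                ; ∙-cong = +ᴹ-cong
                }
              ; assoc = λ _ _ _ → +ᴹ-assoc _ _ _
              }
            ; identity = (λ _ → +ᴹ-identityˡ _) , (λ _ → +ᴹ-identityʳ _)
            }
          ; comm = λ _ _ → +ᴹ-comm _ _
          }
        ; isPreleftSemimodule = record
          { *ₗ-cong = *ₗ-cong
          ; *ₗ-zeroˡ = λ _ → *ₗ-zeroˡ _
          ; *ₗ-distribʳ = λ _ _ _ → *ₗ-distribʳ _ _ _
          ; *ₗ-identityˡ = λ _ → *ₗ-identityˡ _
          ; *ₗ-assoc = λ _ _ _ → *ₗ-assoc _ _ _
          ; *ₗ-zeroʳ = λ _ → *ₗ-zeroʳ _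
          ; *ₗ-distribˡ = λ _ _ _ → *ₗ-distribˡ _ _ _
          }
        }
      ; -ᴹ‿cong = -ᴹ‿cong
      ; -ᴹ‿inverse = (λ _ → -ᴹ‿inverseˡ _) , (λ _ → -ᴹ‿inverseʳ _)
      }
    }
    where open IsSubmodule isSub

-- K[x₁,…,xₙ₊₁] = K[x₂,…,xₙ₊₁][x₁]: index zero is the outermost variable.

_[X_] : CommutativeRing c ℓ → ℕ → CommutativeRing c ℓ
K [X zero  ] = K
K [X suc n ] = Univariate.polynomialRing (K [X n ])

module Multivariate (K : CommutativeRing c ℓ) where

  private
    module K = CommutativeRing K
    module S (n : ℕ) = CommutativeRing (K [X n ])

  Polynomial : ℕ → Set c
  Polynomial = S.Carrier

  constant : ∀ n → K.Carrier → Polynomial n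
  constant zero    a = a
  constant (suc n) a = constant n a ∷ []

  var : ∀ {n} → Fin n → Polynomial n
  var {suc n} zero    = S.0# n ∷ S.1# n ∷ []
  var {suc n} (suc i) = var i ∷ []

  ∂ : ∀ {n} → Fin n → Polynomial n → Polynomial n
  ∂ {suc n} zero    = Univariate.deriv (K [X n ])
  ∂ {suc n} (suc i) = map (∂ i)

  -- The coefficient of x₁^e₁ ⋯ xₙ^eₙ.

  coefficient : ∀ {n} → Polynomial n → Vec ℕ n → K.Carrier
  coefficient {zero}  p []       = p
  coefficient {suc n} p (e ∷ es) = coefficient (Univariate.coeff (K [X n ]) p e) es

  -- The zero polynomial satisfies this for every k.

  IsHomogeneous : ∀ {n} → ℕ → Polynomial n → Set ℓ
  IsHomogeneous {n} k p = ∀ (e : Vec ℕ n) → Vec.sum e ≢ k → coefficient p e K.≈ K.0#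

  ∂-isDerivation : ∀ {n} (i : Fin n) → IsDerivation (K [X n ]) (∂ i)
  ∂-isDerivation {suc n} zero    = UnivariateDerivations.deriv-isDerivation (K [X n ])
  ∂-isDerivation {suc n} (suc i) =
    UnivariateDerivations.map-isDerivation (K [X n ]) (∂-isDerivation i)

  private
    Vanishes : ∀ n → Polynomial n → Set ℓ
    Vanishes n p = S._≈_ n p (S.0# n)

    module _ {n : ℕ} where
      open Univariate (K [X n ])

      single-zero : ∀ {p} → Vanishes n p → (p ∷ []) ≋ []
      single-zero e = ≋-trans (∷-cong e ≋-refl) (∷-zero ≋-refl)

  ∂-constant : ∀ {n} (i : Fin n) a → Vanishes n (∂ i (constant n a))
  ∂-constant {suc n} zero    a = Univariate.∷-zero (K [X n ]) (Univariate.≋-refl (K [X n ]))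
  ∂-constant {suc n} (suc i) a = single-zero {n} (∂-constant i a)

  ∂-1# : ∀ {n} (i : Fin n) → Vanishes n (∂ i (S.1# n))
  ∂-1# {suc n} zero    = Univariate.∷-zero (K [X n ]) (Univariate.≋-refl (K [X n ]))
  ∂-1# {suc n} (suc i) = single-zero {n} (∂-1# i)

  ∂∂-var : ∀ {n} (i j k : Fin n) → Vanishes n (∂ i (∂ j (var k)))
  ∂∂-var {suc n} i zero zero = ≋-trans
    (D-cong {y = S.1# (suc n)}
      (∷-cong (S.+-identityʳ n _) (∷-zero ≋-refl)))
    (∂-1# i)
    where
    open Univariate (K [X n ])
    open IsDerivation (∂-isDerivation i)
  ∂∂-var {suc n} i zero (suc k) = ≋-trans (D-cong (∷-zero ≋-refl)) D-0#
    where
    open Univariate (K [X n ])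
    open IsDerivation (∂-isDerivation i)
  ∂∂-var {suc n} i (suc j) zero = ≋-trans
    (D-cong (≋-trans
      (∷-cong (IsDerivation.D-0# (∂-isDerivation j)) (single-zero {n} (∂-1# j)))
      (∷-zero ≋-refl)))
    D-0#
    where
    open Univariate (K [X n ])
    open IsDerivation (∂-isDerivation i)
  ∂∂-var {suc n} zero (suc j) (suc k) = ∷-zero ≋-refl
    where open Univariate (K [X n ])
  ∂∂-var {suc n} (suc i) (suc j) (suc k) = single-zero {n} (∂∂-var i j k)

fieldRing : HeytingField c ℓ₁ ℓ₂ → CommutativeRing c ℓ₁
fieldRing K = HeytingCommutativeRing.commutativeRing (HeytingField.heytingCommutativeRing K)

CharacteristicZero : HeytingField c ℓ₁ ℓ₂ → Set ℓ₁
CharacteristicZero K = ∀ n → n · 1# ≈ 0# → n ≡ 0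
  where
  open CommutativeRing (fieldRing K) using (_≈_; 0#; 1#; semiring)
  open SemiringMult semiring using () renaming (_×_ to _·_)

module Arrangements (K : HeytingField c ℓ₁ ℓ₂) (l : ℕ) where

  private
    module K = CommutativeRing (fieldRing K)

  V : Set c
  V = Fin l → K.Carrier

  -- Coefficients with respect to the basis x₁,…,xₗ of V*.

  LinearForm : Set c
  LinearForm = Fin l → K.Carrier

  _⟨_⟩ : LinearForm → V → K.Carrier
  a ⟨ v ⟩ = sum λ i → a i K.* v i
    where open SemiringSum K.semiring using (sum)

  ker : LinearForm → Pred V ℓ₁
  ker a v = a ⟨ v ⟩ K.≈ K.0#

  -- The hyperplanes are the kernels of the chosen forms α H.  By distinct,
  -- maps out of the index type are the same as maps out of the set of
  -- hyperplanes.

  record Arrangement : Set (c ⊔ ℓ₁) where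
    field
      size      : ℕ
      α         : Fin size → LinearForm
      nonzero   : ∀ H → ¬ (∀ i → α H i K.≈ K.0#)
      distinct  : ∀ {H H′} → ker (α H) ≐ ker (α H′) → H ≡ H′
      essential : ∀ v → (∀ H → ker (α H) v) → ∀ i → v i K.≈ K.0#

    Multiplicity : Set
    Multiplicity = Fin size → ℕ

    _+𝟏 : Multiplicity → Multiplicity
    (m +𝟏) H = suc (m H)

  S : CommutativeRing c ℓ₁
  S = fieldRing K [X l ]

  private
    module S = CommutativeRing S
  open Multivariate (fieldRing K)
  open SemiringDivisibility S.semiring using (_∣_; _,_; x∣ʳyx; x∣ʳy⇒x∣ʳzy; ∣ʳ-respʳ-≈; _∣0)
  open SemiringExp S.semiring using (_^_)
  open SemiringSum S.semiring
    using (sum; sum-cong-≋; sum-replicate-zero; ∑-distrib-+; *-distribˡ-sum; *-distribʳ-sum)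
  open CommutativeSemigroupProperties S.*-commutativeSemigroup using (x∙yz≈y∙xz)
  open SetoidReasoning S.setoid

  form : LinearForm → S.Carrier
  form a = sum λ i → constant l (a i) S.* var i

  -- Σᵢ fᵢ ∂ᵢ is represented by i ↦ fᵢ.

  Derivation : Set c
  Derivation = Fin l → S.Carrier

  Der : LeftModule S.ring c ℓ₁
  Der = record
    { Carrierᴹ = Derivation
    ; _≈ᴹ_ = λ θ η → ∀ i → θ i S.≈ η i
    ; _+ᴹ_ = λ θ η i → θ i S.+ η i
    ; _*ₗ_ = λ f θ i → f S.* θ i
    ; 0ᴹ = λ _ → S.0#
    ; -ᴹ_ = λ θ i → S.- θ i
    ; isLeftModule = record
      { isLeftSemimodule = record
        { +ᴹ-isCommutativeMonoid = record
          { isMonoid = record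
            { isSemigroup = record
              { isMagma = record
                { isEquivalence = record
                  { refl = λ _ → S.refl
                  ; sym = λ e i → S.sym (e i)
                  ; trans = λ e f i → S.trans (e i) (f i)
                  }
                ; ∙-cong = λ e f i → S.+-cong (e i) (f i)
                }
              ; assoc = λ θ η ζ i → S.+-assoc (θ i) (η i) (ζ i)
              }
            ; identity = (λ θ i → S.+-identityˡ (θ i)) , (λ θ i → S.+-identityʳ (θ i))
            }
          ; comm = λ θ η i → S.+-comm (θ i) (η i)
          }
        ; isPreleftSemimodule = record
          { *ₗ-cong = λ e f i → S.*-cong e (f i)
          ; *ₗ-zeroˡ = λ θ i → S.zeroˡ (θ i)
          ; *ₗ-distribʳ = λ θ f g i → S.distribʳ (θ i) f g
          ; *ₗ-identityˡ = λ θ i → S.*-identityˡ (θ i)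
          ; *ₗ-assoc = λ f g θ i → S.*-assoc f g (θ i)
          ; *ₗ-zeroʳ = λ f i → S.zeroʳ f
          ; *ₗ-distribˡ = λ f θ η i → S.distribˡ f (θ i) (η i)
          }
        }
      ; -ᴹ‿cong = λ e i → S.-‿cong (e i)
      ; -ᴹ‿inverse = (λ θ i → S.-‿inverseˡ (θ i)) , (λ θ i → S.-‿inverseʳ (θ i))
      }
    }

  open LeftModule Der public using () renaming (_≈ᴹ_ to _≈ᴰ_; 0ᴹ to 0ᴰ)
  open LeftModule Der using (_+ᴹ_; _*ₗ_; -ᴹ_)

  infix 8 _⟪_⟫
  _⟪_⟫ : Derivation → S.Carrier → S.Carrier
  θ ⟪ f ⟫ = sum λ i → θ i S.* ∂ i f

  θ-Euler : Derivation
  θ-Euler = var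

  ∇ : Derivation → Derivation → Derivation
  ∇ φ θ i = φ ⟪ θ i ⟫

  HomogeneousOfDegree : ℕ → Derivation → Set (c ⊔ ℓ₁)
  HomogeneousOfDegree k θ =
    ¬ θ ≈ᴰ 0ᴰ ×
    (∀ a → ¬ θ ⟪ form a ⟫ S.≈ S.0# → IsHomogeneous {l} k (θ ⟪ form a ⟫))

  ⟪⟫-+ : ∀ θ η f → (θ +ᴹ η) ⟪ f ⟫ S.≈ θ ⟪ f ⟫ S.+ η ⟪ f ⟫
  ⟪⟫-+ θ η f = S.trans
    (sum-cong-≋ λ (i : Fin l) → S.distribʳ (∂ i f) (θ i) (η i))
    (∑-distrib-+ (λ i → θ i S.* ∂ i f) (λ i → η i S.* ∂ i f))

  ⟪⟫-* : ∀ g θ f → (g *ₗ θ) ⟪ f ⟫ S.≈ g S.* θ ⟪ f ⟫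
  ⟪⟫-* g θ f = S.trans
    (sum-cong-≋ λ (i : Fin l) → S.*-assoc g (θ i) (∂ i f))
    (S.sym (*-distribˡ-sum g (λ i → θ i S.* ∂ i f)))

  ⟪⟫-0 : ∀ f → 0ᴰ ⟪ f ⟫ S.≈ S.0#
  ⟪⟫-0 f = S.trans (sum-cong-≋ λ (i : Fin l) → S.zeroˡ (∂ i f)) (sum-replicate-zero l)

  ⟪⟫-neg : ∀ θ f → (-ᴹ θ) ⟪ f ⟫ S.≈ (S.- S.1#) S.* θ ⟪ f ⟫
  ⟪⟫-neg θ f = S.trans
    (sum-cong-≋ λ (i : Fin l) → S.*-congʳ (S.sym (-1*x≈-x (θ i))))
    (⟪⟫-* (S.- S.1#) θ f)
    where open RingProperties S.ring using (-1*x≈-x)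

  ⟪⟫-isDerivation : ∀ θ → IsDerivation S (θ ⟪_⟫)
  ⟪⟫-isDerivation θ = record
    { D-cong = λ e → sum-cong-≋ λ (i : Fin l) → S.*-congˡ (D-cong i e)
    ; D-+ = λ f g → S.trans
        (sum-cong-≋ λ (i : Fin l) → S.trans (S.*-congˡ (D-+ i f g)) (S.distribˡ _ _ _))
        (∑-distrib-+ (λ i → θ i S.* ∂ i f) (λ i → θ i S.* ∂ i g))
    ; leibniz = λ f g → begin
        sum (λ i → θ i S.* ∂ i (f S.* g))
          ≈⟨ sum-cong-≋ (λ (i : Fin l) → S.trans (S.*-congˡ (leibniz i f g)) (S.distribˡ _ _ _)) ⟩
        sum (λ i → θ i S.* (∂ i f S.* g) S.+ θ i S.* (f S.* ∂ i g))
          ≈⟨ sum-cong-≋ (λ (i : Fin l) → S.+-cong (S.sym (S.*-assoc (θ i) (∂ i f) g))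
               (x∙yz≈y∙xz (θ i) f (∂ i g))) ⟩
        sum (λ i → (θ i S.* ∂ i f) S.* g S.+ f S.* (θ i S.* ∂ i g))
          ≈⟨ ∑-distrib-+ (λ i → (θ i S.* ∂ i f) S.* g) (λ i → f S.* (θ i S.* ∂ i g)) ⟩
        sum (λ i → (θ i S.* ∂ i f) S.* g) S.+ sum (λ i → f S.* (θ i S.* ∂ i g))
          ≈⟨ S.+-cong (*-distribʳ-sum g (λ i → θ i S.* ∂ i f))
               (*-distribˡ-sum f (λ i → θ i S.* ∂ i g)) ⟨
        θ ⟪ f ⟫ S.* g S.+ f S.* θ ⟪ g ⟫ ∎
    }
    where open module ∂ (i : Fin l) = IsDerivation (∂-isDerivation i) using (D-cong; D-+; leibniz)

  ∣-+ : ∀ {x y z} → x ∣ y → x ∣ z → x ∣ (y S.+ z)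
  ∣-+ {x} (p , e) (q , f) = p S.+ q , S.trans (S.distribʳ x p q) (S.+-cong e f)

  module _ {D : S.Carrier → S.Carrier} (isD : IsDerivation S D) where

    open IsDerivation isD

    D-sum : ∀ {n} (f : Fin n → S.Carrier) → D (sum f) S.≈ sum (λ i → D (f i))
    D-sum {zero}  f = D-0#
    D-sum {suc n} f = S.trans (D-+ _ _) (S.+-congˡ (D-sum (λ i → f (suc i))))

    xⁿ∣D[x¹⁺ⁿ] : ∀ x n → (x ^ n) ∣ D (x ^ suc n)
    xⁿ∣xD[xⁿ] : ∀ x n → (x ^ n) ∣ (x S.* D (x ^ n))

    xⁿ∣D[x¹⁺ⁿ] x n = ∣ʳ-respʳ-≈ (S.sym (leibniz x (x ^ n)))
      (∣-+ (x∣ʳyx (x ^ n) (D x)) (xⁿ∣xD[xⁿ] x n))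

    xⁿ∣xD[xⁿ] x zero    = _ , S.*-identityʳ _
    xⁿ∣xD[xⁿ] x (suc n) with xⁿ∣D[x¹⁺ⁿ] x n
    ... | q , e = q , S.trans (x∙yz≈y∙xz q x (x ^ n)) (S.*-congˡ e)

    ∣-D : ∀ x n {f} → (x ^ suc n) ∣ f → (x ^ n) ∣ D f
    ∣-D x n (q , e) = ∣ʳ-respʳ-≈ (S.trans (S.sym (leibniz q (x ^ suc n))) (D-cong e))
      (∣-+ (x∣ʳy⇒x∣ʳzy (D q) (x∣ʳyx (x ^ n) x))
           (x∣ʳy⇒x∣ʳzy q (xⁿ∣D[x¹⁺ⁿ] x n)))

  ⟪⟫-∂-form : ∀ φ i a → φ ⟪ ∂ i (form a) ⟫ S.≈ S.0#
  ⟪⟫-∂-form φ i a = S.trans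
    (sum-cong-≋ λ (j : Fin l) → S.trans (S.*-congˡ (∂∂-form j)) (S.zeroʳ (φ j)))
    (sum-replicate-zero l)
    where
    open module ∂ (i : Fin l) = IsDerivation (∂-isDerivation i) using (D-cong; D-+; D-0#; leibniz)

    ∂-constant-* : ∀ i b f → ∂ i (constant l b S.* f) S.≈ constant l b S.* ∂ i f
    ∂-constant-* i b f = begin
      ∂ i (constant l b S.* f)                               ≈⟨ leibniz i _ f ⟩
      ∂ i (constant l b) S.* f S.+ constant l b S.* ∂ i f
        ≈⟨ S.+-congʳ (S.trans (S.*-congʳ (∂-constant i b)) (S.zeroˡ f)) ⟩
      S.0# S.+ constant l b S.* ∂ i f                        ≈⟨ S.+-identityˡ _ ⟩
      constant l b S.* ∂ i f                                 ∎

    ∂∂-term : ∀ j k → ∂ j (∂ i (constant l (a k) S.* var k)) S.≈ S.0#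
    ∂∂-term j k = begin
      ∂ j (∂ i (constant l (a k) S.* var k))    ≈⟨ D-cong j (∂-constant-* i (a k) (var k)) ⟩
      ∂ j (constant l (a k) S.* ∂ i (var k))    ≈⟨ ∂-constant-* j (a k) (∂ i (var k)) ⟩
      constant l (a k) S.* ∂ j (∂ i (var k))    ≈⟨ S.*-congˡ (∂∂-var j i k) ⟩
      constant l (a k) S.* S.0#                 ≈⟨ S.zeroʳ _ ⟩
      S.0#                                      ∎

    ∂∂-form : ∀ j → ∂ j (∂ i (form a)) S.≈ S.0#
    ∂∂-form j = begin
      ∂ j (∂ i (form a))
        ≈⟨ D-cong j (D-sum (∂-isDerivation i) (λ k → constant l (a k) S.* var k)) ⟩
      ∂ j (sum (λ k → ∂ i (constant l (a k) S.* var k)))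
        ≈⟨ D-sum (∂-isDerivation j) (λ k → ∂ i (constant l (a k) S.* var k)) ⟩
      sum (λ k → ∂ j (∂ i (constant l (a k) S.* var k)))
        ≈⟨ sum-cong-≋ (∂∂-term j) ⟩
      sum (λ (k : Fin l) → S.0#)
        ≈⟨ sum-replicate-zero l ⟩
      S.0# ∎

  ∇-⟪form⟫ : ∀ φ θ a → (∇ φ θ) ⟪ form a ⟫ S.≈ φ ⟪ θ ⟪ form a ⟫ ⟫
  ∇-⟪form⟫ φ θ a = S.sym (begin
    φ ⟪ sum (λ i → θ i S.* ∂ i (form a)) ⟫
      ≈⟨ D-sum (⟪⟫-isDerivation φ) (λ i → θ i S.* ∂ i (form a)) ⟩
    sum (λ i → φ ⟪ θ i S.* ∂ i (form a) ⟫)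
      ≈⟨ sum-cong-≋ (λ (i : Fin l) → S.trans (leibniz (θ i) (∂ i (form a)))
           (S.trans (S.+-congˡ (S.trans (S.*-congˡ (⟪⟫-∂-form φ i a)) (S.zeroʳ (θ i))))
             (S.+-identityʳ _))) ⟩
    sum (λ i → φ ⟪ θ i ⟫ S.* ∂ i (form a)) ∎)
    where open IsDerivation (⟪⟫-isDerivation φ)

  module _ (A : Arrangement) where

    open Arrangement A

    InD : Multiplicity → Pred Derivation (c ⊔ ℓ₁)
    InD m θ = ∀ H → (form (α H) ^ m H) ∣ θ ⟪ form (α H) ⟫

    InD-isSubmodule : ∀ m → IsSubmodule Der (InD m)
    InD-isSubmodule m = record
      { +-closed = λ {θ} {η} p q H →
          ∣ʳ-respʳ-≈ (S.sym (⟪⟫-+ θ η _)) (∣-+ (p H) (q H))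
      ; 0-closed = λ H → ∣ʳ-respʳ-≈ (S.sym (⟪⟫-0 _)) (_ ∣0)
      ; neg-closed = λ {θ} p H →
          ∣ʳ-respʳ-≈ (S.sym (⟪⟫-neg θ _)) (x∣ʳy⇒x∣ʳzy (S.- S.1#) (p H))
      ; *-closed = λ g {θ} p H →
          ∣ʳ-respʳ-≈ (S.sym (⟪⟫-* g θ _)) (x∣ʳy⇒x∣ʳzy g (p H))
      }

    D : Multiplicity → LeftModule S.ring (c ⊔ ℓ₁) ℓ₁
    D m = submodule Der (InD-isSubmodule m)

    TotallyFree : Set (lsuc (c ⊔ ℓ₁))
    TotallyFree = ∀ m → IsFree (D m)

    ∇-InD : ∀ m {θ} → InD (m +𝟏) θ → ∀ φ → InD m (∇ φ θ)
    ∇-InD m {θ} p φ H = ∣ʳ-respʳ-≈ (S.sym (∇-⟪form⟫ φ θ (α H)))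
      (∣-D (⟪⟫-isDerivation φ) (form (α H)) (m H) (p H))

    ∇[_] : ∀ {m} → LeftModule.Carrierᴹ (D (m +𝟏)) → Derivation → LeftModule.Carrierᴹ (D m)
    ∇[_] {m} (θ , p) φ = ∇ φ θ , ∇-InD m p φ

    record IsUniversal (m : Multiplicity) (θ : LeftModule.Carrierᴹ (D (m +𝟏)))
                       : Set (c ⊔ ℓ₁) where
      open LeftModuleMorphisms (LeftModule.rawLeftModule Der) (LeftModule.rawLeftModule (D m))
      field
        homogeneous   : ∃[ k ] HomogeneousOfDegree k (proj₁ θ)
        isIsomorphism : IsLeftModuleIsomorphism (∇[_] {m} θ)

module Submission where

-- Let K be the field of fractions of ℤ[t], and let A consist of the lines
-- x = 0, y = 0, x = y and x = t y in K².
--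
-- A is totally free.  Let α be the equation of a line H.  The map
-- θ ↦ θ(α) / α^m(H) modulo α from D(A,m) to S/α ≅ K[z] is S-linear, and its
-- kernel is the module for the multiplicity that is m(H) + 1 on H and m on
-- the other lines.  Euclid's algorithm, applied to the images of the two
-- elements of a basis, changes the basis by elementary transformations
-- until one of the images is zero.  If the other image is not zero,
-- multiplying the element that it belongs to by α gives a basis of the
-- kernel; if it is, the kernel is everything (Raising.raise).  Starting
-- from Der = D(A,0), this gives a basis of every D(A,m), whose determinant
-- is nonzero and homogeneous of degree at most |m|.
--
-- Let θ = f ∂x + g ∂y be m-universal of degree k, with m ≠ 0.  Because
-- φ ↦ ∇ φ θ is injective, θ(α) ≠ 0 for every line, whence m(H) + 1 ≤ k.
-- Because it is surjective, the determinant of a basis of D(A,m) is a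
-- multiple of the Jacobian determinant of f and g, whence 2k - 2 ≤ |m|.
-- Write a, b, c, d for the values of m + 1 at x, x - t y, x - y and y, so
-- that a + b + c + d ≥ 2k + 2.  It remains to show that θ = 0,
-- contrary to the definition of a homogeneous derivation, follows from
--
--   x^a ∣ f,   (x - t y)^b ∣ f - t g,   (x - y)^c ∣ f - g,   y^d ∣ g.
--
-- Let f_n and g_n be the coefficients of x^n y^(k-n), and put
-- P_n = f_n - g_n and R_n = t^n (f_n - t g_n).  The second and the third
-- condition say that the moments of R of order less than b and those of P
-- of order less than c vanish.  The first says that R_n = t^(n+1) P_n for
-- n < a, and the last that R_n = t^n P_n for n > k - d.  All terms may be
-- taken in ℤ[t].  Fix a number ω, and compare the coefficients of t^j in R
-- with those of t^(j-ω) in P, by induction on j.  If R_n = t^w P_n with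
-- w > ω, then the former is an earlier coefficient of P_n, hence zero.  For
-- a suitable ω this leaves at most b places n, and there the coefficients
-- of R vanish by the Vandermonde determinant.  If R_n = t^w P_n with w ≤ ω,
-- then the coefficient of P_n is a coefficient of R_n that is already known
-- to be zero.  This leaves at most c places, and the moments of P take care
-- of them (cut⇒zero).  Such an ω exists (linked⇒zero) unless two links have
-- the same weight at the wrong place, namely when a = b, c = d and
-- a + d = k + 1.  In that case one term more survives in R and in P, and
-- comparing the two linear relations between the surviving terms shows that
-- they vanish unless a d = 1 (tie⇒zero), that is, unless m = 0.

open import Algebra.Apartness.Bundles using (HeytingField)
open import Algebra.Module.Bundles using (LeftModule)
open import Data.Nat.Base using (ℕ; _≤_)
open import Data.Product.Base using (Σ; _×_; proj₁)
open import Level using (0ℓ)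
open import Relation.Binary.PropositionalEquality.Core using (_≡_)
open import Relation.Nullary.Negation.Core using (¬_)
open import Defs

open import Algebra.Bundles using (CommutativeRing)
import Algebra.Definitions.RawMonoid as RawMonoidDefs
open import Algebra.Module.Morphism.Structures using (module LeftModuleMorphisms)
import Algebra.Properties.CommutativeSemigroup as CommutativeSemigroupProperties
import Algebra.Properties.Group as GroupProperties
import Algebra.Properties.Ring as RingProperties
import Algebra.Properties.Semiring.Divisibility as SemiringDivisibility
import Algebra.Properties.Semiring.Exp as SemiringExp
import Algebra.Properties.Semiring.Mult.TCOptimised as Mult
import Algebra.Properties.Semiring.Sum as SemiringSum
import Algebra.Solver.Ring as RingSolver
open import Algebra.Solver.Ring.AlmostCommutativeRing
  using (AlmostCommutativeRing; fromCommutativeRing; _-Raw-AlmostCommutative⟶_)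
open import Data.Empty using (⊥)
open import Data.Fin.Base using (Fin; zero; suc)
open import Data.Fin.Patterns using (0F; 1F; 2F; 3F)
import Data.Fin.Properties as Fin
open import Data.Integer.Base as ℤ using (ℤ; +_; -[1+_])
import Data.Integer.Properties as ℤ
open import Data.List.Base using (List; []; _∷_; map; length)
open import Data.Maybe.Base using (Maybe; just; nothing)
open import Data.Nat.Base as ℕ using (zero; suc; z≤n; s≤s; s≤s⁻¹)
import Data.Nat.Properties as ℕ
open import Data.Nat.Tactic.RingSolver using (solve-∀)
open import Data.Product.Base using (∃-syntax; _,_; proj₂)
open import Data.Sum.Base as Sum using (_⊎_; inj₁; inj₂; [_,_]′)
import Data.Vec.Base as Vec
open import Function.Base using (_∘_; id)
open import Function.Definitions using (Injective)
open import Relation.Binary.PropositionalEquality as ≡ using (_≢_)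
import Relation.Binary.Reasoning.Setoid as SetoidReasoning
open import Relation.Nullary.Decidable.Core using (Dec; yes; no)
open import Relation.Nullary.Negation.Core using (contradiction)
open import Relation.Unary using (Pred)

-- Integers in a commutative ring

-- The ring homomorphism from the integers.

module Integers (R : CommutativeRing 0ℓ 0ℓ) where

  open CommutativeRing R
  open RingProperties ring
    using (-‿distribˡ-*; -‿distribʳ-*; -‿involutive; -0#≈0#; -‿+-comm)
  open Mult semiring using (×-homo-+; ×1-homo-*; 1+×) renaming (_×_ to _·_)
  open import Relation.Binary.Reasoning.Setoid setoid

  fromℤ : ℤ → Carrier
  fromℤ (+ n)      = n · 1#
  fromℤ (-[1+ n ]) = - (suc n · 1#)

  fromℤ-neg : ∀ i → fromℤ (ℤ.- i) ≈ - fromℤ i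
  fromℤ-neg (+ zero)  = sym -0#≈0#
  fromℤ-neg (+ suc n) = refl
  fromℤ-neg -[1+ n ]  = sym (-‿involutive _)

  fromℤ-⊖ : ∀ m n → fromℤ (m ℤ.⊖ n) ≈ m · 1# - n · 1#
  fromℤ-⊖ m zero = sym (trans (+-congˡ -0#≈0#) (+-identityʳ _))
  fromℤ-⊖ zero (suc n) = sym (+-identityˡ _)
  fromℤ-⊖ (suc m) (suc n) = begin
    fromℤ (suc m ℤ.⊖ suc n)              ≡⟨ ≡.cong fromℤ (ℤ.[1+m]⊖[1+n]≡m⊖n m n) ⟩
    fromℤ (m ℤ.⊖ n)                      ≈⟨ fromℤ-⊖ m n ⟩
    x - y                                ≈⟨ +-congʳ (+-identityʳ x) ⟨
    x + 0# - y                           ≈⟨ +-congʳ (+-congˡ (-‿inverseʳ 1#)) ⟨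
    x + (1# - 1#) - y                    ≈⟨ +-congʳ (+-assoc _ _ _) ⟨
    x + 1# - 1# - y                      ≈⟨ +-assoc _ _ _ ⟩
    x + 1# + (- 1# - y)                  ≈⟨ +-cong (+-comm x 1#) (-‿+-comm 1# y) ⟩
    1# + x - (1# + y)                    ≈⟨ +-cong (1+× m 1#) (-‿cong (1+× n 1#)) ⟨
    suc m · 1# - suc n · 1#              ∎
    where
    x = m · 1#
    y = n · 1#

  fromℤ-+ : ∀ i j → fromℤ (i ℤ.+ j) ≈ fromℤ i + fromℤ j
  fromℤ-+ (+ m)    (+ n)    = ×-homo-+ 1# m n
  fromℤ-+ (+ m)    -[1+ n ] = fromℤ-⊖ m (suc n)
  fromℤ-+ -[1+ m ] (+ n)    = trans (fromℤ-⊖ n (suc m)) (+-comm _ _)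
  fromℤ-+ -[1+ m ] -[1+ n ] = begin
    - (suc (suc (m ℕ.+ n)) · 1#)
      ≡⟨ ≡.cong (λ k → - (k · 1#)) (≡.cong suc (≡.sym (ℕ.+-suc m n))) ⟩
    - ((suc m ℕ.+ suc n) · 1#)        ≈⟨ -‿cong (×-homo-+ 1# (suc m) (suc n)) ⟩
    - (suc m · 1# + suc n · 1#)       ≈⟨ -‿+-comm _ _ ⟨
    - (suc m · 1#) + - (suc n · 1#)   ∎

  private
    fromℤ-*⁺ : ∀ m j → fromℤ (+ m ℤ.* j) ≈ fromℤ (+ m) * fromℤ j
    fromℤ-*⁺ m (+ n) = trans (reflexive (≡.cong fromℤ (≡.sym (ℤ.pos-* m n)))) (×1-homo-* m n)
    fromℤ-*⁺ m -[1+ n ] = begin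
      fromℤ (+ m ℤ.* -[1+ n ])     ≡⟨ ≡.cong fromℤ (ℤ.neg-distribʳ-* (+ m) (+ suc n)) ⟨
      fromℤ (ℤ.- (+ m ℤ.* + suc n)) ≈⟨ fromℤ-neg (+ m ℤ.* + suc n) ⟩
      - fromℤ (+ m ℤ.* + suc n)    ≈⟨ -‿cong (fromℤ-*⁺ m (+ suc n)) ⟩
      - (m · 1# * (suc n · 1#))    ≈⟨ -‿distribʳ-* _ _ ⟩
      m · 1# * - (suc n · 1#)      ∎

  fromℤ-* : ∀ i j → fromℤ (i ℤ.* j) ≈ fromℤ i * fromℤ j
  fromℤ-* (+ m)    j = fromℤ-*⁺ m j
  fromℤ-* -[1+ m ] j = begin
    fromℤ (-[1+ m ] ℤ.* j)        ≡⟨ ≡.cong fromℤ (ℤ.neg-distribˡ-* (+ suc m) j) ⟨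
    fromℤ (ℤ.- (+ suc m ℤ.* j))   ≈⟨ fromℤ-neg (+ suc m ℤ.* j) ⟩
    - fromℤ (+ suc m ℤ.* j)       ≈⟨ -‿cong (fromℤ-*⁺ (suc m) j) ⟩
    - (suc m · 1# * fromℤ j)      ≈⟨ -‿distribˡ-* _ _ ⟩
    - (suc m · 1#) * fromℤ j      ∎

-- The normaliser for commutative rings with integer coefficients.

module IntegerSolver (R : CommutativeRing 0ℓ 0ℓ) where

  open CommutativeRing R
  open Integers R

  private
    almostCommutativeRing : AlmostCommutativeRing 0ℓ 0ℓ
    almostCommutativeRing = fromCommutativeRing R

    homomorphism : CommutativeRing.rawRing ℤ.+-*-commutativeRing
                   -Raw-AlmostCommutative⟶ almostCommutativeRing
    homomorphism = record
      { ⟦_⟧ = fromℤ ; +-homo = fromℤ-+ ; *-homo = fromℤ-* ; -‿homo = fromℤ-neg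
      ; 0-homo = refl ; 1-homo = refl }

    fromℤ-≟ : ∀ i j → Maybe (fromℤ i ≈ fromℤ j)
    fromℤ-≟ i j with i ℤ.≟ j
    ... | yes ≡.refl = just refl
    ... | no  _      = nothing

  open RingSolver (CommutativeRing.rawRing ℤ.+-*-commutativeRing) almostCommutativeRing
    homomorphism fromℤ-≟
    public using (solve; _:=_; _:+_; _:*_; :-_; _:-_; con)

-- Integral domains, polynomial rings and fields of fractions

-- An integral domain with decidable equality.

record IsDomain (R : CommutativeRing 0ℓ 0ℓ) : Set where
  open CommutativeRing R
  field
    1≉0         : ¬ 1# ≈ 0#
    zero?       : ∀ x → Dec (x ≈ 0#)
    zeroProduct : ∀ {x y} → x * y ≈ 0# → x ≈ 0# ⊎ y ≈ 0#

  *-cancelˡ-0 : ∀ {x y} → ¬ x ≈ 0# → x * y ≈ 0# → y ≈ 0#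
  *-cancelˡ-0 x≉0 xy≈0 = [ (λ x≈0 → contradiction x≈0 x≉0) , id ]′ (zeroProduct xy≈0)

  *-nonzero : ∀ {x y} → ¬ x ≈ 0# → ¬ y ≈ 0# → ¬ x * y ≈ 0#
  *-nonzero x≉0 y≉0 xy≈0 = y≉0 (*-cancelˡ-0 x≉0 xy≈0)

  *-cancelˡ : ∀ {x y z} → ¬ x ≈ 0# → x * y ≈ x * z → y ≈ z
  *-cancelˡ {x} {y} {z} x≉0 e = x∙y⁻¹≈ε⇒x≈y y z (*-cancelˡ-0 x≉0 (trans
    (solve 3 (λ x y z → x :* (y :- z) := x :* y :- x :* z) refl x y z)
    (x≈y⇒x∙y⁻¹≈ε e)))
    where
    open GroupProperties +-group using (x∙y⁻¹≈ε⇒x≈y; x≈y⇒x∙y⁻¹≈ε)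
    open IntegerSolver R

  *-cancelʳ : ∀ {x y z} → ¬ x ≈ 0# → y * x ≈ z * x → y ≈ z
  *-cancelʳ x≉0 e = *-cancelˡ x≉0 (trans (*-comm _ _) (trans e (*-comm _ _)))

-- Every nonzero element has an inverse.

HasInverses : CommutativeRing 0ℓ 0ℓ → Set
HasInverses R = ∀ a → ¬ a ≈ 0# → ∃[ b ] b * a ≈ 1#
  where open CommutativeRing R

-- Characteristic zero.

CharZero : CommutativeRing 0ℓ 0ℓ → Set
CharZero R = ∀ n → n · 1# ≈ 0# → n ≡ 0
  where
  open CommutativeRing R
  open RawMonoidDefs +-rawMonoid using () renaming (_×_ to _·_)

ℤ-isDomain : IsDomain ℤ.+-*-commutativeRing
ℤ-isDomain = record
  { 1≉0 = λ ()
  ; zero? = λ i → i ℤ.≟ ℤ.0ℤ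
  ; zeroProduct = λ {i} → ℤ.i*j≡0⇒i≡0∨j≡0 i
  }

module _ {R : CommutativeRing 0ℓ 0ℓ} (isDomain : IsDomain R) where

  open CommutativeRing R
  open Univariate R
  open IsDomain isDomain

  private

    isZero? : ∀ p → Dec (p ≋ [])
    isZero? [] = yes ≋-refl
    isZero? (a ∷ p) with zero? a | isZero? p
    ... | yes a≈0 | yes p≋[] = yes (≋-trans (∷-cong a≈0 p≋[]) (∷-zero ≋-refl))
    ... | no  a≉0 | _        = no λ e → a≉0 (coeffs e 0)
    ... | _       | no p≋̸[]  = no λ e → p≋̸[] (mk≋ λ n → coeffs e (suc n))

    tail≋[] : ∀ {a p} → (a ∷ p) ≋ [] → p ≋ []
    tail≋[] e = mk≋ λ n → coeffs e (suc n)

    dropZero : ∀ {a} p → a ≈ 0# → (a ∷ p) ≋ (0# ∷ p)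
    dropZero p a≈0 = ∷-cong a≈0 ≋-refl

    ⊗-zeroProduct : ∀ p q → p ⊗ q ≋ [] → p ≋ [] ⊎ q ≋ []
    ⊗-zeroProduct []      q = λ _ → inj₁ ≋-refl
    ⊗-zeroProduct (a ∷ p) q = go q
      where
      go : ∀ q → (a ∷ p) ⊗ q ≋ [] → (a ∷ p) ≋ [] ⊎ q ≋ []
      go []      e = inj₂ ≋-refl
      go (b ∷ q) e with zero? a | zero? b
      ... | no a≉0 | no b≉0 =
            contradiction (trans (sym (+-identityʳ (a * b))) (coeffs e 0)) (*-nonzero a≉0 b≉0)
      ... | yes a≈0 | _ = Sum.map₁ (λ p≋[] → ≋-trans (dropZero p a≈0) (∷-zero p≋[]))
            (⊗-zeroProduct p (b ∷ q) (tail≋[] (≋-trans (≋-sym shifted) e)))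
        where
        shifted : (a ∷ p) ⊗ (b ∷ q) ≋ 0# ∷ (p ⊗ (b ∷ q))
        shifted = ≋-trans (⊗-cong (dropZero p a≈0) (≋-refl {b ∷ q})) (shift-⊗ p (b ∷ q))
      ... | no _ | yes b≈0 = Sum.map₂ (λ q≋[] → ≋-trans (dropZero q b≈0) (∷-zero q≋[]))
            (go q (tail≋[] (≋-trans (≋-sym shifted) e)))
        where
        shifted : (a ∷ p) ⊗ (b ∷ q) ≋ 0# ∷ ((a ∷ p) ⊗ q)
        shifted = ≋-trans (⊗-congˡ (a ∷ p) (dropZero q b≈0))
          (≋-trans (⊗-comm (a ∷ p) (0# ∷ q))
          (≋-trans (shift-⊗ q (a ∷ p)) (∷-cong refl (⊗-comm q (a ∷ p)))))

  polynomial-isDomain : IsDomain polynomialRing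
  polynomial-isDomain = record
    { 1≉0 = λ e → 1≉0 (coeffs e 0)
    ; zero? = isZero?
    ; zeroProduct = λ {p} {q} → ⊗-zeroProduct p q
    }

module _ (R : CommutativeRing 0ℓ 0ℓ) where

  open CommutativeRing R
  open Univariate R
  open RawMonoidDefs +-rawMonoid using () renaming (_×_ to _·_)
  private
    module P = CommutativeRing polynomialRing
    open RawMonoidDefs P.+-rawMonoid using () renaming (_×_ to _·ₚ_)

  coeff-× : ∀ m p n → coeff (m ·ₚ p) n ≈ m · coeff p n
  coeff-× zero    p n = refl
  coeff-× (suc m) p n = trans (coeff-⊕ p (m ·ₚ p) n) (+-congˡ (coeff-× m p n))

  polynomial-charZero : CharZero R → CharZero polynomialRing
  polynomial-charZero char n e = char n (trans (sym (coeff-× n P.1# 0)) (coeffs e 0))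

ℤ-charZero : CharZero ℤ.+-*-commutativeRing
ℤ-charZero n e = ℤ.+-injective (≡.trans (≡.sym (n·1 n)) e)
  where
  open RawMonoidDefs ℤ.+-0-rawMonoid using () renaming (_×_ to _·_)
  n·1 : ∀ n → n · ℤ.1ℤ ≡ + n
  n·1 zero    = ≡.refl
  n·1 (suc n) = ≡.cong ℤ.suc (n·1 n)

-- The field of fractions of an integral domain.

module Fractions {R : CommutativeRing 0ℓ 0ℓ} (isDomain : IsDomain R) where

  private module R = CommutativeRing R
  open IsDomain isDomain
  open IntegerSolver R

  infix 4 _≃_
  infixl 5 _/_[_]

  -- Fractions are not reduced, so equality compares cross products.

  record Fraction : Set where
    constructor _/_[_]
    field
      num     : R.Carrier
      den     : R.Carrier
      nonzero : ¬ den R.≈ R.0#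
  open Fraction

  record _≃_ (x y : Fraction) : Set where
    constructor mk≃
    field
      crossProducts : num x R.* den y R.≈ num y R.* den x
  open _≃_

  private

    open import Relation.Binary.Reasoning.Setoid R.setoid

    ≃-trans : ∀ {x y z} → x ≃ y → y ≃ z → x ≃ z
    ≃-trans {a / b [ _ ]} {c / d [ d≉0 ]} {e / f [ _ ]} (mk≃ p) (mk≃ q) = mk≃ (*-cancelˡ d≉0 (begin
      d R.* (a R.* f)    ≈⟨ solve 3 (λ d a f → d :* (a :* f) := f :* (a :* d)) R.refl d a f ⟩
      f R.* (a R.* d)    ≈⟨ R.*-congˡ p ⟩
      f R.* (c R.* b)    ≈⟨ solve 3 (λ f c b → f :* (c :* b) := b :* (c :* f)) R.refl f c b ⟩
      b R.* (c R.* f)    ≈⟨ R.*-congˡ q ⟩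
      b R.* (e R.* d)    ≈⟨ solve 3 (λ b e d → b :* (e :* d) := d :* (e :* b)) R.refl b e d ⟩
      d R.* (e R.* b)    ∎))

  -- The embedding of R.

  fromBase : R.Carrier → Fraction
  fromBase a = a / R.1# [ 1≉0 ]

  infixl 6 _+_
  infixl 7 _*_
  infix  8 -_

  _+_ : Fraction → Fraction → Fraction
  (a / b [ b≉0 ]) + (c / d [ d≉0 ]) = (a R.* d R.+ c R.* b) / b R.* d [ *-nonzero b≉0 d≉0 ]

  _*_ : Fraction → Fraction → Fraction
  (a / b [ b≉0 ]) * (c / d [ d≉0 ]) = (a R.* c) / b R.* d [ *-nonzero b≉0 d≉0 ]

  -_ : Fraction → Fraction
  - (a / b [ b≉0 ]) = (R.- a) / b [ b≉0 ]

  private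

    +-cong : ∀ {x x′ y y′} → x ≃ x′ → y ≃ y′ → x + y ≃ x′ + y′
    +-cong {a / b [ _ ]} {a′ / b′ [ _ ]} {c / d [ _ ]} {c′ / d′ [ _ ]} (mk≃ p) (mk≃ q) = mk≃ (begin
      (a R.* d R.+ c R.* b) R.* (b′ R.* d′)
        ≈⟨ solve 6 (λ a b c d b′ d′ → (a :* d :+ c :* b) :* (b′ :* d′)
             := (a :* b′) :* (d :* d′) :+ (c :* d′) :* (b :* b′)) R.refl a b c d b′ d′ ⟩
      (a R.* b′) R.* (d R.* d′) R.+ (c R.* d′) R.* (b R.* b′)
        ≈⟨ R.+-cong (R.*-congʳ p) (R.*-congʳ q) ⟩
      (a′ R.* b) R.* (d R.* d′) R.+ (c′ R.* d) R.* (b R.* b′)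
        ≈⟨ solve 6 (λ a′ b c′ d b′ d′ → (a′ :* b) :* (d :* d′) :+ (c′ :* d) :* (b :* b′)
             := (a′ :* d′ :+ c′ :* b′) :* (b :* d)) R.refl a′ b c′ d b′ d′ ⟩
      (a′ R.* d′ R.+ c′ R.* b′) R.* (b R.* d) ∎)

    *-cong : ∀ {x x′ y y′} → x ≃ x′ → y ≃ y′ → x * y ≃ x′ * y′
    *-cong {a / b [ _ ]} {a′ / b′ [ _ ]} {c / d [ _ ]} {c′ / d′ [ _ ]} (mk≃ p) (mk≃ q) = mk≃ (begin
      (a R.* c) R.* (b′ R.* d′)
        ≈⟨ solve 4 (λ a c b′ d′ → (a :* c) :* (b′ :* d′) := (a :* b′) :* (c :* d′)) R.refl a c b′ d′ ⟩
      (a R.* b′) R.* (c R.* d′)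
        ≈⟨ R.*-cong p q ⟩
      (a′ R.* b) R.* (c′ R.* d)
        ≈⟨ solve 4 (λ a′ b c′ d → (a′ :* b) :* (c′ :* d) := (a′ :* c′) :* (b :* d)) R.refl a′ b c′ d ⟩
      (a′ R.* c′) R.* (b R.* d) ∎)

  fractionRing : CommutativeRing 0ℓ 0ℓ
  fractionRing = record
    { Carrier = Fraction
    ; _≈_ = _≃_
    ; _+_ = _+_
    ; _*_ = _*_
    ; -_ = -_
    ; 0# = fromBase R.0#
    ; 1# = fromBase R.1#
    ; isCommutativeRing = record
      { isRing = record
        { +-isAbelianGroup = record
          { isGroup = record
            { isMonoid = record
              { isSemigroup = record
                { isMagma = record
                  { isEquivalence = record
                    { refl = mk≃ R.refl
                    ; sym = λ (mk≃ p) → mk≃ (R.sym p)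
                    ; trans = ≃-trans
                    }
                  ; ∙-cong = +-cong
                  }
                ; assoc = λ (a / b [ _ ]) (c / d [ _ ]) (e / f [ _ ]) → mk≃ (solve 6
                    (λ a b c d e f →
                      ((a :* d :+ c :* b) :* f :+ e :* (b :* d)) :* (b :* (d :* f))
                      := (a :* (d :* f) :+ (c :* f :+ e :* d) :* b) :* ((b :* d) :* f))
                    R.refl a b c d e f)
                }
              ; identity =
                  (λ (a / b [ _ ]) → mk≃ (solve 2 (λ a b →
                    (con ℤ.0ℤ :* b :+ a :* con ℤ.1ℤ) :* b := a :* (con ℤ.1ℤ :* b)) R.refl a b)) ,
                  (λ (a / b [ _ ]) → mk≃ (solve 2 (λ a b →
                    (a :* con ℤ.1ℤ :+ con ℤ.0ℤ :* b) :* b := a :* (b :* con ℤ.1ℤ)) R.refl a b))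
              }
            ; inverse =
                (λ (a / b [ _ ]) → mk≃ (solve 2 (λ a b →
                  ((:- a) :* b :+ a :* b) :* con ℤ.1ℤ := con ℤ.0ℤ :* (b :* b)) R.refl a b)) ,
                (λ (a / b [ _ ]) → mk≃ (solve 2 (λ a b →
                  (a :* b :+ (:- a) :* b) :* con ℤ.1ℤ := con ℤ.0ℤ :* (b :* b)) R.refl a b))
            ; ⁻¹-cong = λ { {a / b [ _ ]} {c / d [ _ ]} (mk≃ p) → mk≃ (begin
                (R.- a) R.* d   ≈⟨ solve 2 (λ a d → (:- a) :* d := :- (a :* d)) R.refl a d ⟩
                R.- (a R.* d)   ≈⟨ R.-‿cong p ⟩
                R.- (c R.* b)   ≈⟨ solve 2 (λ c b → :- (c :* b) := (:- c) :* b) R.refl c b ⟩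
                (R.- c) R.* b   ∎) }
            }
          ; comm = λ (a / b [ _ ]) (c / d [ _ ]) → mk≃ (solve 4
              (λ a b c d → (a :* d :+ c :* b) :* (d :* b) := (c :* b :+ a :* d) :* (b :* d))
              R.refl a b c d)
          }
        ; *-cong = *-cong
        ; *-assoc = λ (a / b [ _ ]) (c / d [ _ ]) (e / f [ _ ]) → mk≃ (solve 6
            (λ a b c d e f → ((a :* c) :* e) :* (b :* (d :* f)) := (a :* (c :* e)) :* ((b :* d) :* f))
            R.refl a b c d e f)
        ; *-identity =
            (λ (a / b [ _ ]) → mk≃ (solve 2 (λ a b →
              (con ℤ.1ℤ :* a) :* b := a :* (con ℤ.1ℤ :* b)) R.refl a b)) ,
            (λ (a / b [ _ ]) → mk≃ (solve 2 (λ a b →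
              (a :* con ℤ.1ℤ) :* b := a :* (b :* con ℤ.1ℤ)) R.refl a b))
        ; distrib =
            (λ (a / b [ _ ]) (c / d [ _ ]) (e / f [ _ ]) → mk≃ (solve 6
              (λ a b c d e f → (a :* (c :* f :+ e :* d)) :* ((b :* d) :* (b :* f))
                := ((a :* c) :* (b :* f) :+ (a :* e) :* (b :* d)) :* (b :* (d :* f)))
              R.refl a b c d e f)) ,
            (λ (a / b [ _ ]) (c / d [ _ ]) (e / f [ _ ]) → mk≃ (solve 6
              (λ a b c d e f → ((c :* f :+ e :* d) :* a) :* ((d :* b) :* (f :* b))
                := ((c :* a) :* (f :* b) :+ (e :* a) :* (d :* b)) :* ((d :* f) :* b))
              R.refl a b c d e f))
        }
      ; *-comm = λ (a / b [ _ ]) (c / d [ _ ]) → mk≃ (solve 4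
          (λ a b c d → (a :* c) :* (d :* b) := (c :* a) :* (b :* d)) R.refl a b c d)
      }
    }

  private module F = CommutativeRing fractionRing

  ≃0⇒num≈0 : ∀ {x} → x ≃ F.0# → num x R.≈ R.0#
  ≃0⇒num≈0 (mk≃ e) = R.trans (R.sym (R.*-identityʳ _)) (R.trans e (R.zeroˡ _))

  num≈0⇒≃0 : ∀ {x} → num x R.≈ R.0# → x ≃ F.0#
  num≈0⇒≃0 e = mk≃ (R.trans (R.*-identityʳ _) (R.trans e (R.sym (R.zeroˡ _))))

  _≃0? : ∀ x → Dec (x ≃ F.0#)
  x ≃0? with zero? (num x)
  ... | yes e = yes (num≈0⇒≃0 e)
  ... | no ¬e = no (¬e ∘ ≃0⇒num≈0)

  inverse : ∀ x → ¬ x ≃ F.0# → ∃[ y ] y * x ≃ F.1#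
  inverse (a / b [ b≉0 ]) x≄0 =
    b / a [ (λ a≈0 → x≄0 (num≈0⇒≃0 a≈0)) ] ,
    mk≃ (solve 2 (λ a b → (b :* a) :* con ℤ.1ℤ := con ℤ.1ℤ :* (a :* b)) R.refl a b)

  -- Apartness is the negation of equality.

  fractionField : HeytingField 0ℓ 0ℓ 0ℓ
  fractionField = record
    { Carrier = Fraction
    ; _≈_ = _≃_
    ; _#_ = λ x y → ¬ x ≃ y
    ; _+_ = _+_
    ; _*_ = _*_
    ; -_ = -_
    ; 0# = F.0#
    ; 1# = F.1#
    ; isHeytingField = record
      { isHeytingCommutativeRing = record
        { isCommutativeRing = F.isCommutativeRing
        ; isApartnessRelation = record
          { irrefl = λ x≃y x≄y → x≄y x≃y
          ; sym = λ x≄y y≃x → x≄y (F.sym y≃x)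
          ; cotrans = λ {x} {y} → cotrans x y
          }
        ; #⇒invertible = λ {x} {y} x≄y →
            let z , zd≃1 = inverse (x + - y) (x≄y ∘ x∙y⁻¹≈ε⇒x≈y x y)
            in z , zd≃1 , F.trans (F.*-comm (x + - y) z) zd≃1
        ; invertible⇒# = λ {x} {y} (z , zd≃1 , _) x≃y → 1≉0 (R.trans
            (R.sym (R.*-identityʳ R.1#)) (R.trans
            (_≃_.crossProducts (F.trans (F.sym zd≃1) (F.trans
              (F.*-congˡ {z} (x≈y⇒x∙y⁻¹≈ε x≃y)) (F.zeroʳ z))))
            (R.zeroˡ R.1#)))
        }
      ; tight = λ x y → tight x y , λ x≃y x≄y → x≄y x≃y
      }
    }
    where
    open GroupProperties F.+-group using (x∙y⁻¹≈ε⇒x≈y; x≈y⇒x∙y⁻¹≈ε)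

    _≃?_ : ∀ x y → Dec (x ≃ y)
    x ≃? y with (x + - y) ≃0?
    ... | yes e = yes (x∙y⁻¹≈ε⇒x≈y x y e)
    ... | no ¬e = no λ x≃y → ¬e (x≈y⇒x∙y⁻¹≈ε x≃y)

    tight : ∀ x y → ¬ ¬ x ≃ y → x ≃ y
    tight x y ¬x≄y with x ≃? y
    ... | yes x≃y = x≃y
    ... | no  x≄y = contradiction x≄y ¬x≄y

    cotrans : ∀ x y → ¬ x ≃ y → ∀ z → (¬ x ≃ z) ⊎ (¬ z ≃ y)
    cotrans x y x≄y z with x ≃? z
    ... | no  x≄z = inj₁ x≄z
    ... | yes x≃z = inj₂ λ z≃y → x≄y (F.trans x≃z z≃y)

  fraction-isDomain : IsDomain fractionRing
  fraction-isDomain = record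
    { 1≉0 = 1≉0 ∘ ≃0⇒num≈0
    ; zero? = _≃0?
    ; zeroProduct = λ {x} {y} e → Sum.map (num≈0⇒≃0 {x}) (num≈0⇒≃0 {y}) (zeroProduct (≃0⇒num≈0 e))
    }

  fraction-charZero : CharZero R → CharZero fractionRing
  fraction-charZero char n e = char n (≃0⇒num≈0 (F.trans (F.sym (multiple n)) e))
    where
    open RawMonoidDefs R.+-rawMonoid using () renaming (_×_ to _·_)
    open RawMonoidDefs F.+-rawMonoid using () renaming (_×_ to _·ᶠ_)
    multiple : ∀ n → n ·ᶠ F.1# ≃ fromBase (n · R.1#)
    multiple zero    = F.refl
    multiple (suc n) = F.trans (F.+-congˡ {F.1#} (multiple n)) (mk≃ (solve 1
      (λ a → (con ℤ.1ℤ :* con ℤ.1ℤ :+ a :* con ℤ.1ℤ) :* con ℤ.1ℤ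
        := (con ℤ.1ℤ :+ a) :* (con ℤ.1ℤ :* con ℤ.1ℤ)) R.refl (n · R.1#)))

-- Sums, homomorphisms and evaluation of polynomials

-- Sums over n < K.

module Sums (R : CommutativeRing 0ℓ 0ℓ) where

  open CommutativeRing R

  ∑ : ℕ → (ℕ → Carrier) → Carrier
  ∑ zero    u = 0#
  ∑ (suc K) u = ∑ K u + u K

  ∑-cong : ∀ K {u v} → (∀ n → n ℕ.< K → u n ≈ v n) → ∑ K u ≈ ∑ K v
  ∑-cong zero    u≈v = refl
  ∑-cong (suc K) u≈v = +-cong (∑-cong K λ n n<K → u≈v n (ℕ.m<n⇒m<1+n n<K)) (u≈v K ℕ.≤-refl)

  ∑-first : ∀ K u → ∑ (suc K) u ≈ u 0 + ∑ K (u ∘ suc)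
  ∑-first zero    u = +-comm 0# (u 0)
  ∑-first (suc K) u = trans (+-congʳ (∑-first K u)) (+-assoc _ _ _)

  *-distribˡ-∑ : ∀ K a u → a * ∑ K u ≈ ∑ K (λ n → a * u n)
  *-distribˡ-∑ zero    a u = zeroʳ a
  *-distribˡ-∑ (suc K) a u = trans (distribˡ a _ _) (+-congʳ (*-distribˡ-∑ K a u))

  ∑-zero : ∀ K {u} → (∀ n → n ℕ.< K → u n ≈ 0#) → ∑ K u ≈ 0#
  ∑-zero zero    u≈0 = refl
  ∑-zero (suc K) u≈0 = trans
    (+-cong (∑-zero K λ n n<K → u≈0 n (ℕ.m<n⇒m<1+n n<K)) (u≈0 K ℕ.≤-refl)) (+-identityˡ 0#)

-- Homomorphisms of commutative rings.

record IsHomomorphism (R S : CommutativeRing 0ℓ 0ℓ)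
         (φ : CommutativeRing.Carrier R → CommutativeRing.Carrier S) : Set where
  private
    module R = CommutativeRing R
    module S = CommutativeRing S
  field
    cong   : ∀ {x y} → x R.≈ y → φ x S.≈ φ y
    +-homo : ∀ x y → φ (x R.+ y) S.≈ φ x S.+ φ y
    *-homo : ∀ x y → φ (x R.* y) S.≈ φ x S.* φ y
    1-homo : φ R.1# S.≈ S.1#

  0-homo : φ R.0# S.≈ S.0#
  0-homo = identityʳ-unique (φ R.0#) (φ R.0#)
    (S.trans (S.sym (+-homo R.0# R.0#)) (cong (R.+-identityˡ R.0#)))
    where open GroupProperties S.+-group using (identityʳ-unique)

  neg-homo : ∀ x → φ (R.- x) S.≈ S.- φ x
  neg-homo x = inverseˡ-unique (φ (R.- x)) (φ x)
    (S.trans (S.sym (+-homo (R.- x) x)) (S.trans (cong (R.-‿inverseˡ x)) 0-homo))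
    where open GroupProperties S.+-group using (inverseˡ-unique)

  open SemiringExp R.semiring using () renaming (_^_ to _^ᴿ_)
  open SemiringExp S.semiring using () renaming (_^_ to _^ˢ_)

  ^-homo : ∀ x n → φ (x ^ᴿ n) S.≈ φ x ^ˢ n
  ^-homo x zero    = 1-homo
  ^-homo x (suc n) = S.trans (*-homo x (x ^ᴿ n)) (S.*-congˡ (^-homo x n))

  open Integers R using () renaming (fromℤ to fromℤᴿ)
  open Integers S using () renaming (fromℤ to fromℤˢ)

  fromℤ-homo : ∀ i → φ (fromℤᴿ i) S.≈ fromℤˢ i
  fromℤ-homo (+ n)    = fromℕ n
    where
    fromℕ : ∀ n → φ (fromℤᴿ (+ n)) S.≈ fromℤˢ (+ n)
    fromℕ zero    = 0-homo
    fromℕ (suc n) = S.trans (cong (Mult.1+× R.semiring n R.1#)) (S.trans (+-homo R.1# _)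
      (S.trans (S.+-cong 1-homo (fromℕ n)) (S.sym (Mult.1+× S.semiring n S.1#))))
  fromℤ-homo -[1+ n ] = S.trans (neg-homo _) (S.-‿cong (fromℤ-homo (+ suc n)))

  open Sums R using () renaming (∑ to ∑ᴿ)
  open Sums S using () renaming (∑ to ∑ˢ)

  ∑-homo : ∀ K u → φ (∑ᴿ K u) S.≈ ∑ˢ K (φ ∘ u)
  ∑-homo zero    u = 0-homo
  ∑-homo (suc K) u = S.trans (+-homo _ (u K)) (S.+-congʳ (∑-homo K u))

module Polynomials (R : CommutativeRing 0ℓ 0ℓ) where

  open CommutativeRing R
  open Univariate R
  open Integers R using (fromℤ)

  open SemiringExp semiring using (_^_)
  open Sums R
  private
    module P = CommutativeRing polynomialRing
    module Pℤ = Integers polynomialRing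

  -- The variable, and the constant polynomials.

  X : Poly
  X = 0# ∷ 1# ∷ []

  C : Carrier → Poly
  C a = a ∷ []

  C-⊗ : ∀ a p → C a ⊗ p ≋ scale a p
  C-⊗ a p = ≋-trans (⊕-congˡ (scale a p) (∷-zero ≋-refl)) (⊕-identityʳ (scale a p))

  X-⊗ : ∀ p → X ⊗ p ≋ 0# ∷ p
  X-⊗ p = ≋-trans (shift-⊗ (1# ∷ []) p) (∷-cong refl (⊗-identityˡ p))

  coeff-C-⊗ : ∀ a p n → coeff (C a ⊗ p) n ≈ a * coeff p n
  coeff-C-⊗ a p n = trans (coeffs (C-⊗ a p) n) (coeff-scale a p n)

  C-isHomomorphism : IsHomomorphism R polynomialRing C
  C-isHomomorphism = record
    { cong = λ a≈b → ∷-cong a≈b ≋-refl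
    ; +-homo = λ a b → ≋-refl
    ; *-homo = λ a b → ≋-sym (C-⊗ a (C b))
    ; 1-homo = ≋-refl
    }

  coeff-fromℤ-⊗ : ∀ i p n → coeff (Pℤ.fromℤ i ⊗ p) n ≈ fromℤ i * coeff p n
  coeff-fromℤ-⊗ i p n = trans
    (coeffs (⊗-cong (≋-sym (IsHomomorphism.fromℤ-homo C-isHomomorphism i)) (≋-refl {p})) n)
    (coeff-C-⊗ (fromℤ i) p n)

  coeff-∑ : ∀ K u n → coeff (Sums.∑ polynomialRing K u) n ≈ ∑ K (λ m → coeff (u m) n)
  coeff-∑ zero    u n = refl
  coeff-∑ (suc K) u n = trans (coeff-⊕ (Sums.∑ polynomialRing K u) (u K) n) (+-congʳ (coeff-∑ K u n))

  coeff-deriv : ∀ p n → coeff (deriv p) n ≈ fromℤ (+ suc n) * coeff p (suc n)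
  coeff-deriv []      n = sym (zeroʳ _)
  coeff-deriv (a ∷ p) zero = trans (coeff-⊕ p (0# ∷ deriv p) 0)
    (trans (+-identityʳ _) (sym (*-identityˡ _)))
  coeff-deriv (a ∷ p) (suc n) = begin
    coeff (p ⊕ (0# ∷ deriv p)) (suc n)           ≈⟨ coeff-⊕ p (0# ∷ deriv p) (suc n) ⟩
    c + coeff (deriv p) n                        ≈⟨ +-congˡ (coeff-deriv p n) ⟩
    c + fromℤ (+ suc n) * c                      ≈⟨ +-congʳ (*-identityˡ c) ⟨
    1# * c + fromℤ (+ suc n) * c                 ≈⟨ distribʳ c 1# _ ⟨
    (1# + fromℤ (+ suc n)) * c                   ≈⟨ *-congʳ (Mult.1+× semiring (suc n) 1#) ⟨
    fromℤ (+ suc (suc n)) * c                    ∎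
    where
    open SetoidReasoning setoid
    c = coeff p (suc n)

  coeff-X-deriv : ∀ p n → coeff (X ⊗ deriv p) n ≈ fromℤ (+ n) * coeff p n
  coeff-X-deriv p zero    = trans (coeffs (X-⊗ (deriv p)) 0) (sym (zeroˡ _))
  coeff-X-deriv p (suc n) = trans (coeffs (X-⊗ (deriv p)) (suc n)) (coeff-deriv p n)

  -- The value of a polynomial at r, by Horner's rule.

  eval : Carrier → Poly → Carrier
  eval r []      = 0#
  eval r (a ∷ p) = a + r * eval r p

  module _ (r : Carrier) where

    open IntegerSolver R
    open SetoidReasoning setoid

    eval-zero : ∀ p → p ≋ [] → eval r p ≈ 0#
    eval-zero []      e = refl
    eval-zero (a ∷ p) e = trans
      (+-cong (coeffs e 0) (*-congˡ (eval-zero p (mk≋ (coeffs e ∘ suc)))))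
      (trans (+-identityˡ _) (zeroʳ r))

    eval-⊕ : ∀ p q → eval r (p ⊕ q) ≈ eval r p + eval r q
    eval-⊕ []      q       = sym (+-identityˡ _)
    eval-⊕ (a ∷ p) []      = sym (+-identityʳ _)
    eval-⊕ (a ∷ p) (b ∷ q) = trans (+-congˡ (*-congˡ (eval-⊕ p q)))
      (solve 5 (λ a b r x y → (a :+ b) :+ r :* (x :+ y) := (a :+ r :* x) :+ (b :+ r :* y))
        refl a b r (eval r p) (eval r q))

    eval-scale : ∀ a p → eval r (scale a p) ≈ a * eval r p
    eval-scale a []      = sym (zeroʳ a)
    eval-scale a (b ∷ p) = trans (+-congˡ (*-congˡ (eval-scale a p)))
      (solve 4 (λ a b r x → a :* b :+ r :* (a :* x) := a :* (b :+ r :* x)) refl a b r (eval r p))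

    eval-⊖ : ∀ p → eval r (⊖ p) ≈ - eval r p
    eval-⊖ []      = solve 0 (con ℤ.0ℤ := :- con ℤ.0ℤ) refl
    eval-⊖ (a ∷ p) = trans (+-congˡ (*-congˡ (eval-⊖ p)))
      (solve 3 (λ a r x → :- a :+ r :* (:- x) := :- (a :+ r :* x)) refl a r (eval r p))

    eval-⊗ : ∀ p q → eval r (p ⊗ q) ≈ eval r p * eval r q
    eval-⊗ []      q = sym (zeroˡ _)
    eval-⊗ (a ∷ p) q = begin
      eval r (scale a q ⊕ (0# ∷ (p ⊗ q)))              ≈⟨ eval-⊕ (scale a q) (0# ∷ (p ⊗ q)) ⟩
      eval r (scale a q) + (0# + r * eval r (p ⊗ q))
        ≈⟨ +-cong (eval-scale a q) (+-congˡ (*-congˡ (eval-⊗ p q))) ⟩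
      a * eval r q + (0# + r * (eval r p * eval r q))
        ≈⟨ solve 4 (λ a r x y → a :* y :+ (con ℤ.0ℤ :+ r :* (x :* y)) := (a :+ r :* x) :* y)
             refl a r (eval r p) (eval r q) ⟩
      (a + r * eval r p) * eval r q                    ∎

    eval-cong : ∀ {p q} → p ≋ q → eval r p ≈ eval r q
    eval-cong {p} {q} e = x∙y⁻¹≈ε⇒x≈y _ _ (begin
      eval r p + - eval r q       ≈⟨ +-congˡ (eval-⊖ q) ⟨
      eval r p + eval r (⊖ q)     ≈⟨ eval-⊕ p (⊖ q) ⟨
      eval r (p ⊕ ⊖ q)            ≈⟨ eval-zero (p ⊕ ⊖ q) (P.trans (⊕-congʳ (⊖ q) e) (P.-‿inverseʳ q)) ⟩
      0#                          ∎)
      where open GroupProperties +-group using (x∙y⁻¹≈ε⇒x≈y)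

    eval-isHomomorphism : IsHomomorphism polynomialRing R (eval r)
    eval-isHomomorphism = record
      { cong = eval-cong
      ; +-homo = eval-⊕
      ; *-homo = eval-⊗
      ; 1-homo = trans (+-congˡ (zeroʳ r)) (+-identityʳ 1#)
      }

    eval-∑ : ∀ K p → (∀ n → K ℕ.≤ n → coeff p n ≈ 0#) → eval r p ≈ ∑ K (λ n → r ^ n * coeff p n)
    eval-∑ zero    p       p≈0 = eval-zero p (mk≋ λ n → p≈0 n z≤n)
    eval-∑ (suc K) []      p≈0 = sym (∑-zero (suc K) λ n _ → zeroʳ (r ^ n))
    eval-∑ (suc K) (a ∷ p) p≈0 = begin
      a + r * eval r p
        ≈⟨ +-congˡ (*-congˡ (eval-∑ K p λ n K≤n → p≈0 (suc n) (s≤s K≤n))) ⟩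
      a + r * ∑ K (λ n → r ^ n * coeff p n)
        ≈⟨ +-cong (sym (*-identityˡ a)) (trans (*-distribˡ-∑ K r _)
             (∑-cong K λ n _ → sym (*-assoc r (r ^ n) (coeff p n)))) ⟩
      1# * a + ∑ K (λ n → r * r ^ n * coeff p n)
        ≈⟨ ∑-first K (λ n → r ^ n * coeff (a ∷ p) n) ⟨
      ∑ (suc K) (λ n → r ^ n * coeff (a ∷ p) n) ∎

    eval-x-r : eval r (X ⊕ ⊖ C r) ≈ 0#
    eval-x-r = solve 1 (λ r → (con ℤ.0ℤ :+ (:- r)) :+ r :* (con ℤ.1ℤ :+ r :* con ℤ.0ℤ) := con ℤ.0ℤ)
      refl r

    -- The quotient of p by x - r.

    quotient : Poly → Poly
    quotient []      = []
    quotient (a ∷ p) = eval r p ∷ quotient p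

    coeff-division : ∀ p n → coeff p n ≈
      coeff (0# ∷ quotient p) n - r * coeff (quotient p) n + coeff (C (eval r p)) n
    coeff-division []      zero    =
      solve 1 (λ r → con ℤ.0ℤ := con ℤ.0ℤ :- r :* con ℤ.0ℤ :+ con ℤ.0ℤ) refl r
    coeff-division []      (suc n) =
      solve 1 (λ r → con ℤ.0ℤ := con ℤ.0ℤ :- r :* con ℤ.0ℤ :+ con ℤ.0ℤ) refl r
    coeff-division (a ∷ p) zero    =
      solve 3 (λ a r e → a := con ℤ.0ℤ :- r :* e :+ (a :+ r :* e)) refl a r (eval r p)
    coeff-division (a ∷ p) (suc zero) = trans (coeff-division p 0)
      (solve 3 (λ r q e → con ℤ.0ℤ :- r :* q :+ e := e :- r :* q :+ con ℤ.0ℤ)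
        refl r (coeff (quotient p) 0) (eval r p))
    coeff-division (a ∷ p) (suc (suc n)) = coeff-division p (suc n)

    division : ∀ p → p ≋ (X ⊕ ⊖ C r) ⊗ quotient p ⊕ C (eval r p)
    division p = mk≋ λ n → trans (coeff-division p n) (sym (trans
      (coeff-⊕ ((X ⊕ ⊖ C r) ⊗ quotient p) (C (eval r p)) n) (+-congʳ (trans
      (coeffs (⊗-distribʳ (quotient p) X (⊖ C r)) n) (trans
      (coeff-⊕ (X ⊗ quotient p) (⊖ C r ⊗ quotient p) n)
      (+-cong (coeffs (X-⊗ (quotient p)) n) (trans (coeff-C-⊗ (- r) (quotient p) n)
        (sym (-‿distribˡ-* r _)))))))))
      where open RingProperties ring using (-‿distribˡ-*)

    eval≈0⇒factor : ∀ p → eval r p ≈ 0# → p ≋ (X ⊕ ⊖ C r) ⊗ quotient p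
    eval≈0⇒factor p e = ≋-trans (division p) (≋-trans
      (⊕-congˡ ((X ⊕ ⊖ C r) ⊗ quotient p) (≋-trans (∷-cong e ≋-refl) (∷-zero ≋-refl)))
      (⊕-identityʳ _))

module _ {R S : CommutativeRing 0ℓ 0ℓ} {φ} (isHom : IsHomomorphism R S φ) where

  open IsHomomorphism isHom
  private
    module R = CommutativeRing R
    module S = CommutativeRing S
    module P = Univariate R
    module Q = Univariate S

  coeff-map-φ : ∀ p n → Q.coeff (map φ p) n S.≈ φ (P.coeff p n)
  coeff-map-φ []      n       = S.sym 0-homo
  coeff-map-φ (a ∷ p) zero    = S.refl
  coeff-map-φ (a ∷ p) (suc n) = coeff-map-φ p n

  private
    map-⊕ : ∀ p q → map φ (p P.⊕ q) Q.≋ map φ p Q.⊕ map φ q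
    map-⊕ []      q       = Q.≋-refl
    map-⊕ (a ∷ p) []      = Q.≋-refl
    map-⊕ (a ∷ p) (b ∷ q) = Q.∷-cong (+-homo a b) (map-⊕ p q)

    map-scale : ∀ a p → map φ (P.scale a p) Q.≋ Q.scale (φ a) (map φ p)
    map-scale a []      = Q.≋-refl
    map-scale a (b ∷ p) = Q.∷-cong (*-homo a b) (map-scale a p)

    map-⊗ : ∀ p q → map φ (p P.⊗ q) Q.≋ map φ p Q.⊗ map φ q
    map-⊗ []      q = Q.≋-refl
    map-⊗ (a ∷ p) q = Q.≋-trans (map-⊕ (P.scale a q) (R.0# ∷ (p P.⊗ q)))
      (Q.⊕-cong (map-scale a q) (Q.∷-cong 0-homo (map-⊗ p q)))

  map-isHomomorphism : IsHomomorphism (Univariate.polynomialRing R) (Univariate.polynomialRing S) (map φ)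
  map-isHomomorphism = record
    { cong = λ {p} {q} e → Q.mk≋ λ n → S.trans (coeff-map-φ p n)
        (S.trans (cong (P.coeffs e n)) (S.sym (coeff-map-φ q n)))
    ; +-homo = map-⊕
    ; *-homo = map-⊗
    ; 1-homo = Q.∷-cong 1-homo Q.≋-refl
    }

-- Linked sequences of power series over the integers

module LinkedSequences where

  import Data.Integer.Solver as ℤSolver
  open import Data.List.Base using (_++_; filter; downFrom)
  open import Data.List.Membership.Propositional using (_∈_; _∉_)
  open import Data.List.Membership.Propositional.Properties
    using (∈-map⁺; ∈-map⁻; ∈-filter⁺; ∈-filter⁻; ∈-downFrom⁺; ∈-downFrom⁻; ∈-++⁺ˡ; ∈-++⁺ʳ)
  import Data.List.Membership.DecPropositional as DecMembership
  open import Data.List.Properties using (length-map; length-downFrom; length-++; filter-notAll)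
  open import Data.List.Relation.Unary.Any using (here; there)
  import Data.List.Relation.Unary.Any as Any
  open import Data.Nat.Base using (_+_; _*_; _∸_; _<_; z<s)
  open import Data.Nat.Induction using (<-rec)
  open import Data.Nat.Properties hiding (_≟_)
  open import Relation.Binary.PropositionalEquality
    using (refl; sym; trans; cong; cong₂; subst; module ≡-Reasoning)
  open import Relation.Nullary.Decidable.Core using (¬?)

  -- The product of n - s for s in ns.

  weight : List ℕ → ℕ → ℤ
  weight []       n = ℤ.1ℤ
  weight (s ∷ ns) n = (+ n ℤ.- + s) ℤ.* weight ns n

  open Sums ℤ.+-*-commutativeRing using (∑; ∑-zero)

  -- The moments of order less than c of the first K terms of u vanish: the
  -- products weight ns with ns of length less than c span the polynomials
  -- in n of degree less than c over the rational numbers.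

  MomentsVanish : (K c : ℕ) → (ℕ → ℤ) → Set
  MomentsVanish K c u = ∀ ns → length ns < c → ∑ K (λ n → weight ns n ℤ.* u n) ≡ ℤ.0ℤ

  private
    +n-+s≡0 : ∀ {n s} → + n ℤ.- + s ≡ ℤ.0ℤ → n ≡ s
    +n-+s≡0 {n} {s} e = ℤ.+-injective (ℤ.i-j≡0⇒i≡j (+ n) (+ s) e)

  weight-∈ : ∀ {ns n} → n ∈ ns → weight ns n ≡ ℤ.0ℤ
  weight-∈ {ns = s ∷ ns} {n} (here refl) =
    trans (cong (ℤ._* weight ns n) (ℤ.+-inverseʳ (+ n))) (ℤ.*-zeroˡ (weight ns n))
  weight-∈ {ns = s ∷ ns} {n} (there n∈ns) =
    trans (cong ((+ n ℤ.- + s) ℤ.*_) (weight-∈ n∈ns)) (ℤ.*-zeroʳ (+ n ℤ.- + s))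

  weight-∉ : ∀ {ns n} → n ∉ ns → weight ns n ≢ ℤ.0ℤ
  weight-∉ {[]}     n∉ns ()
  weight-∉ {s ∷ ns} {n} n∉ns e with ℤ.i*j≡0⇒i≡0∨j≡0 (+ n ℤ.- + s) e
  ... | inj₁ n-s≡0 = n∉ns (here (+n-+s≡0 n-s≡0))
  ... | inj₂ e′    = weight-∉ (n∉ns ∘ there) e′

  *-cancelˡ-0 : ∀ {i j} → i ≢ ℤ.0ℤ → i ℤ.* j ≡ ℤ.0ℤ → j ≡ ℤ.0ℤ
  *-cancelˡ-0 {i} i≢0 e with ℤ.i*j≡0⇒i≡0∨j≡0 i e
  ... | inj₁ i≡0 = contradiction i≡0 i≢0
  ... | inj₂ j≡0 = j≡0

  ∑-single : ∀ K {u m} → m < K → (∀ n → n < K → n ≢ m → u n ≡ ℤ.0ℤ) → ∑ K u ≡ u m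
  ∑-single (suc K) {u} {m} m<1+K u≡0 with m ℕ.≟ K
  ... | yes refl = trans
    (cong (ℤ._+ u K) (∑-zero K λ n n<K → u≡0 n (m<n⇒m<1+n n<K) (<⇒≢ n<K)))
    (ℤ.+-identityˡ (u K))
  ... | no m≢K = trans
    (cong₂ ℤ._+_ (∑-single K (≤∧≢⇒< (s≤s⁻¹ m<1+K) m≢K) λ n n<K → u≡0 n (m<n⇒m<1+n n<K))
                 (u≡0 K ≤-refl (m≢K ∘ sym)))
    (ℤ.+-identityʳ (u m))

  ∑-pair : ∀ K {u m} → suc m < K → (∀ n → n < K → n ≢ m → n ≢ suc m → u n ≡ ℤ.0ℤ) →
           ∑ K u ≡ u m ℤ.+ u (suc m)
  ∑-pair (suc K) {u} {m} (s≤s m<K) u≡0 with suc m ℕ.≟ K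
  ... | yes refl = cong (ℤ._+ u K)
    (∑-single K ≤-refl λ n n<K n≢m → u≡0 n (m<n⇒m<1+n n<K) n≢m (<⇒≢ n<K))
  ... | no 1+m≢K = trans
    (cong₂ ℤ._+_ (∑-pair K (≤∧≢⇒< m<K 1+m≢K) λ n n<K → u≡0 n (m<n⇒m<1+n n<K))
                 (u≡0 K ≤-refl (>⇒≢ m<K) (1+m≢K ∘ sym)))
    (ℤ.+-identityʳ (u m ℤ.+ u (suc m)))

  -- The Vandermonde determinant: a sequence with at most c nonzero terms
  -- whose moments of order less than c vanish is zero.  The moment of the
  -- product over all but one of the places isolates one term.

  sparse⇒zero : ∀ K {c u} → MomentsVanish K c u → ∀ ns → length ns ≤ c →
                (∀ n → n < K → n ∉ ns → u n ≡ ℤ.0ℤ) → ∀ n → n < K → u n ≡ ℤ.0ℤ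
  sparse⇒zero K {c} {u} moments ns ∣ns∣≤c u≡0 n n<K with n ∈? ns
    where open DecMembership ℕ._≟_ using (_∈?_)
  ... | no  n∉ns = u≡0 n n<K n∉ns
  ... | yes n∈ns = *-cancelˡ-0 (weight-∉ n∉others)
    (trans (sym (∑-single K n<K elsewhere)) (moments others (<-≤-trans ∣others∣<∣ns∣ ∣ns∣≤c)))
    where
    open DecMembership ℕ._≟_ using (_∈?_)
    ≢n? : ∀ m → Dec (m ≢ n)
    ≢n? m = ¬? (m ℕ.≟ n)
    others : List ℕ
    others = filter ≢n? ns
    ∣others∣<∣ns∣ : length others < length ns
    ∣others∣<∣ns∣ = filter-notAll ≢n? ns (Any.map (λ n≡m m≢n → m≢n (sym n≡m)) n∈ns)
    n∉others : n ∉ others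
    n∉others n∈others = proj₂ (∈-filter⁻ ≢n? {xs = ns} n∈others) refl
    elsewhere : ∀ m → m < K → m ≢ n → weight others m ℤ.* u m ≡ ℤ.0ℤ
    elsewhere m m<K m≢n with m ∈? ns
    ... | yes m∈ns = trans (cong (ℤ._* u m) (weight-∈ (∈-filter⁺ ≢n? m∈ns m≢n))) (ℤ.*-zeroˡ (u m))
    ... | no  m∉ns = trans (cong (weight others m ℤ.*_) (u≡0 m m<K m∉ns)) (ℤ.*-zeroʳ (weight others m))

  -- The power series with the coefficients p and r satisfy r = t^w p.

  record Link (p r : ℕ → ℤ) (w : ℕ) : Set where
    field
      shifted : ∀ j → r (j + w) ≡ p j
      below   : ∀ j → j < w → r j ≡ ℤ.0ℤ
  open Link

  -- If r = t^(w+1) p and r = t^w p, then p = r = 0.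

  links⇒zeroˡ : ∀ {p r w} → Link p r w → Link p r (suc w) → ∀ j → p j ≡ ℤ.0ℤ
  links⇒zeroˡ {p} {r} {w} l l′ zero    = trans (sym (shifted l 0)) (below l′ w ≤-refl)
  links⇒zeroˡ {p} {r} {w} l l′ (suc j) = trans (sym (shifted l (suc j)))
    (trans (cong r (sym (+-suc j w))) (trans (shifted l′ j) (links⇒zeroˡ l l′ j)))

  links⇒zeroʳ : ∀ {p r w} → Link p r w → Link p r (suc w) → ∀ j → r j ≡ ℤ.0ℤ
  links⇒zeroʳ {p} {r} {w} l l′ j with j ℕ.<? w
  ... | yes j<w = below l j j<w
  ... | no  j≮w = trans (cong r (sym (m∸n+n≡m (≮⇒≥ j≮w))))
    (trans (shifted l (j ∸ w)) (links⇒zeroˡ l l′ (j ∸ w)))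

  -- Zero power series are linked with every weight.

  links⇒link : ∀ {p r w} → Link p r w → Link p r (suc w) → ∀ v → Link p r v
  links⇒link l l′ v = record
    { shifted = λ j → trans (links⇒zeroʳ l l′ (j + v)) (sym (links⇒zeroˡ l l′ j))
    ; below   = λ j _ → links⇒zeroʳ l l′ j
    }

  -- Two sequences of K power series in t, where p n j and r n j are the
  -- coefficients of t^j in the terms p_n and r_n.

  module _ (K : ℕ) {b c : ℕ} {p r : ℕ → ℕ → ℤ}
           (r-moments : ∀ j → MomentsVanish K b (λ n → r n j))
           (p-moments : ∀ j → MomentsVanish K c (λ n → p n j)) where

    Zero : Set
    Zero = ∀ n → n < K → ∀ j → p n j ≡ ℤ.0ℤ × r n j ≡ ℤ.0ℤ

    -- The coefficients of t^j in r and those of t^(j-ω) in p vanish.  The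
    -- offset ω stands for division of r by t^ω, and i + ω ≡ j avoids
    -- truncated subtraction.

    ZeroLayer : ℕ → ℕ → Set
    ZeroLayer ω j = ∀ n → n < K → r n j ≡ ℤ.0ℤ × (∀ i → i + ω ≡ j → p n i ≡ ℤ.0ℤ)

    zeroLayers⇒zero : ∀ ω → (∀ j → ZeroLayer ω j) → Zero
    zeroLayers⇒zero ω z n n<K j = proj₂ (z (j + ω) n n<K) j refl , proj₁ (z j n n<K)

    -- A link of weight greater than ω determines a layer of r by an earlier
    -- layer of p, and a link of weight less than ω does the converse.

    heavy⇒r≡0 : ∀ {ω j n w} → n < K → (∀ {i} → i < j → ZeroLayer ω i) →
                ω < w → Link (p n) (r n) w → r n j ≡ ℤ.0ℤ
    heavy⇒r≡0 {ω} {j} {n} {w} n<K rec ω<w l with j ℕ.<? w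
    ... | yes j<w = below l j j<w
    ... | no  j≮w = trans (cong (r n) (sym j∸w+w≡j)) (trans (shifted l (j ∸ w))
      (proj₂ (rec (subst (j ∸ w + ω <_) j∸w+w≡j (+-monoʳ-< (j ∸ w) ω<w)) n n<K) (j ∸ w) refl))
      where
      j∸w+w≡j : j ∸ w + w ≡ j
      j∸w+w≡j = m∸n+n≡m (≮⇒≥ j≮w)

    light⇒p≡0 : ∀ {ω i n w} → n < K → (∀ {j} → j < i + ω → ZeroLayer ω j) →
                w < ω → Link (p n) (r n) w → p n i ≡ ℤ.0ℤ
    light⇒p≡0 {ω} {i} {n} n<K rec w<ω l =
      trans (sym (shifted l i)) (proj₁ (rec (+-monoʳ-< i w<ω) n n<K))

    -- If all earlier layers vanish, then layer j of r is supported on LR,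
    -- hence zero.  Therefore layer j - ω of p, also where the weight is
    -- equal to ω, is supported on LP, hence zero.

    cut⇒zero : ∀ ω LR LP → length LR ≤ b → length LP ≤ c →
      (∀ n → n < K → n ∉ LR → ∃[ w ] ω < w × Link (p n) (r n) w) →
      (∀ n → n < K → n ∉ LP → ∃[ w ] w ≤ ω × Link (p n) (r n) w) → Zero
    cut⇒zero ω LR LP ∣LR∣≤b ∣LP∣≤c heavy light = zeroLayers⇒zero ω (<-rec _ layer)
      where
      layer : ∀ j → (∀ {i} → i < j → ZeroLayer ω i) → ZeroLayer ω j
      layer j rec n n<K = r≡0 n n<K , p≡0 n n<K
        where
        r≡0 : ∀ n → n < K → r n j ≡ ℤ.0ℤ
        r≡0 = sparse⇒zero K (r-moments j) LR ∣LR∣≤b λ n n<K n∉LR →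
          let w , ω<w , l = heavy n n<K n∉LR in heavy⇒r≡0 n<K rec ω<w l

        p≡0 : ∀ n → n < K → ∀ i → i + ω ≡ j → p n i ≡ ℤ.0ℤ
        p≡0 n n<K i refl = sparse⇒zero K (p-moments i) LP ∣LP∣≤c
          (λ n n<K n∉LP → outside n n<K (light n n<K n∉LP)) n n<K
          where
          outside : ∀ n → n < K → ∃[ w ] w ≤ ω × Link (p n) (r n) w → p n i ≡ ℤ.0ℤ
          outside n n<K (w , w≤ω , l) with w ℕ.≟ ω
          ... | yes refl = trans (sym (shifted l i)) (r≡0 n n<K)
          ... | no  w≢ω  = light⇒p≡0 n<K rec (≤∧≢⇒< w≤ω w≢ω) l

  -- The numbers n with lo ≤ n < hi.

  range : ℕ → ℕ → List ℕ
  range lo hi = map (λ i → i + lo) (downFrom (hi ∸ lo))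

  length-range : ∀ lo {hi m} → hi ≡ lo + m → length (range lo hi) ≡ m
  length-range lo {hi} {m} refl = trans (length-map _ (downFrom (hi ∸ lo)))
    (trans (length-downFrom (hi ∸ lo)) (m+n∸m≡n lo m))

  ∈-range : ∀ {lo hi n} → lo ≤ n → n < hi → n ∈ range lo hi
  ∈-range {lo} {hi} {n} lo≤n n<hi = subst (_∈ range lo hi) (m∸n+n≡m lo≤n)
    (∈-map⁺ (λ i → i + lo) (∈-downFrom⁺ (∸-monoˡ-< n<hi lo≤n)))

  ∉-range : ∀ {lo hi n} → n ∉ range lo hi → n < lo ⊎ hi ≤ n
  ∉-range {lo} {hi} {n} n∉ with lo ℕ.≤? n | n ℕ.<? hi
  ... | no  lo≰n | _        = inj₁ (≰⇒> lo≰n)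
  ... | yes _    | no  n≮hi = inj₂ (≮⇒≥ n≮hi)
  ... | yes lo≤n | yes n<hi = contradiction (∈-range lo≤n n<hi) n∉

  -- The products n (n - 1) ⋯ (n - m + 1) and (n + 1) n ⋯ (n - m + 2).

  weight-downFrom : ∀ m n → (+ suc n ℤ.- + m) ℤ.* weight (downFrom m) (suc n) ≡
                            + suc n ℤ.* weight (downFrom m) n
  weight-downFrom zero n = cong (ℤ._* ℤ.1ℤ) (ℤ.+-identityʳ (+ suc n))
  weight-downFrom (suc m) n = begin
    (+ suc n ℤ.- + suc m) ℤ.* ((+ suc n ℤ.- + m) ℤ.* weight (downFrom m) (suc n))
      ≡⟨ cong ((+ suc n ℤ.- + suc m) ℤ.*_) (weight-downFrom m n) ⟩
    (+ suc n ℤ.- + suc m) ℤ.* (+ suc n ℤ.* weight (downFrom m) n)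
      ≡⟨ cong (λ x → x ℤ.* (+ suc n ℤ.* weight (downFrom m) n))
           (solve 2 (λ n m → (con ℤ.1ℤ :+ n) :- (con ℤ.1ℤ :+ m) := n :- m) refl (+ n) (+ m)) ⟩
    (+ n ℤ.- + m) ℤ.* (+ suc n ℤ.* weight (downFrom m) n)
      ≡⟨ solve 3 (λ x y z → x :* (y :* z) := y :* (x :* z)) refl
           (+ n ℤ.- + m) (+ suc n) (weight (downFrom m) n) ⟩
    + suc n ℤ.* ((+ n ℤ.- + m) ℤ.* weight (downFrom m) n) ∎
    where
    open ≡-Reasoning
    open ℤSolver.+-*-Solver

  -- The products of n - s and of n + 1 - s for n + 2 ≤ s < n + 2 + m.

  weight-above : ∀ m n → weight (map (λ i → i + (2 + n)) (downFrom m)) n ≡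
                         + suc m ℤ.* weight (map (λ i → i + (2 + n)) (downFrom m)) (suc n)
  weight-above zero n = refl
  weight-above (suc m) n = begin
    (+ n ℤ.- + (m + (2 + n))) ℤ.* weight ns n
      ≡⟨ cong ((+ n ℤ.- + (m + (2 + n))) ℤ.*_) (weight-above m n) ⟩
    (+ n ℤ.- + (m + (2 + n))) ℤ.* (+ suc m ℤ.* weight ns (suc n))
      ≡⟨ solve 3 (λ n m w → (n :- (m :+ (con (+ 2) :+ n))) :* ((con ℤ.1ℤ :+ m) :* w)
           := (con (+ 2) :+ m) :* (((con ℤ.1ℤ :+ n) :- (m :+ (con (+ 2) :+ n))) :* w))
           refl (+ n) (+ m) (weight ns (suc n)) ⟩
    + suc (suc m) ℤ.* ((+ suc n ℤ.- + (m + (2 + n))) ℤ.* weight ns (suc n)) ∎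
    where
    open ≡-Reasoning
    open ℤSolver.+-*-Solver
    ns = map (λ i → i + (2 + n)) (downFrom m)

  -- The extreme case, in which the places a and a + 1 are both linked with
  -- weight a + 1.  When the earlier layers vanish, layer j of r is supported
  -- on n ≤ a + 1, one place more than its moments can kill, so that it is a
  -- multiple of the coefficients of (x - 1)^(a+1); likewise layer
  -- j - (a + 1) of p is a multiple of the coefficients of
  -- x^a (x - 1)^(c+1).  The two layers agree at a and a + 1.

  module _ {a c : ℕ} {p r : ℕ → ℕ → ℤ}
           (r-moments : ∀ j → MomentsVanish (suc a + suc c) (suc a) (λ n → r n j))
           (p-moments : ∀ j → MomentsVanish (suc a + suc c) (suc c) (λ n → p n j))
           (low  : ∀ n → n < suc a + suc c → n < suc a → Link (p n) (r n) (suc n))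
           (high : ∀ n → n < suc a + suc c → suc a ≤ n → Link (p n) (r n) n) where

    private
      K = suc a + suc c
      1+a<K : suc a < K
      1+a<K = m<m+n (suc a) z<s
      a<K : a < K
      a<K = <-trans (n<1+n a) 1+a<K

    -- The moment that isolates the places a and a + 1.

    r-relation : ∀ j → (∀ n → n < K → suc a < n → r n j ≡ ℤ.0ℤ) →
                 r a j ℤ.+ + suc a ℤ.* r (suc a) j ≡ ℤ.0ℤ
    r-relation j above≡0 = *-cancelˡ-0 (weight-∉ a∉) (begin
      w a ℤ.* (r a j ℤ.+ + suc a ℤ.* r (suc a) j)
        ≡⟨ solve 4 (λ w x α y → w :* (x :+ α :* y) := w :* x :+ (α :* w) :* y) refl
             (w a) (r a j) (+ suc a) (r (suc a) j) ⟩
      w a ℤ.* r a j ℤ.+ (+ suc a ℤ.* w a) ℤ.* r (suc a) j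
        ≡⟨ cong (λ x → w a ℤ.* r a j ℤ.+ x ℤ.* r (suc a) j) (weight-downFrom a a) ⟨
      w a ℤ.* r a j ℤ.+ ((+ suc a ℤ.- + a) ℤ.* w (suc a)) ℤ.* r (suc a) j
        ≡⟨ cong (λ x → w a ℤ.* r a j ℤ.+ x ℤ.* r (suc a) j)
             (solve 2 (λ a x → ((con ℤ.1ℤ :+ a) :- a) :* x := x) refl (+ a) (w (suc a))) ⟩
      w a ℤ.* r a j ℤ.+ w (suc a) ℤ.* r (suc a) j
        ≡⟨ ∑-pair K 1+a<K elsewhere ⟨
      ∑ K (λ n → w n ℤ.* r n j)
        ≡⟨ r-moments j (downFrom a) (s≤s (≤-reflexive (length-downFrom a))) ⟩
      ℤ.0ℤ ∎)
      where
      open ≡-Reasoning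
      open ℤSolver.+-*-Solver
      w = weight (downFrom a)
      a∉ : a ∉ downFrom a
      a∉ a∈ = <-irrefl refl (∈-downFrom⁻ a∈)
      elsewhere : ∀ n → n < K → n ≢ a → n ≢ suc a → w n ℤ.* r n j ≡ ℤ.0ℤ
      elsewhere n n<K n≢a n≢1+a with n ℕ.<? a
      ... | yes n<a = trans (cong (ℤ._* r n j) (weight-∈ (∈-downFrom⁺ n<a))) (ℤ.*-zeroˡ (r n j))
      ... | no  n≮a = trans (cong (w n ℤ.*_) (above≡0 n n<K
        (≤∧≢⇒< (≤∧≢⇒< (≮⇒≥ n≮a) (n≢a ∘ sym)) (n≢1+a ∘ sym)))) (ℤ.*-zeroʳ (w n))

    -- The moment that isolates the places a and a + 1.

    p-relation : ∀ j → (∀ n → n < a → p n j ≡ ℤ.0ℤ) →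
                 + suc c ℤ.* p a j ℤ.+ p (suc a) j ≡ ℤ.0ℤ
    p-relation j below≡0 = *-cancelˡ-0 (weight-∉ 1+a∉) (begin
      w (suc a) ℤ.* (+ suc c ℤ.* p a j ℤ.+ p (suc a) j)
        ≡⟨ solve 4 (λ w x γ y → w :* (γ :* x :+ y) := (γ :* w) :* x :+ w :* y) refl
             (w (suc a)) (p a j) (+ suc c) (p (suc a) j) ⟩
      (+ suc c ℤ.* w (suc a)) ℤ.* p a j ℤ.+ w (suc a) ℤ.* p (suc a) j
        ≡⟨ cong (λ x → x ℤ.* p a j ℤ.+ w (suc a) ℤ.* p (suc a) j) (weight-above c a) ⟨
      w a ℤ.* p a j ℤ.+ w (suc a) ℤ.* p (suc a) j
        ≡⟨ ∑-pair K 1+a<K elsewhere ⟨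
      ∑ K (λ n → w n ℤ.* p n j)
        ≡⟨ p-moments j ns (s≤s (≤-reflexive (trans (length-map _ (downFrom c)) (length-downFrom c)))) ⟩
      ℤ.0ℤ ∎)
      where
      open ≡-Reasoning
      open ℤSolver.+-*-Solver
      ns = map (λ i → i + (2 + a)) (downFrom c)
      w = weight ns
      1+a∉ : suc a ∉ ns
      1+a∉ ∈ns = let i , _ , e = ∈-map⁻ (λ i → i + (2 + a)) ∈ns in
        <-irrefl (trans e (+-suc i (suc a))) (s≤s (m≤n+m (suc a) i))
      ∈ns : ∀ {n} → n < K → suc a < n → n ∈ ns
      ∈ns {n} n<K 1+a<n = subst (λ m → n ∈ map (λ i → i + (2 + a)) (downFrom m))
        (trans (cong (_∸ (2 + a)) (cong suc (+-suc a c))) (m+n∸m≡n a c))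
        (∈-range 1+a<n n<K)
      elsewhere : ∀ n → n < K → n ≢ a → n ≢ suc a → w n ℤ.* p n j ≡ ℤ.0ℤ
      elsewhere n n<K n≢a n≢1+a with n ℕ.<? a
      ... | yes n<a = trans (cong (w n ℤ.*_) (below≡0 n n<a)) (ℤ.*-zeroʳ (w n))
      ... | no  n≮a = trans (cong (ℤ._* p n j) (weight-∈ (∈ns n<K
        (≤∧≢⇒< (≤∧≢⇒< (≮⇒≥ n≮a) (n≢a ∘ sym)) (n≢1+a ∘ sym))))) (ℤ.*-zeroˡ (p n j))

    tie⇒zero : suc a * suc c ≢ 1 → Zero K r-moments p-moments
    tie⇒zero ac≢1 = zeroLayers⇒zero K r-moments p-moments (suc a) (<-rec _ layer)
      where
      Layer = ZeroLayer K r-moments p-moments (suc a)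

      layer : ∀ j → (∀ {i} → i < j → Layer i) → Layer j
      layer j rec = λ n n<K → r≡0 n n<K , λ i i+1+a≡j → p≡0 i i+1+a≡j n n<K
        where
        above≡0 : ∀ n → n < K → suc a < n → r n j ≡ ℤ.0ℤ
        above≡0 n n<K 1+a<n = heavy⇒r≡0 K r-moments p-moments n<K rec 1+a<n (high n n<K (<⇒≤ 1+a<n))

        below≡0 : ∀ i → i + suc a ≡ j → ∀ n → n < a → p n i ≡ ℤ.0ℤ
        below≡0 i refl n n<a = light⇒p≡0 K r-moments p-moments (<-trans n<a a<K) rec (s≤s n<a)
          (low n (<-trans n<a a<K) (m<n⇒m<1+n n<a))

        r[1+a]≡0 : r (suc a) j ≡ ℤ.0ℤ
        r[1+a]≡0 with j ℕ.<? suc a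
        ... | yes j<1+a = below (high (suc a) 1+a<K ≤-refl) j j<1+a
        ... | no  j≮1+a = *-cancelˡ-0 ac-1≢0 (begin
          (+ (suc a * suc c) ℤ.- ℤ.1ℤ) ℤ.* y
            ≡⟨ cong (λ x → (x ℤ.- ℤ.1ℤ) ℤ.* y) (ℤ.pos-* (suc a) (suc c)) ⟩
          (+ suc a ℤ.* + suc c ℤ.- ℤ.1ℤ) ℤ.* y
            ≡⟨ solve 4 (λ α γ x y → (α :* γ :- con ℤ.1ℤ) :* y := γ :* (x :+ α :* y) :- (γ :* x :+ y))
                 refl (+ suc a) (+ suc c) x y ⟩
          + suc c ℤ.* (x ℤ.+ + suc a ℤ.* y) ℤ.- (+ suc c ℤ.* x ℤ.+ y)
            ≡⟨ cong₂ (λ u v → + suc c ℤ.* u ℤ.- v) (r-relation j above≡0) x-y-relation ⟩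
          + suc c ℤ.* ℤ.0ℤ ℤ.- ℤ.0ℤ
            ≡⟨ cong (ℤ._- ℤ.0ℤ) (ℤ.*-zeroʳ (+ suc c)) ⟩
          ℤ.0ℤ ∎)
          where
          open ≡-Reasoning
          open ℤSolver.+-*-Solver
          x = r a j
          y = r (suc a) j
          i = j ∸ suc a
          i+1+a≡j : i + suc a ≡ j
          i+1+a≡j = m∸n+n≡m (≮⇒≥ j≮1+a)
          ac-1≢0 : + (suc a * suc c) ℤ.- ℤ.1ℤ ≢ ℤ.0ℤ
          ac-1≢0 e = ac≢1 (+n-+s≡0 e)
          x-y-relation : + suc c ℤ.* x ℤ.+ y ≡ ℤ.0ℤ
          x-y-relation = trans
            (cong₂ (λ u v → + suc c ℤ.* u ℤ.+ v)
              (trans (cong (r a) (sym i+1+a≡j)) (shifted (low a a<K ≤-refl) i))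
              (trans (cong (r (suc a)) (sym i+1+a≡j)) (shifted (high (suc a) 1+a<K ≤-refl) i)))
            (p-relation i (below≡0 i i+1+a≡j))

        r≡0 : ∀ n → n < K → r n j ≡ ℤ.0ℤ
        r≡0 = sparse⇒zero K (r-moments j) (downFrom (suc a))
          (≤-reflexive (length-downFrom (suc a))) outside
          where
          outside : ∀ n → n < K → n ∉ downFrom (suc a) → r n j ≡ ℤ.0ℤ
          outside n n<K n∉ with n ℕ.<? suc a
          ... | yes n<1+a = contradiction (∈-downFrom⁺ n<1+a) n∉
          ... | no  n≮1+a with n ℕ.≟ suc a
          ...   | yes refl  = r[1+a]≡0
          ...   | no  n≢1+a = above≡0 n n<K (≤∧≢⇒< (≮⇒≥ n≮1+a) (n≢1+a ∘ sym))

        p≡0 : ∀ i → i + suc a ≡ j → ∀ n → n < K → p n i ≡ ℤ.0ℤ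
        p≡0 i i+1+a≡j = sparse⇒zero K (p-moments i) (range (suc a) K)
          (≤-reflexive (length-range (suc a) refl)) outside
          where
          outside : ∀ n → n < K → n ∉ range (suc a) K → p n i ≡ ℤ.0ℤ
          outside n n<K n∉ with ∉-range {suc a} {K} n∉
          ... | inj₂ K≤n   = contradiction n<K (≤⇒≯ K≤n)
          ... | inj₁ n<1+a with n ℕ.≟ a
          ...   | no  n≢a  = below≡0 i i+1+a≡j n (≤∧≢⇒< (s≤s⁻¹ n<1+a) n≢a)
          ...   | yes refl = trans (sym (shifted (low a a<K ≤-refl) i))
            (trans (cong (r a) i+1+a≡j) (r≡0 a a<K))

  private
    cancel-≤ : ∀ z {x y x′ y′} → x ≤ y → x ≡ z + x′ → y ≡ z + y′ → x′ ≤ y′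
    cancel-≤ z x≤y refl refl = +-cancelˡ-≤ z _ _ x≤y

    decompose : ∀ {m n} → m ≤ n → ∃[ o ] n ≡ m + o
    decompose m≤n = let o , e = m≤n⇒∃[o]m+o≡n m≤n in o , sym e

    length-two : ∀ lo lo′ {hi m hi′ m′ n} → hi ≡ lo + m → hi′ ≡ lo′ + m′ → m + m′ ≤ n →
                 length (range lo hi ++ range lo′ hi′) ≤ n
    length-two lo lo′ {hi} e e′ le = ≤-trans (≤-reflexive (trans (length-++ (range lo hi))
      (cong₂ _+_ (length-range lo e) (length-range lo′ e′)))) le

    -- The position of a number relative to two consecutive intervals.

    ∉-two : ∀ {lo hi lo′ hi′ n} → n ∉ range lo hi ++ range lo′ hi′ →
            (n < lo ⊎ hi ≤ n) × (n < lo′ ⊎ hi′ ≤ n)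
    ∉-two {lo} {hi} n∉ = ∉-range (n∉ ∘ ∈-++⁺ˡ) , ∉-range (n∉ ∘ ∈-++⁺ʳ (range lo hi))

  -- The case a = b, c = d and K = a + d, in which the places a - 1 and a are
  -- both linked with weight a.

  private
    extreme : ∀ {K a b c d} {p r : ℕ → ℕ → ℤ}
      (r-moments : ∀ j → MomentsVanish K b (λ n → r n j))
      (p-moments : ∀ j → MomentsVanish K c (λ n → p n j)) →
      (∀ n → n < K → n < a → Link (p n) (r n) (suc n)) →
      (∀ n → n < K → K ≤ n + d → Link (p n) (r n) n) →
      K ≡ a + d → a ≡ b → c ≡ d → a ≢ 0 → d ≢ 0 → a * d ≢ 1 →
      Zero K r-moments p-moments
    extreme {a = zero} _ _ _ _ _ _ _ a≢0 _ = contradiction refl a≢0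
    extreme {a = suc a} {d = zero} _ _ _ _ _ _ _ _ d≢0 = contradiction refl d≢0
    extreme {a = suc a} {d = suc d} r-moments p-moments low high refl refl refl _ _ =
      tie⇒zero r-moments p-moments low (λ n n<K 1+a≤n → high n n<K (+-monoˡ-≤ (suc d) 1+a≤n))

  -- The terms are linked with weight n + 1 for n < a and with weight n for
  -- n ≥ K - d.  In each case ω and the supports are chosen so that the
  -- support of r consists of the places that are not linked and of the
  -- first of the linked places, at most b in total, and the support of p of
  -- the places that are not linked and of the other linked places, at most
  -- c in total.

  module _ (K a b c d : ℕ) {p r : ℕ → ℕ → ℤ}
           (r-moments : ∀ j → MomentsVanish K b (λ n → r n j))
           (p-moments : ∀ j → MomentsVanish K c (λ n → p n j))
           (low  : ∀ n → n < K → n < a → Link (p n) (r n) (suc n))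
           (high : ∀ n → n < K → K ≤ n + d → Link (p n) (r n) n)
           (a≤K : a ≤ K) (b≤K : b ≤ K) (c≤K : c ≤ K) (d≤K : d ≤ K)
           (2K≤ : K + K ≤ a + b + c + d) where

    private
      both : ∀ n → n < K → n < a → K ≤ n + d → ∀ w → Link (p n) (r n) w
      both n n<K n<a K≤n+d = links⇒link (high n n<K K≤n+d) (low n n<K n<a)

      Z = Zero K r-moments p-moments
      cut = cut⇒zero K r-moments p-moments

      absurd-≥ : ∀ {n} {A : Set} → n < K → K ≤ n → A
      absurd-≥ n<K K≤n = contradiction n<K (≤⇒≯ K≤n)

      -- The case a + d ≤ K, where the μ places from a to K - d - 1 are not
      -- linked.

      module Disjoint (μ : ℕ) (K≡ : K ≡ a + d + μ) where

        K≤n+d : ∀ {n} → a + μ ≤ n → K ≤ n + d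
        K≤n+d {n} a+μ≤n = begin
          K          ≡⟨ K≡ ⟩
          a + d + μ  ≡⟨ lemma a d μ ⟩
          a + μ + d  ≤⟨ +-monoˡ-≤ d a+μ≤n ⟩
          n + d      ∎
          where
          open ≤-Reasoning
          lemma : ∀ a d μ → a + d + μ ≡ a + μ + d
          lemma = solve-∀

        -- b + d ≤ K
        module _ (h : ℕ) (b≡ : b ≡ h + μ) (h≤a : h ≤ a) where

          private
            tail : ∃[ x ] K ≡ h + x × x ≤ c
            tail with decompose (≤-trans h≤a a≤K)
            ... | x , K≡h+x = x , K≡h+x , cancel-≤ (K + h) 2K≤
              (trans (cong (λ m → K + m) K≡h+x) (sym (+-assoc K h x)))
              (begin-equality
                a + b + c + d          ≡⟨ cong (λ b → a + b + c + d) b≡ ⟩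
                a + (h + μ) + c + d    ≡⟨ lemma a c d h μ ⟩
                a + d + μ + h + c      ≡⟨ cong (λ K → K + h + c) K≡ ⟨
                K + h + c              ∎)
              where
              open ≤-Reasoning
              lemma : ∀ a c d h μ → a + (h + μ) + c + d ≡ a + d + μ + h + c
              lemma = solve-∀

          untied : h < a + μ → Z
          untied h<a+μ = let x , K≡h+x , x≤c = tail in
            cut h (range 0 h ++ range a (a + μ)) (range h K)
              (length-two 0 a {h} refl refl (≤-reflexive (sym b≡)))
              (≤-trans (≤-reflexive (length-range h K≡h+x)) x≤c)
              heavy light
            where
            heavy : ∀ n → n < K → n ∉ range 0 h ++ range a (a + μ) → ∃[ w ] h < w × Link (p n) (r n) w
            heavy n n<K n∉ with ∉-two {0} {h} n∉
            ... | inj₂ h≤n , inj₁ n<a   = suc n , s≤s h≤n , low n n<K n<a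
            ... | inj₂ h≤n , inj₂ a+μ≤n = n , <-≤-trans h<a+μ a+μ≤n , high n n<K (K≤n+d a+μ≤n)
            light : ∀ n → n < K → n ∉ range h K → ∃[ w ] w ≤ h × Link (p n) (r n) w
            light n n<K n∉ with ∉-range n∉
            ... | inj₁ n<h = suc n , n<h , low n n<K (<-≤-trans n<h h≤a)
            ... | inj₂ K≤n = absurd-≥ n<K K≤n

        -- K < b + d
        large : K < b + d → Z
        large K<b+d with decompose (+-cancelʳ-< d a b (≤-<-trans a+d≤K K<b+d)) | decompose b≤K
          where
          a+d≤K : a + d ≤ K
          a+d≤K = ≤-trans (m≤m+n (a + d) μ) (≤-reflexive (sym K≡))
        ... | o , b≡1+a+o | x , K≡b+x =
            cut (a + o) (range 0 b) (range a (a + μ) ++ range b K)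
              (≤-reflexive (length-range 0 refl)) (length-two a b refl K≡b+x μ+x≤c) heavy light
          where
          μ+x≤c : μ + x ≤ c
          μ+x≤c = cancel-≤ (a + b + d) 2K≤
            (trans (cong₂ _+_ K≡ K≡b+x) (lemma₁ a b d μ x)) (lemma₂ a b c d)
            where
            lemma₁ : ∀ a b d μ x → a + d + μ + (b + x) ≡ a + b + d + (μ + x)
            lemma₁ = solve-∀
            lemma₂ : ∀ a b c d → a + b + c + d ≡ a + b + d + c
            lemma₂ = solve-∀
          a+o<b : a + o < b
          a+o<b = ≤-reflexive (sym b≡1+a+o)
          heavy : ∀ n → n < K → n ∉ range 0 b → ∃[ w ] a + o < w × Link (p n) (r n) w
          heavy n n<K n∉ with ∉-range {0} n∉
          ... | inj₂ b≤n = n , <-≤-trans a+o<b b≤n ,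
            high n n<K (≤-trans (<⇒≤ K<b+d) (+-monoˡ-≤ d b≤n))
          light : ∀ n → n < K → n ∉ range a (a + μ) ++ range b K → ∃[ w ] w ≤ a + o × Link (p n) (r n) w
          light n n<K n∉ with ∉-two {a} {a + μ} n∉
          ... | _            , inj₂ K≤n = absurd-≥ n<K K≤n
          ... | inj₁ n<a     , _        = suc n , ≤-trans n<a (m≤m+n a o) , low n n<K n<a
          ... | inj₂ a+μ≤n   , inj₁ n<b = n , s≤s⁻¹ (≤-trans n<b (≤-reflexive b≡1+a+o)) ,
            high n n<K (K≤n+d a+μ≤n)

      -- The case K < a + d, where the places from e = K - d to a - 1 are
      -- linked twice, so that the terms at them vanish.
      module Overlapping (e : ℕ) (K≡ : K ≡ e + d) (e<a : e < a) where

        K≤n+d : ∀ {n} → e ≤ n → K ≤ n + d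
        K≤n+d e≤n = ≤-trans (≤-reflexive K≡) (+-monoˡ-≤ d e≤n)

        small : b ≤ e → Z
        small b≤e with decompose b≤e | decompose a≤K
        ... | x , e≡b+x | y , K≡a+y =
            cut b (range 0 b) (range b e ++ range a K)
              (≤-reflexive (length-range 0 refl)) (length-two b a e≡b+x K≡a+y x+y≤c) heavy light
          where
          x+y≤c : x + y ≤ c
          x+y≤c = cancel-≤ (a + b + d) 2K≤
            (trans (cong₂ _+_ K≡a+y (trans K≡ (cong (λ e → e + d) e≡b+x))) (lemma₁ a b d x y))
            (lemma₂ a b c d)
            where
            lemma₁ : ∀ a b d x y → a + y + (b + x + d) ≡ a + b + d + (x + y)
            lemma₁ = solve-∀
            lemma₂ : ∀ a b c d → a + b + c + d ≡ a + b + d + c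
            lemma₂ = solve-∀
          heavy : ∀ n → n < K → n ∉ range 0 b → ∃[ w ] b < w × Link (p n) (r n) w
          heavy n n<K n∉ with ∉-range {0} n∉ | n ℕ.<? a | n ℕ.<? e
          ... | inj₂ b≤n | yes n<a | _       = suc n , s≤s b≤n , low n n<K n<a
          ... | inj₂ b≤n | no  n≮a | _       = n , <-≤-trans (≤-<-trans b≤e e<a) (≮⇒≥ n≮a) ,
            high n n<K (K≤n+d (≤-trans (<⇒≤ e<a) (≮⇒≥ n≮a)))
          light : ∀ n → n < K → n ∉ range b e ++ range a K → ∃[ w ] w ≤ b × Link (p n) (r n) w
          light n n<K n∉ with ∉-two {b} {e} n∉
          ... | _        , inj₂ K≤n = absurd-≥ n<K K≤n
          ... | inj₁ n<b , _        = suc n , n<b , low n n<K (<-trans (<-≤-trans n<b b≤e) e<a)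
          ... | inj₂ e≤n , inj₁ n<a = 0 , z≤n , both n n<K n<a (K≤n+d e≤n) 0

        -- b = e + 1 + β
        large : ∀ β → b ≡ suc (e + β) → Z
        large β b≡ = cut (a + β) (range 0 e ++ range a h) (range h K)
            (length-two 0 a {e} refl refl (≤-reflexive (trans (+-suc e β) (sym b≡)))) LP≤c heavy light
          where
          h = a + suc β
          a+β<h : a + β < h
          a+β<h = +-monoʳ-< a ≤-refl
          LP≤c : length (range h K) ≤ c
          LP≤c with h ℕ.≤? K
          ... | yes h≤K = let x , K≡h+x = decompose h≤K in
            ≤-trans (≤-reflexive (length-range h K≡h+x)) (cancel-≤ (h + K) 2K≤
              (trans (cong (λ m → m + K) K≡h+x) (lemma₁ h x K))
              (trans (cong (λ b → a + b + c + d) b≡)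
                (trans (lemma₂ a β c d e) (cong (λ K → h + K + c) (sym K≡)))))
            where
            lemma₁ : ∀ h x K → h + x + K ≡ h + K + x
            lemma₁ = solve-∀
            lemma₂ : ∀ a β c d e → a + suc (e + β) + c + d ≡ a + suc β + (e + d) + c
            lemma₂ = solve-∀
          ... | no  h≰K = ≤-trans (≤-reflexive (trans (length-map _ (downFrom (K ∸ h)))
            (trans (length-downFrom (K ∸ h)) (m≤n⇒m∸n≡0 (<⇒≤ (≰⇒> h≰K)))))) z≤n
          heavy : ∀ n → n < K → n ∉ range 0 e ++ range a h → ∃[ w ] a + β < w × Link (p n) (r n) w
          heavy n n<K n∉ with ∉-two {0} {e} n∉
          ... | inj₂ e≤n , inj₁ n<a = h , a+β<h , both n n<K n<a (K≤n+d e≤n) h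
          ... | inj₂ e≤n , inj₂ h≤n = n , <-≤-trans a+β<h h≤n , high n n<K (K≤n+d e≤n)
          light : ∀ n → n < K → n ∉ range h K → ∃[ w ] w ≤ a + β × Link (p n) (r n) w
          light n n<K n∉ with ∉-range n∉
          ... | inj₂ K≤n = absurd-≥ n<K K≤n
          ... | inj₁ n<h with n ℕ.<? e | n ℕ.<? a
          ...   | yes n<e | _       = suc n , ≤-trans n<e (≤-trans (<⇒≤ e<a) (m≤m+n a β)) ,
            low n n<K (<-trans n<e e<a)
          ...   | no  n≮e | yes n<a = 0 , z≤n , both n n<K n<a (K≤n+d (≮⇒≥ n≮e)) 0
          ...   | no  n≮e | no  n≮a = n , s≤s⁻¹ (≤-trans n<h (≤-reflexive (+-suc a β))) ,
            high n n<K (K≤n+d (≮⇒≥ n≮e))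

    linked⇒zero : a ≢ 0 → d ≢ 0 → ¬ (a ≡ 1 × b ≡ 1 × c ≡ 1 × d ≡ 1) → Z
    linked⇒zero a≢0 d≢0 ¬ones with a + d ℕ.≤? K
    linked⇒zero a≢0 d≢0 ¬ones | no a+d≰K = overlapping (decompose d≤K)
      where
      overlapping : ∃[ e ] K ≡ d + e → Z
      overlapping (e , K≡d+e) = split (b ℕ.≤? e)
        where
        K≡e+d : K ≡ e + d
        K≡e+d = trans K≡d+e (+-comm d e)
        e<a : e < a
        e<a = +-cancelʳ-< d e a (≤-<-trans (≤-reflexive (sym K≡e+d)) (≰⇒> a+d≰K))
        split : Dec (b ≤ e) → Z
        split (yes b≤e) = Overlapping.small e K≡e+d e<a b≤e
        split (no  b≰e) = let β , b≡1+e+β = decompose (≰⇒> b≰e) in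
          Overlapping.large e K≡e+d e<a β b≡1+e+β
    linked⇒zero a≢0 d≢0 ¬ones | yes a+d≤K = disjoint (decompose a+d≤K)
      where
      disjoint : ∃[ μ ] K ≡ a + d + μ → Z
      disjoint (μ , K≡) with b + d ℕ.≤? K
      ... | no  b+d≰K = Disjoint.large μ K≡ (≰⇒> b+d≰K)
      ... | yes b+d≤K = upper (decompose μ≤b)
        where
        μ≤b : μ ≤ b
        μ≤b = cancel-≤ (K + a + d) (≤-trans 2K≤ (+-monoˡ-≤ d (+-monoʳ-≤ (a + b) c≤K)))
          (trans (cong (λ m → K + m) K≡) (lemma₁ K a d μ)) (lemma₂ K a b d)
          where
          lemma₁ : ∀ K a d μ → K + (a + d + μ) ≡ K + a + d + μ
          lemma₁ = solve-∀
          lemma₂ : ∀ K a b d → a + b + K + d ≡ K + a + d + b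
          lemma₂ = solve-∀
        upper : ∃[ h ] b ≡ μ + h → Z
        upper (h , b≡μ+h) with h ℕ.<? a + μ
        ... | yes h<a+μ = Disjoint.untied μ K≡ h (trans b≡μ+h (+-comm μ h)) h≤a h<a+μ
          where
          h≤a : h ≤ a
          h≤a = cancel-≤ (d + μ) b+d≤K (trans (cong (λ b → b + d) b≡μ+h) (lemma₁ d h μ))
            (trans K≡ (lemma₂ a d μ))
            where
            lemma₁ : ∀ d h μ → μ + h + d ≡ d + μ + h
            lemma₁ = solve-∀
            lemma₂ : ∀ a d μ → a + d + μ ≡ d + μ + a
            lemma₂ = solve-∀
        -- Then μ = 0 and h = a = b.
        ... | no  h≮a+μ = tied (c ℕ.≟ d)
          where
          a+μ≤h : a + μ ≤ h
          a+μ≤h = ≮⇒≥ h≮a+μ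
          μ≡0 : μ ≡ 0
          μ≡0 = n≤0⇒n≡0 (cancel-≤ (a + d + μ)
            (≤-trans (+-monoʳ-≤ (d + μ) a+μ≤h)
              (≤-trans (≤-reflexive (trans (lemma d μ h) (cong (λ b → b + d) (sym b≡μ+h)))) b+d≤K))
            (lemma′ a d μ) (trans K≡ (sym (+-identityʳ (a + d + μ)))))
            where
            lemma : ∀ d μ h → d + μ + h ≡ μ + h + d
            lemma = solve-∀
            lemma′ : ∀ a d μ → d + μ + (a + μ) ≡ a + d + μ + μ
            lemma′ = solve-∀
          K≡a+d : K ≡ a + d
          K≡a+d = trans K≡ (trans (cong (λ m → a + d + m) μ≡0) (+-identityʳ (a + d)))
          a≤b : a ≤ b
          a≤b = ≤-trans (m≤m+n a μ) (≤-trans a+μ≤h (≤-trans (m≤n+m h μ) (≤-reflexive (sym b≡μ+h))))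
          a≡b : a ≡ b
          a≡b = ≤-antisym a≤b (+-cancelʳ-≤ d b a (≤-trans b+d≤K (≤-reflexive K≡a+d)))
          d≤c : d ≤ c
          d≤c = cancel-≤ (a + a + d) 2K≤ (trans (cong₂ _+_ K≡a+d K≡a+d) (lemma a d))
            (trans (cong (λ b → a + b + c + d) (sym a≡b)) (lemma′ a c d))
            where
            lemma : ∀ a d → a + d + (a + d) ≡ a + a + d + d
            lemma = solve-∀
            lemma′ : ∀ a c d → a + a + c + d ≡ a + a + d + c
            lemma′ = solve-∀
          tied : Dec (c ≡ d) → Z
          tied (yes c≡d) = extreme r-moments p-moments low high K≡a+d a≡b c≡d a≢0 d≢0 λ ad≡1 →
            let a≡1 = m*n≡1⇒m≡1 a d ad≡1
                d≡1 = m*n≡1⇒n≡1 a d ad≡1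
            in ¬ones (a≡1 , trans (sym a≡b) a≡1 , trans c≡d d≡1 , d≡1)
          tied (no c≢d) with decompose (n≢0⇒n>0 a≢0)
          ... | a′ , a≡1+a′ = cut a′ (range 0 a′) (range a′ K)
            (≤-trans (≤-reflexive (length-range 0 refl)) (≤-trans (<⇒≤ a′<a) a≤b))
            (≤-trans (≤-reflexive (length-range a′ K≡a′+1+d)) (≤∧≢⇒< d≤c (c≢d ∘ sym)))
            heavy light
            where
            a′<a : a′ < a
            a′<a = ≤-reflexive (sym a≡1+a′)
            K≡a′+1+d : K ≡ a′ + suc d
            K≡a′+1+d = trans K≡a+d (trans (cong (λ a → a + d) a≡1+a′) (sym (+-suc a′ d)))
            heavy : ∀ n → n < K → n ∉ range 0 a′ → ∃[ w ] a′ < w × Link (p n) (r n) w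
            heavy n n<K n∉ with ∉-range {0} n∉ | n ℕ.<? a
            ... | inj₂ a′≤n | yes n<a = suc n , s≤s a′≤n , low n n<K n<a
            ... | inj₂ a′≤n | no  n≮a = n , <-≤-trans a′<a (≮⇒≥ n≮a) ,
              high n n<K (≤-trans (≤-reflexive K≡a+d) (+-monoˡ-≤ d (≮⇒≥ n≮a)))
            light : ∀ n → n < K → n ∉ range a′ K → ∃[ w ] w ≤ a′ × Link (p n) (r n) w
            light n n<K n∉ with ∉-range n∉
            ... | inj₁ n<a′ = suc n , n<a′ , low n n<K (<-trans n<a′ a′<a)
            ... | inj₂ K≤n  = absurd-≥ n<K K≤n

open LinkedSequences using (weight; MomentsVanish; Link; linked⇒zero)

module _ {R : CommutativeRing 0ℓ 0ℓ} where

  open CommutativeRing R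
  open IsDerivation
  open CommutativeSemigroupProperties *-commutativeSemigroup using (x∙yz≈y∙xz)
  open IntegerSolver R

  *-isDerivation : ∀ a {D} → IsDerivation R D → IsDerivation R (λ x → a * D x)
  *-isDerivation a {D} isD = record
    { D-cong = λ e → *-congˡ (D-cong isD e)
    ; D-+ = λ x y → trans (*-congˡ (D-+ isD x y)) (distribˡ a (D x) (D y))
    ; leibniz = λ x y → trans (*-congˡ (leibniz isD x y))
        (solve 5 (λ a x y x′ y′ → a :* (x′ :* y :+ x :* y′) := (a :* x′) :* y :+ x :* (a :* y′))
          refl a x y (D x) (D y))
    }

  +-isDerivation : ∀ {D D′} → IsDerivation R D → IsDerivation R D′ →
                   IsDerivation R (λ x → D x + D′ x)
  +-isDerivation {D} {D′} isD isD′ = record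
    { D-cong = λ e → +-cong (D-cong isD e) (D-cong isD′ e)
    ; D-+ = λ x y → trans (+-cong (D-+ isD x y) (D-+ isD′ x y))
        (solve 4 (λ a b c d → (a :+ b) :+ (c :+ d) := (a :+ c) :+ (b :+ d))
          refl (D x) (D y) (D′ x) (D′ y))
    ; leibniz = λ x y → trans (+-cong (leibniz isD x y) (leibniz isD′ x y))
        (solve 6 (λ x y a b c d → (a :* y :+ x :* b) :+ (c :* y :+ x :* d)
            := (a :+ c) :* y :+ x :* (b :+ d))
          refl x y (D x) (D y) (D′ x) (D′ y))
    }

-- Eigenvectors of a derivation, with eigenvalues in the ring.

module Eigenvectors {R : CommutativeRing 0ℓ 0ℓ} {E} (isDerivation : IsDerivation R E) where

  open CommutativeRing R
  open IsDerivation isDerivation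
  open IntegerSolver R

  eigen-* : ∀ {a b f g} → E f ≈ a * f → E g ≈ b * g → E (f * g) ≈ (a + b) * (f * g)
  eigen-* {a} {b} {f} {g} Ef≈af Eg≈bg = trans (leibniz f g) (trans
    (+-cong (*-congʳ Ef≈af) (*-congˡ Eg≈bg))
    (solve 4 (λ a b f g → (a :* f) :* g :+ f :* (b :* g) := (a :+ b) :* (f :* g)) refl a b f g))

  eigen-cofactor : ∀ {m n f g} → IsDomain R → ¬ g ≈ 0# → E g ≈ m * g → E (f * g) ≈ n * (f * g) →
                   E f ≈ (n - m) * f
  eigen-cofactor {m} {n} {f} {g} isDomain g≉0 Eg≈mg Efg≈nfg =
    IsDomain.*-cancelʳ isDomain g≉0 (begin
      E f * g
        ≈⟨ solve 4 (λ e m f g → e :* g := (e :* g :+ f :* (m :* g)) :- m :* (f :* g)) refl (E f) m f g ⟩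
      E f * g + f * (m * g) - m * (f * g)
        ≈⟨ +-congʳ (+-congˡ (*-congˡ Eg≈mg)) ⟨
      E f * g + f * E g - m * (f * g)
        ≈⟨ +-congʳ (trans (sym (leibniz f g)) Efg≈nfg) ⟩
      n * (f * g) - m * (f * g)
        ≈⟨ solve 4 (λ n m f g → n :* (f :* g) :- m :* (f :* g) := ((n :- m) :* f) :* g) refl n m f g ⟩
      (n - m) * f * g ∎)
    where open SetoidReasoning setoid

-- Homogeneous polynomials in two variables

-- The ring S = K[x,y], represented by polynomials in x over K[y].

module Plane {K : CommutativeRing 0ℓ 0ℓ} (K-isDomain : IsDomain K) (K-charZero : CharZero K) where

  module K = CommutativeRing K
  module U = Univariate K
  module T = Univariate (K [X 1 ])
  module K[y] = CommutativeRing (K [X 1 ])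
  module S = CommutativeRing (K [X 2 ])
  module UP = Polynomials K
  module TP = Polynomials (K [X 1 ])
  open Multivariate K using (constant; var; ∂; IsHomogeneous; ∂-isDerivation)
  open Integers K using () renaming (fromℤ to fromℤᴷ)
  open Integers (K [X 2 ])
  open SetoidReasoning K.setoid

  S-isDomain : IsDomain (K [X 2 ])
  S-isDomain = polynomial-isDomain {K [X 1 ]} (polynomial-isDomain {K} K-isDomain)

  private
    module Dom = IsDomain S-isDomain

  x y : S.Carrier
  x = var {2} zero
  y = var {2} (suc zero)

  ∂x ∂y : S.Carrier → S.Carrier
  ∂x = ∂ {2} zero
  ∂y = ∂ {2} (suc zero)

  -- The coefficient of x^i y^j.

  coeff₂ : S.Carrier → ℕ → ℕ → K.Carrier
  coeff₂ f i j = U.coeff (T.coeff f i) j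

  coeff₂-cong : ∀ {f g} → f S.≈ g → ∀ i j → coeff₂ f i j K.≈ coeff₂ g i j
  coeff₂-cong e i j = U.coeffs (T.coeffs e i) j

  coeff₂-ext : ∀ {f g} → (∀ i j → coeff₂ f i j K.≈ coeff₂ g i j) → f S.≈ g
  coeff₂-ext e = T.mk≋ λ i → U.mk≋ λ j → e i j

  coeff₂-+ : ∀ f g i j → coeff₂ (f S.+ g) i j K.≈ coeff₂ f i j K.+ coeff₂ g i j
  coeff₂-+ f g i j = K.trans (U.coeffs (T.coeff-⊕ f g i) j) (U.coeff-⊕ (T.coeff f i) (T.coeff g i) j)

  coeff₂-neg : ∀ f i j → coeff₂ (S.- f) i j K.≈ K.- coeff₂ f i j
  coeff₂-neg f i j = K.trans (U.coeffs (T.coeff-⊖ f i) j) (U.coeff-⊖ (T.coeff f i) j)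

  coeff₂-constant : ∀ a f i j → coeff₂ (constant 2 a S.* f) i j K.≈ a K.* coeff₂ f i j
  coeff₂-constant a f i j = K.trans (U.coeffs (TP.coeff-C-⊗ (constant 1 a) f i) j)
    (UP.coeff-C-⊗ a (T.coeff f i) j)

  coeff₂-fromℤ : ∀ n f i j → coeff₂ (fromℤ n S.* f) i j K.≈ fromℤᴷ n K.* coeff₂ f i j
  coeff₂-fromℤ n f i j = K.trans (U.coeffs (TP.coeff-fromℤ-⊗ n f i) j)
    (UP.coeff-fromℤ-⊗ n (T.coeff f i) j)

  coeff₂-x∂x : ∀ f i j → coeff₂ (x S.* ∂x f) i j K.≈ fromℤᴷ (+ i) K.* coeff₂ f i j
  coeff₂-x∂x f i j = K.trans (U.coeffs (TP.coeff-X-deriv f i) j) (UP.coeff-fromℤ-⊗ (+ i) (T.coeff f i) j)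

  private
    coeff-map-deriv : ∀ f i → T.coeff (map U.deriv f) i ≡ U.deriv (T.coeff f i)
    coeff-map-deriv []      i       = ≡.refl
    coeff-map-deriv (a ∷ f) zero    = ≡.refl
    coeff-map-deriv (a ∷ f) (suc i) = coeff-map-deriv f i

  coeff₂-∂x : ∀ f i j → coeff₂ (∂x f) i j K.≈ fromℤᴷ (+ suc i) K.* coeff₂ f (suc i) j
  coeff₂-∂x f i j = K.trans (U.coeffs (TP.coeff-deriv f i) j)
    (UP.coeff-fromℤ-⊗ (+ suc i) (T.coeff f (suc i)) j)

  coeff₂-∂y : ∀ f i j → coeff₂ (∂y f) i j K.≈ fromℤᴷ (+ suc j) K.* coeff₂ f i (suc j)
  coeff₂-∂y f i j = K.trans (K.reflexive (≡.cong (λ g → U.coeff g j) (coeff-map-deriv f i)))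
    (UP.coeff-deriv (T.coeff f i) j)

  coeff₂-y∂y : ∀ f i j → coeff₂ (y S.* ∂y f) i j K.≈ fromℤᴷ (+ j) K.* coeff₂ f i j
  coeff₂-y∂y f i j = K.trans (U.coeffs (TP.coeff-C-⊗ UP.X (∂y f) i) j) (K.trans
    (U.coeffs (U.⊗-congˡ UP.X (K[y].reflexive (coeff-map-deriv f i))) j)
    (UP.coeff-X-deriv (T.coeff f i) j))

  -- The Euler derivation x ∂x + y ∂y.

  euler : S.Carrier → S.Carrier
  euler f = x S.* ∂x f S.+ y S.* ∂y f

  euler-isDerivation : IsDerivation (K [X 2 ]) euler
  euler-isDerivation = +-isDerivation {K [X 2 ]} (*-isDerivation {K [X 2 ]} x (∂-isDerivation {2} zero))
    (*-isDerivation {K [X 2 ]} y (∂-isDerivation {2} (suc zero)))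

  open Eigenvectors {K [X 2 ]} euler-isDerivation

  coeff₂-euler : ∀ f i j → coeff₂ (euler f) i j K.≈ fromℤᴷ (+ (i ℕ.+ j)) K.* coeff₂ f i j
  coeff₂-euler f i j = begin
    coeff₂ (euler f) i j
      ≈⟨ coeff₂-+ (x S.* ∂x f) (y S.* ∂y f) i j ⟩
    coeff₂ (x S.* ∂x f) i j K.+ coeff₂ (y S.* ∂y f) i j
      ≈⟨ K.+-cong (coeff₂-x∂x f i j) (coeff₂-y∂y f i j) ⟩
    fromℤᴷ (+ i) K.* c K.+ fromℤᴷ (+ j) K.* c
      ≈⟨ K.distribʳ c _ _ ⟨
    (fromℤᴷ (+ i) K.+ fromℤᴷ (+ j)) K.* c
      ≈⟨ K.*-congʳ (Integers.fromℤ-+ K (+ i) (+ j)) ⟨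
    fromℤᴷ (+ (i ℕ.+ j)) K.* c ∎
    where c = coeff₂ f i j

  fromℤ≉0 : ∀ {n} → n ≢ ℤ.0ℤ → ¬ fromℤᴷ n K.≈ K.0#
  fromℤ≉0 {+ n} n≢0 e = n≢0 (≡.cong +_ (K-charZero n (K.trans (Mult.×ᵤ≈× K.semiring n K.1#) e)))
  fromℤ≉0 { -[1+ n ]} n≢0 e with K-charZero (suc n) (K.trans (Mult.×ᵤ≈× K.semiring (suc n) K.1#)
    (K.trans (K.sym (-‿involutive _)) (K.trans (K.-‿cong e) ε⁻¹≈ε)))
    where open GroupProperties K.+-group using (ε⁻¹≈ε) renaming (⁻¹-involutive to -‿involutive)
  ... | ()

  -- All terms of f have degree k; so the zero polynomial is homogeneous of
  -- every degree.

  Homogeneous : ℕ → S.Carrier → Set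
  Homogeneous k f = ∀ i j → i ℕ.+ j ≢ k → coeff₂ f i j K.≈ K.0#

  IsHomogeneous⇒Homogeneous : ∀ {k f} → IsHomogeneous {2} k f → Homogeneous k f
  IsHomogeneous⇒Homogeneous hom i j i+j≢k =
    hom (i Data.Vec.Base.∷ j Data.Vec.Base.∷ Data.Vec.Base.[])
      (λ e → i+j≢k (≡.trans (≡.cong (i ℕ.+_) (≡.sym (ℕ.+-identityʳ j))) e))
    where import Data.Vec.Base

  homogeneous-cong : ∀ {k f g} → f S.≈ g → Homogeneous k f → Homogeneous k g
  homogeneous-cong e hom i j i+j≢k = K.trans (K.sym (coeff₂-cong e i j)) (hom i j i+j≢k)

  homogeneous-sub : ∀ {k f g} → Homogeneous k f → Homogeneous k g → Homogeneous k (f S.- g)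
  homogeneous-sub {k} {f} {g} hom-f hom-g i j i+j≢k = begin
    coeff₂ (f S.- g) i j               ≈⟨ coeff₂-+ f (S.- g) i j ⟩
    coeff₂ f i j K.+ coeff₂ (S.- g) i j
      ≈⟨ K.+-cong (hom-f i j i+j≢k) (K.trans (coeff₂-neg g i j) (K.-‿cong (hom-g i j i+j≢k))) ⟩
    K.0# K.- K.0#                      ≈⟨ K.-‿inverseʳ K.0# ⟩
    K.0#                               ∎

  homogeneous-neg : ∀ {k f} → Homogeneous k f → Homogeneous k (S.- f)
  homogeneous-neg {k} {f} hom i j i+j≢k = K.trans (coeff₂-neg f i j)
    (K.trans (K.-‿cong (hom i j i+j≢k)) ε⁻¹≈ε)
    where open GroupProperties K.+-group using (ε⁻¹≈ε)

  homogeneous-0 : ∀ {k} → Homogeneous k S.0#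
  homogeneous-0 i j _ = K.refl

  homogeneous-∂ : ∀ {k f} v → Homogeneous (suc k) f → Homogeneous k (∂ {2} v f)
  homogeneous-∂ {f = f} zero hom i j i+j≢k = K.trans (coeff₂-∂x f i j)
    (K.trans (K.*-congˡ (hom (suc i) j (i+j≢k ∘ ℕ.suc-injective))) (K.zeroʳ _))
  homogeneous-∂ {f = f} (suc zero) hom i j i+j≢k = K.trans (coeff₂-∂y f i j)
    (K.trans (K.*-congˡ (hom i (suc j) (i+j≢k ∘ λ e → ℕ.suc-injective (≡.trans (≡.sym (ℕ.+-suc i j)) e))))
      (K.zeroʳ _))

  homogeneous⇒euler : ∀ {k f} → Homogeneous k f → euler f S.≈ fromℤ (+ k) S.* f
  homogeneous⇒euler {k} {f} hom = coeff₂-ext λ i j →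
    K.trans (coeff₂-euler f i j) (K.trans (eq i j) (K.sym (coeff₂-fromℤ (+ k) f i j)))
    where
    eq : ∀ i j → fromℤᴷ (+ (i ℕ.+ j)) K.* coeff₂ f i j K.≈ fromℤᴷ (+ k) K.* coeff₂ f i j
    eq i j with i ℕ.+ j ℕ.≟ k
    ... | yes ≡.refl  = K.refl
    ... | no  i+j≢k = K.trans (K.trans (K.*-congˡ (hom i j i+j≢k)) (K.zeroʳ _))
      (K.sym (K.trans (K.*-congˡ (hom i j i+j≢k)) (K.zeroʳ _)))

  -- An eigenvector of the Euler derivation for n has terms of degree n only.
  -- As n may be negative, this also shows that some eigenvectors vanish.

  euler⇒coeff₂≈0 : ∀ {n f} → euler f S.≈ fromℤ n S.* f →
                   ∀ i j → + (i ℕ.+ j) ≢ n → coeff₂ f i j K.≈ K.0#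
  euler⇒coeff₂≈0 {n} {f} e i j i+j≢n = IsDomain.*-cancelˡ-0 K-isDomain
    (fromℤ≉0 {+ (i ℕ.+ j) ℤ.- n} (i+j≢n ∘ ℤ.i-j≡0⇒i≡j (+ (i ℕ.+ j)) n)) (begin
      fromℤᴷ (+ (i ℕ.+ j) ℤ.- n) K.* c
        ≈⟨ K.*-congʳ (K.trans (Integers.fromℤ-+ K (+ (i ℕ.+ j)) (ℤ.- n)) (K.+-congˡ (Integers.fromℤ-neg K n))) ⟩
      (fromℤᴷ (+ (i ℕ.+ j)) K.- fromℤᴷ n) K.* c
        ≈⟨ I.solve 3 (λ a b c → (a I.:- b) I.:* c I.:= a I.:* c I.:- b I.:* c) K.refl _ _ c ⟩
      fromℤᴷ (+ (i ℕ.+ j)) K.* c K.- fromℤᴷ n K.* c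
        ≈⟨ K.+-cong (K.trans (K.sym (coeff₂-euler f i j)) (coeff₂-cong e i j))
             (K.-‿cong (K.sym (coeff₂-fromℤ n f i j))) ⟩
      coeff₂ (fromℤ n S.* f) i j K.- coeff₂ (fromℤ n S.* f) i j
        ≈⟨ K.-‿inverseʳ _ ⟩
      K.0# ∎)
    where
    module I = IntegerSolver K
    import Data.Integer.Properties as ℤ
    c = coeff₂ f i j

  homogeneous-* : ∀ {k l f g} → Homogeneous k f → Homogeneous l g → Homogeneous (k ℕ.+ l) (f S.* g)
  homogeneous-* {k} {l} {f} {g} hom-f hom-g i j i+j≢ = euler⇒coeff₂≈0 {+ (k ℕ.+ l)}
    (S.trans (eigen-* {fromℤ (+ k)} {fromℤ (+ l)} {f} {g} (homogeneous⇒euler hom-f) (homogeneous⇒euler hom-g))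
      (S.*-congʳ {f S.* g} (S.sym (fromℤ-+ (+ k) (+ l)))))
    i j (i+j≢ ∘ ℤ.+-injective)
    where import Data.Integer.Properties as ℤ

  -- The degree of a homogeneous divisor: the cofactor Z is an eigenvector of
  -- the Euler derivation for N - M, so it is zero if N < M.

  divisor-degree : ∀ {M N J Z} → Homogeneous M J → Homogeneous N (Z S.* J) →
                   ¬ Z S.* J S.≈ S.0# → M ℕ.≤ N
  divisor-degree {M} {N} {J} {Z} hom-J hom-ZJ ZJ≉0 with M ℕ.≤? N
  ... | yes M≤N = M≤N
  ... | no  M≰N = contradiction (S.trans (S.*-congʳ {J} Z≈0) (S.zeroˡ J)) ZJ≉0
    where
    import Data.Integer.Properties as ℤ
    J≉0 : ¬ J S.≈ S.0#
    J≉0 J≈0 = ZJ≉0 (S.trans (S.*-congˡ {Z} J≈0) (S.zeroʳ Z))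
    n = + N ℤ.- + M
    euler-Z : euler Z S.≈ fromℤ n S.* Z
    euler-Z = S.trans
      (eigen-cofactor {fromℤ (+ M)} {fromℤ (+ N)} {Z} {J} S-isDomain J≉0 (homogeneous⇒euler hom-J) (homogeneous⇒euler hom-ZJ))
      (S.*-congʳ {Z} (S.sym (S.trans (fromℤ-+ (+ N) (ℤ.- + M)) (S.+-congˡ {fromℤ (+ N)} (fromℤ-neg (+ M))))))
    Z≈0 : Z S.≈ S.0#
    Z≈0 = coeff₂-ext λ i j → euler⇒coeff₂≈0 {n} euler-Z i j λ e →
      M≰N (ℤ.drop‿+≤+ (ℤ.0≤i-j⇒j≤i (≡.subst (ℤ.0ℤ ℤ.≤_) e (ℤ.+≤+ ℕ.z≤n))))

-- Rank two modules and Euclid's algorithm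

-- A surjection from S to the polynomial ring F[z] whose kernel is
-- generated by α, with a section.

record Residue (F S : CommutativeRing 0ℓ 0ℓ) (α : CommutativeRing.Carrier S) : Set where
  private
    module S = CommutativeRing S
    F[z] = Univariate.polynomialRing F
    module F[z] = CommutativeRing F[z]
  open SemiringDivisibility S.semiring using (_∣_)
  field
    ρ              : S.Carrier → F[z].Carrier
    isHomomorphism : IsHomomorphism S F[z] ρ
    section        : F[z].Carrier → S.Carrier
    ρ-section      : ∀ p → ρ (section p) F[z].≈ p
    ρ-α            : ρ α F[z].≈ F[z].0#
    kernel         : ∀ {f} → ρ f F[z].≈ F[z].0# → α ∣ f

module Monomials (F : CommutativeRing 0ℓ 0ℓ) where

  open CommutativeRing F
  open Univariate F
  open Polynomials F

  -- c z^j

  monomial : Carrier → ℕ → Poly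
  monomial c zero    = C c
  monomial c (suc j) = 0# ∷ monomial c j

  coeff-monomial-⊗ : ∀ c j p n → coeff (monomial c j ⊗ p) (j ℕ.+ n) ≈ c * coeff p n
  coeff-monomial-⊗ c zero    p n = coeff-C-⊗ c p n
  coeff-monomial-⊗ c (suc j) p n = trans (coeffs (shift-⊗ (monomial c j) p) (suc (j ℕ.+ n)))
    (coeff-monomial-⊗ c j p n)

-- Pairs of elements of S, such as the coefficients of a derivation.

module RankTwo (S : CommutativeRing 0ℓ 0ℓ) where

  open CommutativeRing S hiding (zero)
  open IntegerSolver S

  Pair : Set
  Pair = Fin 2 → Carrier

  det : Pair → Pair → Carrier
  det η ζ = η zero * ζ (suc zero) - η (suc zero) * ζ zero

  -- Two generators of the submodule D, whose determinant satisfies Q.  They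
  -- are independent as soon as Q excludes zero.

  record Basis (D : Pred Pair 0ℓ) (Q : Pred Carrier 0ℓ) : Set where
    field
      η ζ      : Pair
      η∈D      : D η
      ζ∈D      : D ζ
      spanning : ∀ {θ} → D θ → ∃[ a ] ∃[ b ] (∀ i → θ i ≈ a * η i + b * ζ i)
      Q-det    : Q (det η ζ)

  -- Cramer's rule.

  det-cramerˡ : ∀ {η ζ a b} → (∀ i → a * η i + b * ζ i ≈ 0#) → a * det η ζ ≈ 0#
  det-cramerˡ {η} {ζ} {a} {b} e = trans
    (solve 6 (λ a b η₀ η₁ ζ₀ ζ₁ → a :* (η₀ :* ζ₁ :- η₁ :* ζ₀)
        := (a :* η₀ :+ b :* ζ₀) :* ζ₁ :- (a :* η₁ :+ b :* ζ₁) :* ζ₀)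
      refl a b (η zero) (η (suc zero)) (ζ zero) (ζ (suc zero)))
    (trans (+-cong (*-congʳ (e zero)) (-‿cong (*-congʳ (e (suc zero)))))
      (solve 2 (λ u v → con ℤ.0ℤ :* u :- con ℤ.0ℤ :* v := con ℤ.0ℤ) refl _ _))

  det-swap : ∀ η ζ → det ζ η ≈ - det η ζ
  det-swap η ζ = solve 4 (λ η₀ η₁ ζ₀ ζ₁ → ζ₀ :* η₁ :- ζ₁ :* η₀ := :- (η₀ :* ζ₁ :- η₁ :* ζ₀))
    refl (η zero) (η (suc zero)) (ζ zero) (ζ (suc zero))

  det-scaleʳ : ∀ α η ζ → det η (λ i → α * ζ i) ≈ α * det η ζ
  det-scaleʳ α η ζ = solve 5 (λ α η₀ η₁ ζ₀ ζ₁ → η₀ :* (α :* ζ₁) :- η₁ :* (α :* ζ₀)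
      := α :* (η₀ :* ζ₁ :- η₁ :* ζ₀))
    refl α (η zero) (η (suc zero)) (ζ zero) (ζ (suc zero))

  det-addʳ : ∀ u η ζ → det η (λ i → ζ i + u * η i) ≈ det η ζ
  det-addʳ u η ζ = solve 5 (λ u η₀ η₁ ζ₀ ζ₁ → η₀ :* (ζ₁ :+ u :* η₁) :- η₁ :* (ζ₀ :+ u :* η₀)
      := η₀ :* ζ₁ :- η₁ :* ζ₀)
    refl u (η zero) (η (suc zero)) (ζ zero) (ζ (suc zero))

  det-cramerʳ : ∀ {η ζ a b} → (∀ i → a * η i + b * ζ i ≈ 0#) → b * det η ζ ≈ 0#
  det-cramerʳ {η} {ζ} {a} {b} e = trans
    (solve 6 (λ a b η₀ η₁ ζ₀ ζ₁ → b :* (η₀ :* ζ₁ :- η₁ :* ζ₀)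
        := (a :* η₁ :+ b :* ζ₁) :* η₀ :- (a :* η₀ :+ b :* ζ₀) :* η₁)
      refl a b (η zero) (η (suc zero)) (ζ zero) (ζ (suc zero)))
    (trans (+-cong (*-congʳ (e (suc zero))) (-‿cong (*-congʳ (e zero))))
      (solve 2 (λ u v → con ℤ.0ℤ :* u :- con ℤ.0ℤ :* v := con ℤ.0ℤ) refl _ _))

  swap : ∀ {D Q} → (∀ {d d′} → d ≈ d′ → Q d → Q d′) → (∀ {d} → Q d → Q (- d)) →
         Basis D Q → Basis D Q
  swap Q-resp Q-neg B = record
    { η = ζ ; ζ = η ; η∈D = ζ∈D ; ζ∈D = η∈D
    ; spanning = λ θ∈D → let a , b , e = spanning θ∈D in b , a , λ i → trans (e i) (+-comm _ _)
    ; Q-det = Q-resp (sym (det-swap η ζ)) (Q-neg Q-det)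
    }
    where open Basis B

  -- The elementary transformation that adds u η to ζ.

  add : ∀ {D Q} → (∀ {d d′} → d ≈ d′ → Q d → Q d′) →
        (∀ {θ φ} u → D θ → D φ → D (λ i → θ i + u * φ i)) →
        Basis D Q → Carrier → Basis D Q
  add Q-resp D-add B u = record
    { η = η ; ζ = λ i → ζ i + u * η i ; η∈D = η∈D ; ζ∈D = D-add u ζ∈D η∈D
    ; spanning = λ θ∈D → let a , b , e = spanning θ∈D in
        a - b * u , b , λ i → trans (e i)
          (solve 5 (λ a b u x z → a :* x :+ b :* z := (a :- b :* u) :* x :+ b :* (z :+ u :* x))
            refl a b u (η i) (ζ i))
    ; Q-det = Q-resp (sym (det-addʳ u η ζ)) Q-det
    }
    where open Basis B

-- The passage from a submodule D, on which A divides the linear form ℓ, to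
-- its submodule D′ on which α A divides ℓ.  The predicates Q and Q′ are
-- conditions on the determinant.

module Raising {F S : CommutativeRing 0ℓ 0ℓ} (F-isDomain : IsDomain F) (S-isDomain : IsDomain S) where

  open CommutativeRing S hiding (zero)
  open RankTwo S
  open SemiringDivisibility semiring using (_∣_; _∣ʳ_; _,_)

  module _
    (F-inverse : HasInverses F)
    {α : Carrier} (α≉0 : ¬ α ≈ 0#) (residue : Residue F S α)
    {ℓ : Pair → Carrier}
    (ℓ-add : ∀ a b η ζ θ → (∀ i → θ i ≈ a * η i + b * ζ i) → ℓ θ ≈ a * ℓ η + b * ℓ ζ)
    {A : Carrier} (A≉0 : ¬ A ≈ 0#)
    {D D′ : Pred Pair 0ℓ} {Q Q′ : Pred Carrier 0ℓ}
    (D-add : ∀ {θ φ} u → D θ → D φ → D (λ i → θ i + u * φ i))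
    (D-scale : ∀ {θ} u → D θ → D (λ i → u * θ i))
    (D⇒∣ : ∀ {θ} → D θ → A ∣ ℓ θ)
    (D′⇒D : ∀ {θ} → D′ θ → D θ)
    (D′⇒∣ : ∀ {θ} → D′ θ → (α * A) ∣ ℓ θ)
    (⇒D′ : ∀ {θ} → D θ → (α * A) ∣ ℓ θ → D′ θ)
    (Q-resp : ∀ {d d′} → d ≈ d′ → Q d → Q d′)
    (Q-neg : ∀ {d} → Q d → Q (- d))
    (Q⇒Q′ : ∀ {d} → Q d → Q′ d)
    (Q⇒Q′-α : ∀ {d} → Q d → Q′ (α * d))
    (Q′-resp : ∀ {d d′} → d ≈ d′ → Q′ d → Q′ d′)
    where

    open IsDomain S-isDomain
    open Residue residue
    open IsHomomorphism isHomomorphism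
    open Basis
    open IntegerSolver S
    open SetoidReasoning setoid
    private
      module F = CommutativeRing F
      module P = Univariate F
      module F[z] = CommutativeRing P.polynomialRing
      module FD = IsDomain F-isDomain
      F[z]-isDomain = polynomial-isDomain {F} F-isDomain
      module F[z]D = IsDomain F[z]-isDomain

    -- ℓ θ / A and its residue modulo α.

    cofactor : ∀ {θ} → D θ → Carrier
    cofactor θ∈D = _∣ʳ_.quotient (D⇒∣ θ∈D)

    residueOf : ∀ {θ} → D θ → F[z].Carrier
    residueOf θ∈D = ρ (cofactor θ∈D)

    cofactor-≈ : ∀ {θ} (θ∈D : D θ) → cofactor θ∈D * A ≈ ℓ θ
    cofactor-≈ θ∈D = _∣ʳ_.equality (D⇒∣ θ∈D)

    cofactor-add : ∀ {θ η ζ} (θ∈D : D θ) (η∈D : D η) (ζ∈D : D ζ) a b →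
                   (∀ i → θ i ≈ a * η i + b * ζ i) →
                   cofactor θ∈D ≈ a * cofactor η∈D + b * cofactor ζ∈D
    cofactor-add {θ} {η} {ζ} θ∈D η∈D ζ∈D a b e = *-cancelʳ A≉0 (begin
      cofactor θ∈D * A                                     ≈⟨ cofactor-≈ θ∈D ⟩
      ℓ θ                                                  ≈⟨ ℓ-add a b η ζ θ e ⟩
      a * ℓ η + b * ℓ ζ
        ≈⟨ +-cong (*-congˡ (cofactor-≈ η∈D)) (*-congˡ (cofactor-≈ ζ∈D)) ⟨
      a * (cofactor η∈D * A) + b * (cofactor ζ∈D * A)
        ≈⟨ solve 5 (λ a b x z A → a :* (x :* A) :+ b :* (z :* A) := (a :* x :+ b :* z) :* A)
             refl a b (cofactor η∈D) (cofactor ζ∈D) A ⟩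
      (a * cofactor η∈D + b * cofactor ζ∈D) * A            ∎)

    residue≈0⇒D′ : ∀ {θ} (θ∈D : D θ) → residueOf θ∈D F[z].≈ F[z].0# → D′ θ
    residue≈0⇒D′ {θ} θ∈D r≈0 = ⇒D′ θ∈D (let q , qα≈ = kernel r≈0 in q , (begin
      q * (α * A)        ≈⟨ *-assoc q α A ⟨
      q * α * A          ≈⟨ *-congʳ qα≈ ⟩
      cofactor θ∈D * A   ≈⟨ cofactor-≈ θ∈D ⟩
      ℓ θ                ∎))

    D′⇒residue≈0 : ∀ {θ} → D′ θ → (θ∈D : D θ) → residueOf θ∈D F[z].≈ F[z].0#
    D′⇒residue≈0 {θ} θ∈D′ θ∈D = let q , qαA≈ = D′⇒∣ θ∈D′ in
      F[z].trans (cong (*-cancelʳ A≉0 (begin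
        cofactor θ∈D * A   ≈⟨ cofactor-≈ θ∈D ⟩
        ℓ θ                ≈⟨ qαA≈ ⟨
        q * (α * A)        ≈⟨ *-assoc q α A ⟨
        q * α * A          ∎)))
      (F[z].trans (*-homo q α) (F[z].trans (F[z].*-congˡ {ρ q} ρ-α) (F[z].zeroʳ (ρ q))))

    ρ-add : ∀ {x a b p q} → x ≈ a * p + b * q → ρ x F[z].≈ ρ a F[z].* ρ p F[z].+ ρ b F[z].* ρ q
    ρ-add {x} {a} {b} {p} {q} e = F[z].trans (cong e) (F[z].trans (+-homo (a * p) (b * q))
      (F[z].+-cong (*-homo a p) (*-homo b q)))

    -- If the residue of η vanishes, then η and α ζ form a basis of D′, or η
    -- and ζ do.

    finish : (B : Basis D Q) → residueOf (η∈D B) F[z].≈ F[z].0# → Basis D′ Q′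
    finish B rη≈0 with F[z]D.zero? (residueOf (ζ∈D B))
    ... | yes rζ≈0 = record
      { η = η B ; ζ = ζ B
      ; η∈D = residue≈0⇒D′ (η∈D B) rη≈0 ; ζ∈D = residue≈0⇒D′ (ζ∈D B) rζ≈0
      ; spanning = λ θ∈D′ → spanning B (D′⇒D θ∈D′)
      ; Q-det = Q⇒Q′ (Q-det B)
      }
    ... | no rζ≉0 = record
      { η = η B ; ζ = λ i → α * ζ B i
      ; η∈D = residue≈0⇒D′ (η∈D B) rη≈0
      ; ζ∈D = ⇒D′ (D-scale α (ζ∈D B)) (cofactor (ζ∈D B) , (begin
          cofactor (ζ∈D B) * (α * A)
            ≈⟨ solve 3 (λ q α A → q :* (α :* A) := α :* (q :* A) :+ con ℤ.0ℤ :* (q :* A)) refl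
                 (cofactor (ζ∈D B)) α A ⟩
          α * (cofactor (ζ∈D B) * A) + 0# * (cofactor (ζ∈D B) * A)
            ≈⟨ +-cong (*-congˡ (cofactor-≈ (ζ∈D B))) (*-congˡ (cofactor-≈ (ζ∈D B))) ⟩
          α * ℓ (ζ B) + 0# * ℓ (ζ B)
            ≈⟨ ℓ-add α 0# (ζ B) (ζ B) (λ i → α * ζ B i)
                 (λ i → solve 2 (λ α z → α :* z := α :* z :+ con ℤ.0ℤ :* z) refl α (ζ B i)) ⟨
          ℓ (λ i → α * ζ B i) ∎))
      ; spanning = λ {θ} θ∈D′ →
          let a , b , e = spanning B (D′⇒D θ∈D′)
              ρbrζ≈0 : ρ b F[z].* residueOf (ζ∈D B) F[z].≈ F[z].0#
              ρbrζ≈0 = F[z].trans (F[z].sym (F[z].trans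
                (ρ-add (cofactor-add (D′⇒D θ∈D′) (η∈D B) (ζ∈D B) a b e))
                (F[z].trans (F[z].+-congʳ (F[z].trans (F[z].*-congˡ {ρ a} rη≈0) (F[z].zeroʳ (ρ a))))
                  (F[z].+-identityˡ _))))
                (D′⇒residue≈0 θ∈D′ (D′⇒D θ∈D′))
              q , qα≈b = kernel (F[z]D.*-cancelˡ-0 rζ≉0 (F[z].trans (F[z].*-comm _ (ρ b)) ρbrζ≈0))
          in a , q , λ i → trans (e i) (+-congˡ (trans (*-congʳ (sym qα≈b)) (*-assoc q α (ζ B i))))
      ; Q-det = Q′-resp (sym (det-scaleʳ α (η B) (ζ B))) (Q⇒Q′-α (Q-det B))
      }

    -- The polynomial p has degree less than n.

    DegreeBelow : ℕ → F[z].Carrier → Set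
    DegreeBelow n p = ∀ i → n ℕ.≤ i → P.coeff p i F.≈ F.0#

    degreeBelow-length : ∀ p → DegreeBelow (length p) p
    degreeBelow-length []      i       _         = F.refl
    degreeBelow-length (a ∷ p) (suc i) (s≤s n≤i) = degreeBelow-length p i n≤i

    degreeBelow-drop : ∀ {n} p → P.coeff p n F.≈ F.0# → DegreeBelow (suc n) p → DegreeBelow n p
    degreeBelow-drop {n} p e below i n≤i with n ℕ.≟ i
    ... | yes ≡.refl = e
    ... | no  n≢i    = below i (ℕ.≤∧≢⇒< n≤i n≢i)

    -- A multiple of the residue of η cancels the leading coefficient of the
    -- residue of ζ.

    eliminate : (B : Basis D Q) → ∀ {m n} → m ℕ.≤ n →
                DegreeBelow (suc m) (residueOf (η∈D B)) → DegreeBelow (suc n) (residueOf (ζ∈D B)) →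
                ¬ P.coeff (residueOf (η∈D B)) m F.≈ F.0# →
                ∃[ u ] DegreeBelow n (residueOf (D-add u (ζ∈D B) (η∈D B)))
    eliminate B {m} {n} m≤n η-below ζ-below lead≉0 = u , below
      where
      open Monomials F
      r s : F[z].Carrier
      r = residueOf (η∈D B)
      s = residueOf (ζ∈D B)
      inv = proj₁ (F-inverse (P.coeff r m) lead≉0)
      c = F.- (P.coeff s n F.* inv)
      p = monomial c (n ℕ.∸ m)
      u = section p
      coeff-sum : ∀ i → P.coeff (residueOf (D-add u (ζ∈D B) (η∈D B))) i F.≈
                        P.coeff s i F.+ P.coeff (p F[z].* r) i
      coeff-sum i = F.trans (P.coeffs sum≈ i) (P.coeff-⊕ s (p F[z].* r) i)
        where
        sum≈ : residueOf (D-add u (ζ∈D B) (η∈D B)) F[z].≈ s F[z].+ p F[z].* r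
        sum≈ = F[z].trans
          (ρ-add (cofactor-add (D-add u (ζ∈D B) (η∈D B)) (ζ∈D B) (η∈D B) 1# u
            (λ i → +-congʳ (sym (*-identityˡ (ζ B i))))))
          (F[z].+-cong (F[z].trans (F[z].*-congʳ {s} 1-homo) (F[z].*-identityˡ s))
            (F[z].*-congʳ {r} (ρ-section p)))
      coeff-product : ∀ i → m ℕ.≤ i → P.coeff (p F[z].* r) (n ℕ.∸ m ℕ.+ i) F.≈ c F.* P.coeff r i
      coeff-product i _ = coeff-monomial-⊗ c (n ℕ.∸ m) r i
      below : DegreeBelow n (residueOf (D-add u (ζ∈D B) (η∈D B)))
      below i n≤i with n ℕ.≟ i
      ... | yes ≡.refl = F.trans (coeff-sum n) (F.trans (F.+-congˡ (F.trans
        (F.reflexive (≡.cong (P.coeff (p F[z].* r)) (≡.sym (ℕ.m∸n+n≡m m≤n))))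
        (F.trans (coeff-product m ℕ.≤-refl)
          (F.trans (F.sym (-‿distribˡ-* _ _)) (F.-‿cong (F.trans (F.*-assoc _ _ _)
            (F.trans (F.*-congˡ (proj₂ (F-inverse (P.coeff r m) lead≉0))) (F.*-identityʳ _))))))))
        (F.-‿inverseʳ _))
        where open RingProperties F.ring using (-‿distribˡ-*)
      ... | no n≢i = F.trans (coeff-sum i) (F.trans (F.+-cong (ζ-below i n<i) (F.trans
        (F.reflexive (≡.cong (P.coeff (p F[z].* r)) (≡.sym shift)))
        (F.trans (coeff-product (i ℕ.∸ (n ℕ.∸ m)) (ℕ.<⇒≤ m<))
          (F.trans (F.*-congˡ (η-below (i ℕ.∸ (n ℕ.∸ m)) m<)) (F.zeroʳ c)))))
        (F.+-identityˡ F.0#))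
        where
        n<i : n ℕ.< i
        n<i = ℕ.≤∧≢⇒< n≤i n≢i
        shift : n ℕ.∸ m ℕ.+ (i ℕ.∸ (n ℕ.∸ m)) ≡ i
        shift = ℕ.m+[n∸m]≡n (ℕ.≤-trans (ℕ.m∸n≤m n m) n≤i)
        m< : m ℕ.< i ℕ.∸ (n ℕ.∸ m)
        m< = ℕ.+-cancelˡ-< (n ℕ.∸ m) m _ (≡.subst₂ ℕ._<_ (≡.sym (ℕ.m∸n+n≡m m≤n)) (≡.sym shift) n<i)

    -- Euclid's algorithm on the residues of a basis of D, by induction on a
    -- bound s for the sum of the degree bounds m and n.

    private
      euclid : ∀ s m n → m ℕ.+ n ℕ.≤ s → (B : Basis D Q) →
               DegreeBelow m (residueOf (η∈D B)) → DegreeBelow n (residueOf (ζ∈D B)) → Basis D′ Q′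
      euclid s zero    n _ B η-below _ = finish B (P.mk≋ λ i → η-below i z≤n)
      euclid s (suc m) zero _ B _ ζ-below = finish (swap Q-resp Q-neg B) (P.mk≋ λ i → ζ-below i z≤n)
      euclid (suc s) (suc m) (suc n) (s≤s m+1+n≤s) B η-below ζ-below
        with FD.zero? (P.coeff (residueOf (η∈D B)) m) | FD.zero? (P.coeff (residueOf (ζ∈D B)) n)
      ... | yes lead≈0 | _ = euclid s m (suc n) m+1+n≤s B (degreeBelow-drop (residueOf (η∈D B)) lead≈0 η-below) ζ-below
      ... | no _ | yes lead≈0 = euclid s (suc m) n
        (ℕ.≤-trans (ℕ.≤-reflexive (≡.sym (ℕ.+-suc m n))) m+1+n≤s) B η-below
        (degreeBelow-drop (residueOf (ζ∈D B)) lead≈0 ζ-below)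
      ... | no leadη≉0 | no leadζ≉0 with ℕ.≤-total m n
      ...   | inj₁ m≤n = let u , below = eliminate B m≤n η-below ζ-below leadη≉0 in
        euclid s (suc m) n (ℕ.≤-trans (ℕ.≤-reflexive (≡.sym (ℕ.+-suc m n))) m+1+n≤s)
          (add Q-resp D-add B u) η-below below
      ...   | inj₂ n≤m = let u , below = eliminate (swap Q-resp Q-neg B) n≤m ζ-below η-below leadζ≉0 in
        euclid s (suc n) m (ℕ.≤-trans (ℕ.≤-reflexive (ℕ.+-comm (suc n) m)) m+1+n≤s)
          (add Q-resp D-add (swap Q-resp Q-neg B) u) ζ-below below

    raise : Basis D Q → Basis D′ Q′
    raise B = euclid _ _ _ ℕ.≤-refl B (degreeBelow-length (residueOf (η∈D B)))
      (degreeBelow-length (residueOf (ζ∈D B)))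

module _ {S : CommutativeRing 0ℓ 0ℓ} (S-isDomain : IsDomain S) where

  open CommutativeRing S hiding (zero)
  open RankTwo S
  open SemiringSum semiring using (sum)
  open IsDomain S-isDomain
  open IntegerSolver S

  -- Two pairs as a family.

  pairOf : Pair → Pair → Fin 2 → Pair
  pairOf η ζ zero       = η
  pairOf η ζ (suc zero) = ζ

  det≉0⇒independent : ∀ {η ζ} → ¬ det η ζ ≈ 0# → ∀ {n} (ι : Fin n → Fin 2) → Injective _≡_ _≡_ ι →
    (a : Fin n → Carrier) → (∀ i → sum (λ k → a k * pairOf η ζ (ι k) i) ≈ 0#) → ∀ k → a k ≈ 0#
  det≉0⇒independent {η} {ζ} det≉0 {suc zero} ι _ a e zero with ι zero | e
  ... | zero     | e = *-cancelˡ-0 det≉0 (trans (*-comm _ _) (det-cramerˡ {η} {ζ} {b = 0#}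
    λ i → trans (solve 3 (λ a u v → a :* u :+ con ℤ.0ℤ :* v := a :* u :+ con ℤ.0ℤ) refl
      (a zero) (η i) (ζ i)) (e i)))
  ... | suc zero | e = *-cancelˡ-0 det≉0 (trans (*-comm _ _) (det-cramerʳ {η} {ζ} {0#}
    λ i → trans (solve 3 (λ a u v → con ℤ.0ℤ :* u :+ a :* v := a :* v :+ con ℤ.0ℤ) refl
      (a zero) (η i) (ζ i)) (e i)))
  det≉0⇒independent {η} {ζ} det≉0 {suc (suc zero)} ι inj a e k
    with ι zero in ι₀ | ι (suc zero) in ι₁ | e
  ... | zero     | zero     | _ = contradiction (inj (≡.trans ι₀ (≡.sym ι₁))) λ ()
  ... | suc zero | suc zero | _ = contradiction (inj (≡.trans ι₀ (≡.sym ι₁))) λ ()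
  ... | zero     | suc zero | e = both k
    where
    e′ : ∀ i → a zero * η i + a (suc zero) * ζ i ≈ 0#
    e′ i = trans (+-congˡ (sym (+-identityʳ _))) (e i)
    both : ∀ k → a k ≈ 0#
    both zero       = *-cancelˡ-0 det≉0 (trans (*-comm _ _) (det-cramerˡ {η} {ζ} e′))
    both (suc zero) = *-cancelˡ-0 det≉0 (trans (*-comm _ _) (det-cramerʳ {η} {ζ} e′))
  ... | suc zero | zero     | e = both k
    where
    e′ : ∀ i → a (suc zero) * η i + a zero * ζ i ≈ 0#
    e′ i = trans (trans (+-comm _ _) (+-congˡ (sym (+-identityʳ _)))) (e i)
    both : ∀ k → a k ≈ 0#
    both zero       = *-cancelˡ-0 det≉0 (trans (*-comm _ _) (det-cramerʳ {η} {ζ} e′))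
    both (suc zero) = *-cancelˡ-0 det≉0 (trans (*-comm _ _) (det-cramerˡ {η} {ζ} e′))
  det≉0⇒independent _ {suc (suc (suc n))} ι inj = contradiction (Fin.injective⇒≤ {f = ι} inj) λ { (s≤s (s≤s ())) }

  -- The standard basis of S².

  e₁ e₂ : Pair
  e₁ zero       = 1#
  e₁ (suc zero) = 0#
  e₂ zero       = 0#
  e₂ (suc zero) = 1#

  det-e₁-e₂ : det e₁ e₂ ≈ 1#
  det-e₁-e₂ = solve 0 (con ℤ.1ℤ :* con ℤ.1ℤ :- con ℤ.0ℤ :* con ℤ.0ℤ := con ℤ.1ℤ) refl

  standardBasis : ∀ {D : Pred Pair 0ℓ} {Q : Pred Carrier 0ℓ} → (∀ θ → D θ) → Q (det e₁ e₂) → Basis D Q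
  standardBasis all Q-det = record
    { η = e₁ ; ζ = e₂ ; η∈D = all e₁ ; ζ∈D = all e₂
    ; spanning = λ {θ} _ → θ zero , θ (suc zero) , λ
        { zero → solve 2 (λ a b → a := a :* con ℤ.1ℤ :+ b :* con ℤ.0ℤ) refl _ _
        ; (suc zero) → solve 2 (λ a b → b := a :* con ℤ.0ℤ :+ b :* con ℤ.1ℤ) refl _ _ }
    ; Q-det = Q-det
    }

-- Restriction of polynomials to a line

module PlaneResidues {K : CommutativeRing 0ℓ 0ℓ} (K-isDomain : IsDomain K) (K-charZero : CharZero K) where

  open Plane K-isDomain K-charZero
  open Multivariate K using (constant; var)
  open SemiringDivisibility S.semiring using (_∣_; _∣ʳ_; _,_)

  -- The polynomial c x + d y.

  linear : K.Carrier → K.Carrier → S.Carrier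
  linear c d = (K.0# ∷ d ∷ []) ∷ (c ∷ []) ∷ []

  coeff₂-linear : ∀ c d i j → coeff₂ (constant 2 c S.* x S.+ (constant 2 d S.* y S.+ S.0#)) i j K.≈
                              coeff₂ (linear c d) i j
  coeff₂-linear c d i j = K.trans (coeff₂-+ (constant 2 c S.* x) (constant 2 d S.* y S.+ S.0#) i j)
    (K.trans (K.+-cong (coeff₂-constant c x i j)
      (K.trans (coeff₂-+ (constant 2 d S.* y) S.0# i j)
        (K.trans (K.+-identityʳ _) (coeff₂-constant d y i j))))
    (cases i j))
    where
    open IntegerSolver K
    cases : ∀ i j → c K.* coeff₂ x i j K.+ d K.* coeff₂ y i j K.≈ coeff₂ (linear c d) i j
    cases 0 0 = solve 2 (λ c d → c :* con ℤ.0ℤ :+ d :* con ℤ.0ℤ := con ℤ.0ℤ) K.refl c d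
    cases 0 1 = solve 2 (λ c d → c :* con ℤ.0ℤ :+ d :* con ℤ.1ℤ := d) K.refl c d
    cases 0 (suc (suc j)) = solve 2 (λ c d → c :* con ℤ.0ℤ :+ d :* con ℤ.0ℤ := con ℤ.0ℤ) K.refl c d
    cases 1 0 = solve 2 (λ c d → c :* con ℤ.1ℤ :+ d :* con ℤ.0ℤ := c) K.refl c d
    cases 1 (suc j) = solve 2 (λ c d → c :* con ℤ.0ℤ :+ d :* con ℤ.0ℤ := con ℤ.0ℤ) K.refl c d
    cases (suc (suc i)) j = solve 2 (λ c d → c :* con ℤ.0ℤ :+ d :* con ℤ.0ℤ := con ℤ.0ℤ) K.refl c d

  linear≈x-λy : ∀ a → linear K.1# (K.- a) S.≈ TP.X S.+ (S.- TP.C (K.0# ∷ a ∷ []))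
  linear≈x-λy a = T.∷-cong (U.∷-cong (K.sym ε⁻¹≈ε) U.≋-refl) T.≋-refl
    where open import Algebra.Properties.Group K.+-group using (ε⁻¹≈ε)

  linear≈y : linear K.0# K.1# S.≈ TP.C UP.X
  linear≈y = T.∷-cong U.≋-refl (T.≋-trans (T.∷-cong (U.∷-zero U.≋-refl) T.≋-refl) (T.∷-zero T.≋-refl))

  -- Substitution of a y for x.

  residue-x-λy : ∀ a {α} → α S.≈ TP.X S.+ (S.- TP.C (K.0# ∷ a ∷ [])) → Residue K (K [X 2 ]) α
  residue-x-λy a {α} α≈ = record
    { ρ = TP.eval r
    ; isHomomorphism = TP.eval-isHomomorphism r
    ; section = TP.C
    ; ρ-section = λ p → K[y].trans (K[y].+-congˡ {p} (K[y].zeroʳ r)) (K[y].+-identityʳ p)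
    ; ρ-α = K[y].trans (TP.eval-cong r α≈) (TP.eval-x-r r)
    ; kernel = λ {f} e → TP.quotient r f , S.sym (S.trans (TP.eval≈0⇒factor r f e)
        (S.trans (S.*-comm (TP.X S.+ (S.- TP.C r)) (TP.quotient r f))
          (S.*-congˡ {TP.quotient r f} (S.sym α≈))))
    }
    where r = K.0# ∷ a ∷ []

  -- Substitution of 0 for y.

  residue-y : ∀ {α} → α S.≈ TP.C UP.X → Residue K (K [X 2 ]) α
  residue-y {α} α≈ = record
    { ρ = map ε
    ; isHomomorphism = map-isHomomorphism ε-hom
    ; section = map UP.C
    ; ρ-section = λ p → U.mk≋ λ n → ρ-section p n
    ; ρ-α = U.≋-trans (IsHomomorphism.cong (map-isHomomorphism ε-hom) α≈)
        (U.≋-trans (U.∷-cong (K.trans (K.+-identityˡ _) (K.zeroˡ _)) U.≋-refl) (U.∷-zero U.≋-refl))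
    ; kernel = λ {f} e → map (UP.quotient K.0#) f ,
        S.trans (S.*-congˡ {map (UP.quotient K.0#) f} α≈)
        (S.trans (S.*-comm (map (UP.quotient K.0#) f) (TP.C UP.X))
        (T.mk≋ λ n → K[y].trans (TP.coeff-C-⊗ UP.X (map (UP.quotient K.0#) f) n)
          (K[y].trans (K[y].*-congˡ {UP.X} (K[y].reflexive (coeff-map-quotient f n)))
            (K[y].sym (K[y].trans
              (UP.eval≈0⇒factor K.0# (T.coeff f n)
                (K.trans (K.sym (coeff-map-φ ε-hom f n)) (U.coeffs e n)))
              (K[y].*-congʳ {UP.quotient K.0# (T.coeff f n)} X-0≈X))))))
    }
    where
    ε : K[y].Carrier → K.Carrier
    ε = UP.eval K.0#
    ε-hom : IsHomomorphism (K [X 1 ]) K ε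
    ε-hom = UP.eval-isHomomorphism K.0#
    ρ-section : ∀ p n → U.coeff (map ε (map UP.C p)) n K.≈ U.coeff p n
    ρ-section []      n       = K.refl
    ρ-section (a ∷ p) zero    = K.trans (K.+-congˡ (K.zeroʳ K.0#)) (K.+-identityʳ a)
    ρ-section (a ∷ p) (suc n) = ρ-section p n
    coeff-map-quotient : ∀ f n → T.coeff (map (UP.quotient K.0#) f) n ≡ UP.quotient K.0# (T.coeff f n)
    coeff-map-quotient []      n       = ≡.refl
    coeff-map-quotient (a ∷ f) zero    = ≡.refl
    coeff-map-quotient (a ∷ f) (suc n) = coeff-map-quotient f n
    X-0≈X : UP.X U.⊕ (U.⊖ UP.C K.0#) U.≋ UP.X
    X-0≈X = U.∷-cong (K.-‿inverseʳ K.0#) U.≋-refl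

-- Moments and determinants over a commutative ring

module _ (R : CommutativeRing 0ℓ 0ℓ) where

  open CommutativeRing R hiding (zero)
  open IntegerSolver R
  open Polynomials R

  -- The moments of order less than c of the first K terms of u vanish.

  Moments : (K c : ℕ) → (ℕ → Carrier) → Set
  Moments K c u = ∀ ns → length ns ℕ.< c → Sums.∑ R K (λ n → Integers.fromℤ R (weight ns n) * u n) ≈ 0#

  -- Two sequences of K elements that are linked by powers of t, as the
  -- coefficients of θ(x - y) and of θ(x - t y) are, vanish.

  LinkedVanishing : Carrier → Set
  LinkedVanishing t = ∀ K a b c d {P R} → Moments K b R → Moments K c P →
    (∀ n → n ℕ.< K → n ℕ.< a → R n ≈ t ^ suc n * P n) →
    (∀ n → n ℕ.< K → K ℕ.≤ n ℕ.+ d → R n ≈ t ^ n * P n) →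
    a ℕ.≤ K → b ℕ.≤ K → c ℕ.≤ K → d ℕ.≤ K → K ℕ.+ K ℕ.≤ a ℕ.+ b ℕ.+ c ℕ.+ d →
    a ≢ 0 → d ≢ 0 → ¬ (a ≡ 1 × b ≡ 1 × c ≡ 1 × d ≡ 1) →
    ∀ n → n ℕ.< K → P n ≈ 0# × R n ≈ 0#
    where open SemiringExp semiring using (_^_)

  -- The derivation (b , - a) annihilates a function with gradient (p a , p b).

  jacobian-lemma : ∀ p a b → b * (p * a) + ((- a) * (p * b) + 0#) ≈ 0#
  jacobian-lemma = solve 3 (λ p a b → b :* (p :* a) :+ ((:- a) :* (p :* b) :+ con ℤ.0ℤ) := con ℤ.0ℤ) refl

  e₁-lemma : ∀ a b → 1# * a + (0# * b + 0#) ≈ a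
  e₁-lemma = solve 2 (λ a b → con ℤ.1ℤ :* a :+ (con ℤ.0ℤ :* b :+ con ℤ.0ℤ) := a) refl

  form-lemma : ∀ c d f g → f * c + (g * d + 0#) ≈ c * f + d * g
  form-lemma = solve 4 (λ c d f g → f :* c :+ (g :* d :+ con ℤ.0ℤ) := c :* f :+ d :* g) refl

  -- The chain rule for determinants.

  det-lemma : ∀ p q r s fx fy gx gy →
    (p * fx + (q * fy + 0#)) * (r * gx + (s * gy + 0#)) - (p * gx + (q * gy + 0#)) * (r * fx + (s * fy + 0#)) ≈
    (p * s - q * r) * (fx * gy - gx * fy)
  det-lemma = solve 8 (λ p q r s fx fy gx gy →
    (p :* fx :+ (q :* fy :+ con ℤ.0ℤ)) :* (r :* gx :+ (s :* gy :+ con ℤ.0ℤ))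
      :- (p :* gx :+ (q :* gy :+ con ℤ.0ℤ)) :* (r :* fx :+ (s :* fy :+ con ℤ.0ℤ))
    := (p :* s :- q :* r) :* (fx :* gy :- gx :* fy)) refl

  eval1-single : ∀ j p → (∀ i → i ≢ j → Univariate.coeff R p i ≈ 0#) → eval 1# p ≈ Univariate.coeff R p j
  eval1-single j       []      _   = refl
  eval1-single zero    (a ∷ p) p≈0 = trans (+-congˡ (trans (*-identityˡ _)
    (eval-zero 1# p (Univariate.mk≋ λ n → p≈0 (suc n) λ ())))) (+-identityʳ a)
  eval1-single (suc j) (a ∷ p) p≈0 = trans (+-cong (p≈0 0 λ ()) (trans (*-identityˡ _)
    (eval1-single j p λ i i≢j → p≈0 (suc i) (i≢j ∘ ℕ.suc-injective)))) (+-identityˡ _)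

-- The isomorphism of a universal derivation, in terms of derivations.

module Universal (K : HeytingField 0ℓ 0ℓ 0ℓ) (l : ℕ) where

  open Arrangements K l

  module _ (A : Arrangement) {m : Arrangement.Multiplicity A} {θ : Derivation}
           {θ∈D : InD A (Arrangement._+𝟏 A m) θ} (universal : IsUniversal A m (θ , θ∈D)) where

    private
      module Iso = LeftModuleMorphisms.IsLeftModuleIsomorphism (IsUniversal.isIsomorphism universal)

    ∇-injective : ∀ φ ψ → ∇ φ θ ≈ᴰ ∇ ψ θ → φ ≈ᴰ ψ
    ∇-injective φ ψ = Iso.injective {φ} {ψ}

    ∇-surjective : ∀ η → InD A m η → ∃[ φ ] ∇ φ θ ≈ᴰ η
    ∇-surjective η η∈D = let φ , e = Iso.surjective (η , η∈D) in
      φ , e {φ} (LeftModule.≈ᴹ-refl Der {φ})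

-- The arrangement of four lines

module FourLines
  (K : HeytingField 0ℓ 0ℓ 0ℓ) (K-isDomain : IsDomain (fieldRing K))
  (K-charZero : CharZero (fieldRing K)) (K-inverse : HasInverses (fieldRing K))
  (t : HeytingField.Carrier K)
  (t≉0 : ¬ HeytingField._≈_ K t (HeytingField.0# K))
  (t≉1 : ¬ HeytingField._≈_ K t (HeytingField.1# K))
  where

  private module K = CommutativeRing (fieldRing K)

  open Arrangements K 2
  open Plane {fieldRing K} K-isDomain K-charZero hiding (module K)
  open PlaneResidues {fieldRing K} K-isDomain K-charZero
  open RankTwo (fieldRing K [X 2 ])
  open SemiringDivisibility S.semiring using (_∣_; _,_; x∣ʳy⇒x∣ʳzy)
  open SemiringExp S.semiring using (_^_)
  open SemiringExp K.semiring using () renaming (_^_ to _^ᴷ_)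
  open IsDomain K-isDomain using (1≉0; *-cancelˡ-0; *-nonzero)
  open Multivariate (fieldRing K) using (constant; ∂)
  open Integers (fieldRing K) using (fromℤ; fromℤ-+; fromℤ-*)
  open GroupProperties K.+-group using (x∙y⁻¹≈ε⇒x≈y) renaming (ε⁻¹≈ε to -0≈0)
  open IntegerSolver (fieldRing K)
  open CommutativeSemigroupProperties S.*-commutativeSemigroup using (x∙yz≈y∙xz)
  private module Dom = IsDomain S-isDomain

  vector : K.Carrier → K.Carrier → Fin 2 → K.Carrier
  vector a b zero       = a
  vector a b (suc zero) = b

  -- The lines x = 0, y = 0, x = y and x = t y.

  lines : Fin 4 → LinearForm
  lines 0F = vector K.1# K.0#
  lines 1F = vector K.0# K.1#
  lines 2F = vector K.1# (K.- K.1#)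
  lines 3F = vector K.1# (K.- t)

  private
    -- A vector on each line.

    point : Fin 4 → V
    point 0F = vector K.0# K.1#
    point 1F = vector K.1# K.0#
    point 2F = vector K.1# K.1#
    point 3F = vector t K.1#

    point∈line : ∀ H → ker (lines H) (point H)
    point∈line 0F = solve 0 (con ℤ.1ℤ :* con ℤ.0ℤ :+ (con ℤ.0ℤ :* con ℤ.1ℤ :+ con ℤ.0ℤ) := con ℤ.0ℤ) K.refl
    point∈line 1F = solve 0 (con ℤ.0ℤ :* con ℤ.1ℤ :+ (con ℤ.1ℤ :* con ℤ.0ℤ :+ con ℤ.0ℤ) := con ℤ.0ℤ) K.refl
    point∈line 2F = solve 0 (con ℤ.1ℤ :* con ℤ.1ℤ :+ ((:- con ℤ.1ℤ) :* con ℤ.1ℤ :+ con ℤ.0ℤ) := con ℤ.0ℤ) K.refl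
    point∈line 3F = solve 1 (λ t → con ℤ.1ℤ :* t :+ ((:- t) :* con ℤ.1ℤ :+ con ℤ.0ℤ) := con ℤ.0ℤ) K.refl t

    1-t≉0 : ¬ K.1# K.- t K.≈ K.0#
    1-t≉0 e = t≉1 (K.sym (x∙y⁻¹≈ε⇒x≈y K.1# t e))

    value-≉0 : ∀ {u v} → ¬ u K.≈ K.0# → u K.≈ v → ¬ v K.≈ K.0#
    value-≉0 u≉0 u≈v v≈0 = u≉0 (K.trans u≈v v≈0)

    neg-≉0 : ∀ {u v} → ¬ u K.≈ K.0# → u K.≈ K.- v → ¬ v K.≈ K.0#
    neg-≉0 u≉0 u≈-v v≈0 = u≉0 (K.trans u≈-v (K.trans (K.-‿cong v≈0) -0≈0))

    point∉line : ∀ H H′ → H ≢ H′ → ¬ ker (lines H′) (point H)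
    point∉line 0F 0F H≢H = contradiction ≡.refl H≢H
    point∉line 1F 1F H≢H = contradiction ≡.refl H≢H
    point∉line 2F 2F H≢H = contradiction ≡.refl H≢H
    point∉line 3F 3F H≢H = contradiction ≡.refl H≢H
    point∉line 0F 1F _ = value-≉0 1≉0
      (solve 0 (con ℤ.1ℤ := con ℤ.0ℤ :* con ℤ.0ℤ :+ (con ℤ.1ℤ :* con ℤ.1ℤ :+ con ℤ.0ℤ)) K.refl)
    point∉line 0F 2F _ = neg-≉0 1≉0
      (solve 0 (con ℤ.1ℤ := :- (con ℤ.1ℤ :* con ℤ.0ℤ :+ ((:- con ℤ.1ℤ) :* con ℤ.1ℤ :+ con ℤ.0ℤ))) K.refl)
    point∉line 0F 3F _ = neg-≉0 t≉0
      (solve 1 (λ t → t := :- (con ℤ.1ℤ :* con ℤ.0ℤ :+ ((:- t) :* con ℤ.1ℤ :+ con ℤ.0ℤ))) K.refl t)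
    point∉line 1F 0F _ = value-≉0 1≉0
      (solve 0 (con ℤ.1ℤ := con ℤ.1ℤ :* con ℤ.1ℤ :+ (con ℤ.0ℤ :* con ℤ.0ℤ :+ con ℤ.0ℤ)) K.refl)
    point∉line 1F 2F _ = value-≉0 1≉0
      (solve 0 (con ℤ.1ℤ := con ℤ.1ℤ :* con ℤ.1ℤ :+ ((:- con ℤ.1ℤ) :* con ℤ.0ℤ :+ con ℤ.0ℤ)) K.refl)
    point∉line 1F 3F _ = value-≉0 1≉0
      (solve 1 (λ t → con ℤ.1ℤ := con ℤ.1ℤ :* con ℤ.1ℤ :+ ((:- t) :* con ℤ.0ℤ :+ con ℤ.0ℤ)) K.refl t)
    point∉line 2F 0F _ = value-≉0 1≉0
      (solve 0 (con ℤ.1ℤ := con ℤ.1ℤ :* con ℤ.1ℤ :+ (con ℤ.0ℤ :* con ℤ.1ℤ :+ con ℤ.0ℤ)) K.refl)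
    point∉line 2F 1F _ = value-≉0 1≉0
      (solve 0 (con ℤ.1ℤ := con ℤ.0ℤ :* con ℤ.1ℤ :+ (con ℤ.1ℤ :* con ℤ.1ℤ :+ con ℤ.0ℤ)) K.refl)
    point∉line 2F 3F _ = value-≉0 1-t≉0
      (solve 1 (λ t → con ℤ.1ℤ :- t := con ℤ.1ℤ :* con ℤ.1ℤ :+ ((:- t) :* con ℤ.1ℤ :+ con ℤ.0ℤ)) K.refl t)
    point∉line 3F 0F _ = value-≉0 t≉0
      (solve 1 (λ t → t := con ℤ.1ℤ :* t :+ (con ℤ.0ℤ :* con ℤ.1ℤ :+ con ℤ.0ℤ)) K.refl t)
    point∉line 3F 1F _ = value-≉0 1≉0
      (solve 1 (λ t → con ℤ.1ℤ := con ℤ.0ℤ :* t :+ (con ℤ.1ℤ :* con ℤ.1ℤ :+ con ℤ.0ℤ)) K.refl t)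
    point∉line 3F 2F _ = neg-≉0 1-t≉0
      (solve 1 (λ t → con ℤ.1ℤ :- t := :- (con ℤ.1ℤ :* t :+ ((:- con ℤ.1ℤ) :* con ℤ.1ℤ :+ con ℤ.0ℤ))) K.refl t)

  A : Arrangement
  A = record
    { size = 4
    ; α = lines
    ; nonzero = λ
        { 0F e → 1≉0 (e 0F) ; 1F e → 1≉0 (e 1F) ; 2F e → 1≉0 (e 0F) ; 3F e → 1≉0 (e 0F) }
    ; distinct = λ {H} {H′} (⊆ , _) → distinct H H′ (λ {v} → ⊆ {v})
    ; essential = λ v e → λ
        { 0F → K.trans (solve 2 (λ a b → a := con ℤ.1ℤ :* a :+ (con ℤ.0ℤ :* b :+ con ℤ.0ℤ)) K.refl
            (v 0F) (v 1F)) (e 0F)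
        ; 1F → K.trans (solve 2 (λ a b → b := con ℤ.0ℤ :* a :+ (con ℤ.1ℤ :* b :+ con ℤ.0ℤ)) K.refl
            (v 0F) (v 1F)) (e 1F) }
    }
    where
    distinct : ∀ H H′ → (∀ {v} → ker (lines H) v → ker (lines H′) v) → H ≡ H′
    distinct H H′ ⊆ with H Fin.≟ H′
    ... | yes H≡H′ = H≡H′
    ... | no  H≢H′ = contradiction (⊆ {point H} (point∈line H)) (point∉line H H′ H≢H′)

  open Arrangement A using (Multiplicity; _+𝟏)

  -- The equation of a line, as an element of K[x,y].

  line : Fin 4 → S.Carrier
  line H = form (lines H)

  line≈linear : ∀ H → line H S.≈ linear (lines H 0F) (lines H 1F)
  line≈linear H = coeff₂-ext (coeff₂-linear (lines H 0F) (lines H 1F))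

  line≉0 : ∀ H → ¬ line H S.≈ S.0#
  line≉0 H e = Arrangement.nonzero A H λ
    { 0F → coeff₂-cong (S.trans (S.sym (line≈linear H)) e) 1 0
    ; 1F → coeff₂-cong (S.trans (S.sym (line≈linear H)) e) 0 1 }

  line-homogeneous : ∀ H → Homogeneous 1 (line H)
  line-homogeneous H = homogeneous-cong {1} (S.sym (line≈linear H)) linear-homogeneous
    where
    linear-homogeneous : Homogeneous 1 (linear (lines H 0F) (lines H 1F))
    linear-homogeneous 0 0             _  = K.refl
    linear-homogeneous 0 1             ≢1 = contradiction ≡.refl ≢1
    linear-homogeneous 0 (suc (suc j)) _  = K.refl
    linear-homogeneous 1 0             ≢1 = contradiction ≡.refl ≢1
    linear-homogeneous 1 (suc j)       _  = K.refl
    linear-homogeneous (suc (suc i)) j _  = K.refl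

  residue : ∀ H → Residue (fieldRing K) (fieldRing K [X 2 ]) (line H)
  residue 0F = residue-x-λy K.0# (S.trans (line≈linear 0F) (S.trans
    (coeff₂-ext λ { 0 0 → K.refl ; 0 1 → K.sym -0≈0 ; 0 (suc (suc j)) → K.refl ; (suc i) j → K.refl })
    (linear≈x-λy K.0#)))
  residue 1F = residue-y (S.trans (line≈linear 1F) linear≈y)
  residue 2F = residue-x-λy K.1# (S.trans (line≈linear 2F) (linear≈x-λy K.1#))
  residue 3F = residue-x-λy t (S.trans (line≈linear 3F) (linear≈x-λy t))

  -- Total freeness

  -- A nonzero homogeneous polynomial of degree at most s.

  DegreeAtMost : ℕ → Pred S.Carrier 0ℓ
  DegreeAtMost s d = ¬ d S.≈ S.0# × ∃[ N ] N ℕ.≤ s × Homogeneous N d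

  degree-cong : ∀ {s d d′} → d S.≈ d′ → DegreeAtMost s d → DegreeAtMost s d′
  degree-cong d≈d′ (d≉0 , N , N≤s , hom) =
    (λ d′≈0 → d≉0 (S.trans d≈d′ d′≈0)) , N , N≤s , homogeneous-cong {N} d≈d′ hom

  degree-neg : ∀ {s d} → DegreeAtMost s d → DegreeAtMost s (S.- d)
  degree-neg {s} {d} (d≉0 , N , N≤s , hom) =
    (λ -d≈0 → d≉0 (S.trans (S.sym (⁻¹-involutive d)) (S.trans (S.-‿cong -d≈0) ε⁻¹≈ε))) ,
    N , N≤s , homogeneous-neg {N} {d} hom
    where open GroupProperties S.+-group using (⁻¹-involutive; ε⁻¹≈ε)

  degree-suc : ∀ {s d} → DegreeAtMost s d → DegreeAtMost (suc s) d
  degree-suc (d≉0 , N , N≤s , hom) = d≉0 , N , ℕ.m≤n⇒m≤1+n N≤s , hom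

  degree-line : ∀ H {s d} → DegreeAtMost s d → DegreeAtMost (suc s) (line H S.* d)
  degree-line H {s} {d} (d≉0 , N , N≤s , hom) =
    Dom.*-nonzero {line H} {d} (line≉0 H) d≉0 , suc N , s≤s N≤s ,
    homogeneous-* {1} {N} {line H} {d} (line-homogeneous H) hom

  ^≉0 : ∀ H n → ¬ line H ^ n S.≈ S.0#
  ^≉0 H zero    = Dom.1≉0
  ^≉0 H (suc n) = Dom.*-nonzero {line H} {line H ^ n} (line≉0 H) (^≉0 H n)

  ⟪⟫-add : ∀ f a b (η ζ θ : Derivation) → (∀ i → θ i S.≈ a S.* η i S.+ b S.* ζ i) →
           θ ⟪ f ⟫ S.≈ a S.* η ⟪ f ⟫ S.+ b S.* ζ ⟪ f ⟫
  ⟪⟫-add f a b η ζ θ e = S.trans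
    (sum-cong-≋ {2} λ i → S.*-congʳ {∂′ i f} (e i))
    (S.trans (⟪⟫-+ (λ i → a S.* η i) (λ i → b S.* ζ i) f)
      (S.+-cong (⟪⟫-* a η f) (⟪⟫-* b ζ f)))
    where
    open SemiringSum S.semiring using (sum-cong-≋)
    ∂′ = Multivariate.∂ (fieldRing K) {2}

  private
    module IsSub (m : Multiplicity) = IsSubmodule (InD-isSubmodule A m)

  -- Increasing the multiplicity of the line H by one.

  raise-line : ∀ H m m′ → m′ H ≡ suc (m H) → (∀ H′ → H′ ≢ H → m′ H′ ≡ m H′) → ∀ {s} →
               Basis (InD A m) (DegreeAtMost s) → Basis (InD A m′) (DegreeAtMost (suc s))
  raise-line H m m′ m′H≡ m′H′≡ {s} = Raising.raise
    {fieldRing K} {fieldRing K [X 2 ]} K-isDomain S-isDomain K-inverse {line H} (line≉0 H) (residue H)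
    {λ θ → θ ⟪ line H ⟫} (⟪⟫-add (line H)) {line H ^ m H} (^≉0 H (m H))
    {InD A m} {InD A m′} {DegreeAtMost s} {DegreeAtMost (suc s)}
    (λ {θ} {φ} u θ∈D φ∈D → IsSub.+-closed m {θ} {λ i → u S.* φ i} θ∈D (IsSub.*-closed m u {φ} φ∈D))
    (λ {θ} u θ∈D → IsSub.*-closed m u {θ} θ∈D)
    (λ θ∈D → θ∈D H)
    (λ {θ} θ∈D′ H′ → forget {θ} θ∈D′ H′ (H′ Fin.≟ H))
    (λ {θ} θ∈D′ → ≡.subst (λ n → line H ^ n ∣ θ ⟪ line H ⟫) m′H≡ (θ∈D′ H))
    (λ {θ} θ∈D div H′ → remember {θ} θ∈D div H′ (H′ Fin.≟ H))
    degree-cong degree-neg degree-suc (degree-line H) degree-cong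
    where
    forget : ∀ {θ} → InD A m′ θ → ∀ H′ → Dec (H′ ≡ H) → line H′ ^ m H′ ∣ θ ⟪ line H′ ⟫
    forget {θ} θ∈D′ H′ (no H′≢H) = ≡.subst (λ n → line H′ ^ n ∣ θ ⟪ line H′ ⟫) (m′H′≡ H′ H′≢H) (θ∈D′ H′)
    forget {θ} θ∈D′ H′ (yes ≡.refl) =
      let q , e = ≡.subst (λ n → line H ^ n ∣ θ ⟪ line H ⟫) m′H≡ (θ∈D′ H) in
      q S.* line H , S.trans (S.*-assoc q (line H) (line H ^ m H)) e
    remember : ∀ {θ} → InD A m θ → line H ^ suc (m H) ∣ θ ⟪ line H ⟫ →
               ∀ H′ → Dec (H′ ≡ H) → line H′ ^ m′ H′ ∣ θ ⟪ line H′ ⟫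
    remember {θ} θ∈D div H′ (no H′≢H) =
      ≡.subst (λ n → line H′ ^ n ∣ θ ⟪ line H′ ⟫) (≡.sym (m′H′≡ H′ H′≢H)) (θ∈D H′)
    remember {θ} θ∈D div H′ (yes ≡.refl) =
      ≡.subst (λ n → line H ^ n ∣ θ ⟪ line H ⟫) (≡.sym m′H≡) div

  -- Multiplicities with given values; the recursion for the bases is on these.

  multiplicity : ℕ → ℕ → ℕ → ℕ → Multiplicity
  multiplicity a b c d 0F = a
  multiplicity a b c d 1F = b
  multiplicity a b c d 2F = c
  multiplicity a b c d 3F = d

  basis : ∀ a b c d → Basis (InD A (multiplicity a b c d)) (DegreeAtMost (a ℕ.+ b ℕ.+ c ℕ.+ d))
  basis (suc a) b c d = raise-line 0F (multiplicity a b c d) (multiplicity (suc a) b c d) ≡.refl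
    (λ { 0F 0≢0 → contradiction ≡.refl 0≢0 ; 1F _ → ≡.refl ; 2F _ → ≡.refl ; 3F _ → ≡.refl })
    (basis a b c d)
  basis zero (suc b) c d = raise-line 1F (multiplicity 0 b c d) (multiplicity 0 (suc b) c d) ≡.refl
    (λ { 0F _ → ≡.refl ; 1F 1≢1 → contradiction ≡.refl 1≢1 ; 2F _ → ≡.refl ; 3F _ → ≡.refl })
    (basis zero b c d)
  basis zero zero (suc c) d = raise-line 2F (multiplicity 0 0 c d) (multiplicity 0 0 (suc c) d) ≡.refl
    (λ { 0F _ → ≡.refl ; 1F _ → ≡.refl ; 2F 2≢2 → contradiction ≡.refl 2≢2 ; 3F _ → ≡.refl })
    (basis zero zero c d)
  basis zero zero zero (suc d) = raise-line 3F (multiplicity 0 0 0 d) (multiplicity 0 0 0 (suc d)) ≡.refl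
    (λ { 0F _ → ≡.refl ; 1F _ → ≡.refl ; 2F _ → ≡.refl ; 3F 3≢3 → contradiction ≡.refl 3≢3 })
    (basis zero zero zero d)
  basis zero zero zero zero = standardBasis {fieldRing K [X 2 ]} S-isDomain all
    (degree-cong {0} (S.sym (det-e₁-e₂ {fieldRing K [X 2 ]} S-isDomain)) (Dom.1≉0 , 0 , z≤n , 1-homogeneous))
    where
    all : ∀ θ → InD A (multiplicity 0 0 0 0) θ
    all θ 0F = θ ⟪ line 0F ⟫ , S.*-identityʳ (θ ⟪ line 0F ⟫)
    all θ 1F = θ ⟪ line 1F ⟫ , S.*-identityʳ (θ ⟪ line 1F ⟫)
    all θ 2F = θ ⟪ line 2F ⟫ , S.*-identityʳ (θ ⟪ line 2F ⟫)
    all θ 3F = θ ⟪ line 3F ⟫ , S.*-identityʳ (θ ⟪ line 3F ⟫)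
    1-homogeneous : Homogeneous 0 S.1#
    1-homogeneous 0       0       0≢0 = contradiction ≡.refl 0≢0
    1-homogeneous 0       (suc j) _   = K.refl
    1-homogeneous (suc i) j       _   = K.refl

  -- The sum of the values.

  ∣_∣ : Multiplicity → ℕ
  ∣ m ∣ = m 0F ℕ.+ m 1F ℕ.+ m 2F ℕ.+ m 3F

  D-basis : ∀ m → Basis (InD A m) (DegreeAtMost ∣ m ∣)
  D-basis m = record
    { η = η ; ζ = ζ ; η∈D = to {η} η∈D ; ζ∈D = to {ζ} ζ∈D
    ; spanning = λ {θ} θ∈D → spanning {θ} (from {θ} θ∈D)
    ; Q-det = Q-det
    }
    where
    open Basis (basis (m 0F) (m 1F) (m 2F) (m 3F))
    m′ = multiplicity (m 0F) (m 1F) (m 2F) (m 3F)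
    to : ∀ {θ} → InD A m′ θ → InD A m θ
    to θ∈D 0F = θ∈D 0F
    to θ∈D 1F = θ∈D 1F
    to θ∈D 2F = θ∈D 2F
    to θ∈D 3F = θ∈D 3F
    from : ∀ {θ} → InD A m θ → InD A m′ θ
    from θ∈D 0F = θ∈D 0F
    from θ∈D 1F = θ∈D 1F
    from θ∈D 2F = θ∈D 2F
    from θ∈D 3F = θ∈D 3F

  totallyFree : TotallyFree A
  totallyFree m = Fin 2 , e , record
    { independent = λ ι ι-injective a sum≈0 → det≉0⇒independent {fieldRing K [X 2 ]} S-isDomain {η} {ζ} (proj₁ Q-det)
        ι ι-injective a (λ i → S.trans (S.reflexive (≡.sym (component a ι i))) (sum≈0 i))
    ; spanning = λ (θ , θ∈D) → let a , b , θ≈ = spanning {θ} θ∈D in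
        2 , id , pair a b , λ i → S.trans (θ≈ i) (S.+-congˡ {a S.* η i} (S.sym (S.+-identityʳ (b S.* ζ i))))
    }
    where
    open Basis (D-basis m)
    e : Fin 2 → LeftModule.Carrierᴹ (D A m)
    e zero       = η , η∈D
    e (suc zero) = ζ , ζ∈D
    pair : S.Carrier → S.Carrier → Fin 2 → S.Carrier
    pair a b zero       = a
    pair a b (suc zero) = b
    open LeftModule (D A m) using (+ᴹ-rawMonoid; _*ₗ_)
    open import Algebra.Definitions.RawMonoid +ᴹ-rawMonoid using () renaming (sum to sumᴹ)
    open SemiringSum S.semiring using (sum)
    e≡pair : ∀ k i → proj₁ (e k) i ≡ pairOf {fieldRing K [X 2 ]} S-isDomain η ζ k i
    e≡pair zero       i = ≡.refl
    e≡pair (suc zero) i = ≡.refl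
    component : ∀ {n} (a : Fin n → S.Carrier) (ι : Fin n → Fin 2) i →
                proj₁ (sumᴹ (λ k → a k *ₗ e (ι k))) i ≡
                sum (λ k → a k S.* pairOf {fieldRing K [X 2 ]} S-isDomain η ζ (ι k) i)
    component {zero}  a ι i = ≡.refl
    component {suc n} a ι i = ≡.cong₂ S._+_ (≡.cong (λ z → a zero S.* z) (e≡pair (ι zero) i))
      (component (a ∘ suc) (ι ∘ suc) i)

  -- Divisibility conditions in terms of coefficients

  ∂x-linear : ∀ c d → ∂x (linear c d) S.≈ constant 2 c
  ∂x-linear c d = coeff₂-ext λ i j → K.trans (coeff₂-∂x (linear c d) i j) (cases i j)
    where
    cases : ∀ i j → fromℤ (+ suc i) K.* coeff₂ (linear c d) (suc i) j K.≈ coeff₂ (constant 2 c) i j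
    cases zero    j = K.*-identityˡ _
    cases (suc i) j = K.zeroʳ _

  ∂y-linear : ∀ c d → ∂y (linear c d) S.≈ constant 2 d
  ∂y-linear c d = coeff₂-ext λ i j → K.trans (coeff₂-∂y (linear c d) i j) (cases i j)
    where
    cases : ∀ i j → fromℤ (+ suc j) K.* coeff₂ (linear c d) i (suc j) K.≈ coeff₂ (constant 2 d) i j
    cases zero          zero    = K.*-identityˡ _
    cases zero          (suc j) = K.zeroʳ _
    cases (suc zero)    j       = K.zeroʳ _
    cases (suc (suc i)) j       = K.zeroʳ _

  ⟪line⟫ : ∀ θ H → θ ⟪ line H ⟫ S.≈
           constant 2 (lines H 0F) S.* θ 0F S.+ constant 2 (lines H 1F) S.* θ 1F
  ⟪line⟫ θ H = S.trans
    (S.+-cong (S.*-congˡ {θ 0F} (S.trans (Der₀.D-cong (line≈linear H)) (∂x-linear (lines H 0F) (lines H 1F))))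
      (S.+-congʳ (S.*-congˡ {θ 1F} (S.trans (Der₁.D-cong (line≈linear H)) (∂y-linear (lines H 0F) (lines H 1F))))))
    (form-lemma (fieldRing K [X 2 ]) (constant 2 (lines H 0F)) (constant 2 (lines H 1F)) (θ 0F) (θ 1F))
    where
    module Der₀ = IsDerivation (Multivariate.∂-isDerivation (fieldRing K) {2} 0F)
    module Der₁ = IsDerivation (Multivariate.∂-isDerivation (fieldRing K) {2} 1F)

  coeff₂-⟪line⟫ : ∀ θ H i j → coeff₂ (θ ⟪ line H ⟫) i j K.≈
                  lines H 0F K.* coeff₂ (θ 0F) i j K.+ lines H 1F K.* coeff₂ (θ 1F) i j
  coeff₂-⟪line⟫ θ H i j = K.trans (coeff₂-cong (⟪line⟫ θ H) i j)
    (K.trans (coeff₂-+ (constant 2 (lines H 0F) S.* θ 0F) (constant 2 (lines H 1F) S.* θ 1F) i j)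
      (K.+-cong (coeff₂-constant (lines H 0F) (θ 0F) i j) (coeff₂-constant (lines H 1F) (θ 1F) i j)))

  x^∣⇒coeff≈0 : ∀ n {f} → line 0F ^ n ∣ f → ∀ i j → i ℕ.< n → coeff₂ f i j K.≈ K.0#
  x^∣⇒coeff≈0 (suc n) {f} (q , e) i j i<1+n =
    K.trans (coeff₂-cong f≈ i j) (K.trans (U.coeffs (T.coeffs (TP.X-⊗ g) i) j) (cases i i<1+n))
    where
    g = q S.* line 0F ^ n
    f≈ : f S.≈ x S.* g
    f≈ = S.trans (S.sym e) (S.trans (x∙yz≈y∙xz q (line 0F) (line 0F ^ n))
      (S.*-congʳ {g} (S.trans (line≈linear 0F) linear≈x)))
      where
      linear≈x : linear K.1# K.0# S.≈ x
      linear≈x = T.∷-cong (U.≋-trans (U.∷-cong K.refl (U.∷-zero U.≋-refl)) (U.∷-zero U.≋-refl)) T.≋-refl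
    cases : ∀ i → i ℕ.< suc n → U.coeff (T.coeff ([] ∷ g) i) j K.≈ K.0#
    cases zero    _         = K.refl
    cases (suc i) (s≤s i<n) = x^∣⇒coeff≈0 n (q , S.refl) i j i<n

  y^∣⇒coeff≈0 : ∀ n {f} → line 1F ^ n ∣ f → ∀ i j → j ℕ.< n → coeff₂ f i j K.≈ K.0#
  y^∣⇒coeff≈0 (suc n) {f} (q , e) i j j<1+n =
    K.trans (coeff₂-cong f≈ i j) (K.trans (U.coeffs (K[y].trans (TP.coeff-C-⊗ UP.X g i) (UP.X-⊗ (T.coeff g i))) j)
      (cases j j<1+n))
    where
    g = q S.* line 1F ^ n
    f≈ : f S.≈ y S.* g
    f≈ = S.trans (S.sym e) (S.trans (x∙yz≈y∙xz q (line 1F) (line 1F ^ n))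
      (S.*-congʳ {g} (S.trans (line≈linear 1F) linear≈y)))
    cases : ∀ j → j ℕ.< suc n → U.coeff (K.0# ∷ T.coeff g i) j K.≈ K.0#
    cases zero    _         = K.refl
    cases (suc j) (s≤s j<n) = y^∣⇒coeff≈0 n (q , S.refl) i j j<n

  -- The line H with the equation x = a y, and evaluation at its point (a , 1).

  module Point (a : K.Carrier) (H : Fin 4) (lineH≈ : line H S.≈ linear K.1# (K.- a)) where

    private
      r = K.0# ∷ a ∷ []
      module Eval = IsHomomorphism (UP.eval-isHomomorphism K.1#)

    -- Substitution of a y for x, then of 1 for y.

    evaluate : S.Carrier → K.Carrier
    evaluate f = UP.eval K.1# (TP.eval r f)

    evaluate-line : ∀ {f} → line H ∣ f → evaluate f K.≈ K.0#
    evaluate-line {f} (q , e) = Eval.cong (K[y].trans (TP.eval-cong r (S.sym e))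
      (K[y].trans (TP.eval-⊗ r q (line H))
      (K[y].trans (K[y].*-congˡ {TP.eval r q}
        (K[y].trans (TP.eval-cong r (S.trans lineH≈ (linear≈x-λy a))) (TP.eval-x-r r)))
      (K[y].zeroʳ (TP.eval r q)))))

    evaluate-homogeneous : ∀ {k f} → Homogeneous k f →
      evaluate f K.≈ Sums.∑ (fieldRing K) (suc k) (λ n → a ^ᴷ n K.* coeff₂ f n (k ℕ.∸ n))
    evaluate-homogeneous {k} {f} hom = K.trans
      (Eval.cong (TP.eval-∑ r (suc k) f λ n k<n → U.mk≋ λ j → hom n j λ e →
        ℕ.<⇒≢ (ℕ.<-≤-trans k<n (ℕ.m≤m+n n j)) (≡.sym e)))
      (K.trans (Eval.∑-homo (suc k) (λ n → r ^ᵁ n K[y].* T.coeff f n))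
      (Sums.∑-cong (fieldRing K) (suc k) λ n n≤k → K.trans (Eval.*-homo (r ^ᵁ n) (T.coeff f n))
        (K.*-cong (K.trans (Eval.^-homo r n) (^-congˡ n eval-r))
          (eval1-single (fieldRing K) (k ℕ.∸ n) (T.coeff f n) λ j j≢ → hom n j λ e →
            j≢ (≡.trans (≡.sym (ℕ.m+n∸m≡n n j)) (≡.cong (ℕ._∸ n) e))))))
      where
      open SemiringExp K[y].semiring using () renaming (_^_ to _^ᵁ_)
      open SemiringExp K.semiring using (^-congˡ)
      eval-r : UP.eval K.1# r K.≈ a
      eval-r = solve 1 (λ a → con ℤ.0ℤ :+ con ℤ.1ℤ :* (a :+ con ℤ.1ℤ :* con ℤ.0ℤ)
        := a) K.refl a

    -- The operator x ∂x - s, which multiplies the coefficient of x^i y^j by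
    -- i - s and lowers the order of vanishing along a line by at most one.

    Δ : ℕ → S.Carrier → S.Carrier
    Δ s f = x S.* ∂x f S.+ Integers.fromℤ (fieldRing K [X 2 ]) (ℤ.- + s) S.* f

    coeff₂-Δ : ∀ s f i j → coeff₂ (Δ s f) i j K.≈ fromℤ (+ i ℤ.- + s) K.* coeff₂ f i j
    coeff₂-Δ s f i j = K.trans
      (coeff₂-+ (x S.* ∂x f) (Integers.fromℤ (fieldRing K [X 2 ]) (ℤ.- + s) S.* f) i j)
      (K.trans (K.+-cong (coeff₂-x∂x f i j) (coeff₂-fromℤ (ℤ.- + s) f i j))
      (K.trans (K.sym (K.distribʳ (coeff₂ f i j) _ _)) (K.*-congʳ (K.sym (fromℤ-+ (+ i) (ℤ.- + s))))))

    homogeneous-Δ : ∀ {k} s {f} → Homogeneous k f → Homogeneous k (Δ s f)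
    homogeneous-Δ s {f} hom i j i+j≢k =
      K.trans (coeff₂-Δ s f i j) (K.trans (K.*-congˡ (hom i j i+j≢k)) (K.zeroʳ _))

    ∣-pred : ∀ n {f} → line H ^ suc n ∣ f → line H ^ n ∣ f
    ∣-pred n (q , e) = q S.* line H , S.trans (S.*-assoc q (line H) (line H ^ n)) e

    ∣-Δ : ∀ s n {f} → line H ^ suc n ∣ f → line H ^ n ∣ Δ s f
    ∣-Δ s n {f} div = ∣-+ {line H ^ n} {x S.* ∂x f} {c S.* f}
      (∣-D {λ h → x S.* ∂x h} x∂x-isDerivation (line H) n {f} div)
      (x∣ʳy⇒x∣ʳzy {line H ^ n} {f} c (∣-pred n {f} div))
      where
      c = Integers.fromℤ (fieldRing K [X 2 ]) (ℤ.- + s)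
      x∂x-isDerivation : IsDerivation (fieldRing K [X 2 ]) (λ h → x S.* ∂x h)
      x∂x-isDerivation = *-isDerivation {fieldRing K [X 2 ]} x {∂x} (Multivariate.∂-isDerivation (fieldRing K) {2} 0F)

    -- After fewer than c applications of operators Δ, a polynomial divisible
    -- by (x - a y)^c still vanishes at the point.

    moments : ∀ {k} c {f} → Homogeneous k f → line H ^ c ∣ f →
              Moments (fieldRing K) (suc k) c (λ n → a ^ᴷ n K.* coeff₂ f n (k ℕ.∸ n))
    moments {k} (suc c) {f} hom (q , e) [] _ = K.trans
      (Sums.∑-cong (fieldRing K) (suc k) λ n _ → K.*-identityˡ _)
      (K.trans (K.sym (evaluate-homogeneous {k} {f} hom))
        (evaluate-line {f} (q S.* line H ^ c , S.trans (S.*-assoc q (line H ^ c) (line H))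
          (S.trans (S.*-congˡ {q} (S.*-comm (line H ^ c) (line H))) e))))
    moments {k} (suc c) {f} hom div (s ∷ ns) (s≤s ∣ns∣<c) = K.trans
      (Sums.∑-cong (fieldRing K) (suc k) λ n _ → K.trans
        (K.*-congʳ (fromℤ-* (+ n ℤ.- + s) (weight ns n)))
        (K.trans
          (solve 4 (λ u w v g → (u :* w) :* (v :* g) := w :* (v :* (u :* g))) K.refl
            (fromℤ (+ n ℤ.- + s)) (fromℤ (weight ns n)) (a ^ᴷ n) (coeff₂ f n (k ℕ.∸ n)))
          (K.*-congˡ (K.*-congˡ (K.sym (coeff₂-Δ s f n (k ℕ.∸ n)))))))
      (moments {k} c {Δ s f} (homogeneous-Δ s {f} hom) (∣-Δ s c {f} div) ns ∣ns∣<c)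

  -- Universal derivations

  -- If η = ∇ φ θ and ζ = ∇ ψ θ, then the determinant of η and ζ is a
  -- multiple of the Jacobian determinant of θ.

  jacobian-degree : ∀ k N θ η ζ φ ψ → Homogeneous (suc k) (θ 0F) → Homogeneous (suc k) (θ 1F) →
    ∇ φ θ ≈ᴰ η → ∇ ψ θ ≈ᴰ ζ → ¬ det η ζ S.≈ S.0# → Homogeneous N (det η ζ) → k ℕ.+ k ℕ.≤ N
  jacobian-degree k N θ η ζ φ ψ f-hom g-hom φ-value ψ-value det≉0 det-homogeneous =
    divisor-degree {k ℕ.+ k} {N} {J} {det φ ψ} J-homogeneous
      (homogeneous-cong {N} det≈ det-homogeneous) (λ ≈0 → det≉0 (S.trans det≈ ≈0))
    where
    f g J : S.Carrier
    f = θ 0F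
    g = θ 1F
    J = ∂x f S.* ∂y g S.- ∂x g S.* ∂y f
    J-homogeneous : Homogeneous (k ℕ.+ k) J
    J-homogeneous = homogeneous-sub {k ℕ.+ k} {∂x f S.* ∂y g} {∂x g S.* ∂y f}
      (homogeneous-* {k} {k} {∂x f} {∂y g} (homogeneous-∂ {k} {f} 0F f-hom) (homogeneous-∂ {k} {g} 1F g-hom))
      (homogeneous-* {k} {k} {∂x g} {∂y f} (homogeneous-∂ {k} {g} 0F g-hom) (homogeneous-∂ {k} {f} 1F f-hom))
    det≈ : det η ζ S.≈ det φ ψ S.* J
    det≈ = S.trans (S.sym (S.+-cong (S.*-cong (φ-value 0F) (ψ-value 1F))
      (S.-‿cong (S.*-cong (φ-value 1F) (ψ-value 0F)))))
      (det-lemma (fieldRing K [X 2 ]) (φ 0F) (φ 1F) (ψ 0F) (ψ 1F) (∂x f) (∂y f) (∂x g) (∂y g))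

  module _ {m : Multiplicity} {θ : Derivation} (θ∈D : InD A (m +𝟏) θ)
           (homogeneous : ∃[ k ] HomogeneousOfDegree k θ)
           (injective : ∀ φ ψ → ∇ φ θ ≈ᴰ ∇ ψ θ → φ ≈ᴰ ψ)
           (surjective : ∀ η → InD A m η → ∃[ φ ] ∇ φ θ ≈ᴰ η) where

    f g : S.Carrier
    f = θ 0F
    g = θ 1F

    k : ℕ
    k = proj₁ homogeneous

    private
      θ≉0 : ¬ θ ≈ᴰ 0ᴰ
      θ≉0 = proj₁ (proj₂ homogeneous)

    value-homogeneous : ∀ H → Homogeneous k (θ ⟪ line H ⟫)
    value-homogeneous H with Dom.zero? (θ ⟪ line H ⟫)
    ... | yes ≈0 = homogeneous-cong {k} (S.sym ≈0) (homogeneous-0 {k})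
    ... | no  ≉0 = IsHomogeneous⇒Homogeneous {k} {θ ⟪ line H ⟫} (proj₂ (proj₂ homogeneous) (lines H) ≉0)

    f≈ : ∀ i j → coeff₂ (θ ⟪ line 0F ⟫) i j K.≈ coeff₂ f i j
    f≈ i j = K.trans (coeff₂-⟪line⟫ θ 0F i j) (solve 2
      (λ f g → con ℤ.1ℤ :* f :+ con ℤ.0ℤ :* g := f) K.refl (coeff₂ f i j) (coeff₂ g i j))

    g≈ : ∀ i j → coeff₂ (θ ⟪ line 1F ⟫) i j K.≈ coeff₂ g i j
    g≈ i j = K.trans (coeff₂-⟪line⟫ θ 1F i j) (solve 2
      (λ f g → con ℤ.0ℤ :* f :+ con ℤ.1ℤ :* g := g) K.refl (coeff₂ f i j) (coeff₂ g i j))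

    x-λy≈ : ∀ a i j → K.1# K.* coeff₂ f i j K.+ (K.- a) K.* coeff₂ g i j K.≈
                      coeff₂ f i j K.- a K.* coeff₂ g i j
    x-λy≈ a i j = solve 3 (λ a f g → con ℤ.1ℤ :* f :+ (:- a) :* g := f :- a :* g)
      K.refl a (coeff₂ f i j) (coeff₂ g i j)

    f-homogeneous : Homogeneous k f
    f-homogeneous = homogeneous-cong {k} (coeff₂-ext {θ ⟪ line 0F ⟫} {f} f≈) (value-homogeneous 0F)

    g-homogeneous : Homogeneous k g
    g-homogeneous = homogeneous-cong {k} (coeff₂-ext {θ ⟪ line 1F ⟫} {g} g≈) (value-homogeneous 1F)

    -- If f and g are multiples of one polynomial u, then ∇ φ θ = 0 for the
    -- derivation φ = ∂y u ∂x - ∂x u ∂y.  So φ = 0 by injectivity, u is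
    -- constant, and ∇ ∂x θ = 0 contradicts injectivity.

    proportional⇒⊥ : ∀ p q u → (∀ i j → coeff₂ f i j K.≈ p K.* coeff₂ u i j) →
                     ¬ (∀ i j → coeff₂ g i j K.≈ q K.* coeff₂ u i j)
    proportional⇒⊥ p q u f≈pu g≈qu = Dom.1≉0 (injective e 0ᴰ (λ i → S.trans
      (e-value i) (S.sym (⟪⟫-0 (θ i)))) 0F)
      where
      e φ : Derivation
      e zero       = S.1#
      e (suc zero) = S.0#
      φ zero       = ∂y u
      φ (suc zero) = S.- ∂x u
      scalar : Fin 2 → K.Carrier
      scalar zero       = p
      scalar (suc zero) = q
      θ≈ : ∀ i → θ i S.≈ constant 2 (scalar i) S.* u
      θ≈ zero       = coeff₂-ext λ i j → K.trans (f≈pu i j) (K.sym (coeff₂-constant p u i j))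
      θ≈ (suc zero) = coeff₂-ext λ i j → K.trans (g≈qu i j) (K.sym (coeff₂-constant q u i j))
      ∂θ≈ : ∀ v i → ∂ {2} v (θ i) S.≈ constant 2 (scalar i) S.* ∂ {2} v u
      ∂θ≈ v i = S.trans (Der.D-cong (θ≈ i)) (S.trans (Der.leibniz (constant 2 (scalar i)) u)
        (S.trans (S.+-congʳ (S.trans (S.*-congʳ {u} (Multivariate.∂-constant (fieldRing K) {2} v (scalar i))) (S.zeroˡ u)))
          (S.+-identityˡ (constant 2 (scalar i) S.* ∂ {2} v u))))
        where module Der = IsDerivation (Multivariate.∂-isDerivation (fieldRing K) {2} v)
      φθ≈0 : ∀ i → φ ⟪ θ i ⟫ S.≈ S.0#
      φθ≈0 i = S.trans
        (S.+-cong (S.*-congˡ {∂y u} (∂θ≈ 0F i)) (S.+-congʳ (S.*-congˡ {S.- ∂x u} (∂θ≈ 1F i))))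
        (jacobian-lemma (fieldRing K [X 2 ]) (constant 2 (scalar i)) (∂x u) (∂y u))
      φ≈0 : φ ≈ᴰ 0ᴰ
      φ≈0 = injective φ 0ᴰ λ i → S.trans (φθ≈0 i) (S.sym (⟪⟫-0 (θ i)))
      ∂xu≈0 : ∂x u S.≈ S.0#
      ∂xu≈0 = S.trans (S.sym (⁻¹-involutive (∂x u))) (S.trans (S.-‿cong (φ≈0 1F)) ε⁻¹≈ε)
        where open GroupProperties S.+-group using (⁻¹-involutive; ε⁻¹≈ε)
      e-value : ∀ i → e ⟪ θ i ⟫ S.≈ S.0#
      e-value i = S.trans (e₁-lemma (fieldRing K [X 2 ]) (∂x (θ i)) (∂y (θ i)))
        (S.trans (∂θ≈ 0F i) (S.trans (S.*-congˡ {constant 2 (scalar i)} ∂xu≈0) (S.zeroʳ (constant 2 (scalar i)))))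

    value≉0 : ∀ H → ¬ θ ⟪ line H ⟫ S.≈ S.0#
    value≉0 0F e = proportional⇒⊥ K.0# K.1# g
      (λ i j → K.trans (K.sym (f≈ i j)) (K.trans (coeff₂-cong e i j) (K.sym (K.zeroˡ _))))
      (λ i j → K.sym (K.*-identityˡ _))
    value≉0 1F e = proportional⇒⊥ K.1# K.0# f
      (λ i j → K.sym (K.*-identityˡ _))
      (λ i j → K.trans (K.sym (g≈ i j)) (K.trans (coeff₂-cong e i j) (K.sym (K.zeroˡ _))))
    value≉0 2F e = proportional⇒⊥ K.1# K.1# g
      (λ i j → x∙y⁻¹≈ε⇒x≈y _ _ (K.trans (K.sym (x-λy≈ K.1# i j))
        (K.trans (K.sym (coeff₂-⟪line⟫ θ 2F i j)) (coeff₂-cong e i j))))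
      (λ i j → K.sym (K.*-identityˡ _))
    value≉0 3F e = proportional⇒⊥ t K.1# g
      (λ i j → x∙y⁻¹≈ε⇒x≈y _ _ (K.trans (K.sym (x-λy≈ t i j))
        (K.trans (K.sym (coeff₂-⟪line⟫ θ 3F i j)) (coeff₂-cong e i j))))
      (λ i j → K.sym (K.*-identityˡ _))

    ^-homogeneous : ∀ H n → Homogeneous n (line H ^ n)
    ^-homogeneous H zero zero    zero    0≢0 = contradiction ≡.refl 0≢0
    ^-homogeneous H zero zero    (suc j) _   = K.refl
    ^-homogeneous H zero (suc i) j       _   = K.refl
    ^-homogeneous H (suc n) = homogeneous-* {1} {n} {line H} {line H ^ n} (line-homogeneous H) (^-homogeneous H n)

    multiplicity≤k : ∀ H → suc (m H) ℕ.≤ k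
    multiplicity≤k H = let q , e = θ∈D H in
      divisor-degree {suc (m H)} {k} {line H ^ suc (m H)} {q} (^-homogeneous H (suc (m H)))
        (homogeneous-cong {k} (S.sym e) (value-homogeneous H))
        (λ ≈0 → value≉0 H (S.trans (S.sym e) ≈0))

    2k≤∣m∣+2 : k ℕ.+ k ℕ.≤ ∣ m ∣ ℕ.+ 2
    2k≤∣m∣+2 = bound k f-homogeneous g-homogeneous (D-basis m)
      where
      bound : ∀ k → Homogeneous k f → Homogeneous k g → Basis (InD A m) (DegreeAtMost ∣ m ∣) →
              k ℕ.+ k ℕ.≤ ∣ m ∣ ℕ.+ 2
      bound zero     _     _     _ = z≤n
      bound (suc k′) f-hom g-hom B =
        let open Basis B
            det≉0 , N , N≤∣m∣ , N-homogeneous = Q-det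
            φ , φ-value = surjective η η∈D
            ψ , ψ-value = surjective ζ ζ∈D
        in ≡.subst₂ ℕ._≤_ (lemma k′) (ℕ.+-comm 2 ∣ m ∣) (s≤s (s≤s (ℕ.≤-trans
             (jacobian-degree k′ N θ η ζ φ ψ f-hom g-hom φ-value ψ-value det≉0 N-homogeneous) N≤∣m∣)))
        where
        lemma : ∀ k′ → suc (suc (k′ ℕ.+ k′)) ≡ suc k′ ℕ.+ suc k′
        lemma = solve-∀

    module _ (linkedVanishing : LinkedVanishing (fieldRing K) t) (m≢0 : ¬ (∀ H → m H ≡ 0)) where

      private
        fₙ gₙ P R : ℕ → K.Carrier
        fₙ n = coeff₂ f n (k ℕ.∸ n)
        gₙ n = coeff₂ g n (k ℕ.∸ n)
        P n = fₙ n K.- K.1# K.* gₙ n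
        R n = t ^ᴷ n K.* (fₙ n K.- t K.* gₙ n)

        P-moments : Moments (fieldRing K) (suc k) (suc (m 2F)) P
        P-moments ns ∣ns∣<c = K.trans (Sums.∑-cong (fieldRing K) (suc k) λ n _ → K.*-congˡ (K.sym (K.trans
            (K.*-cong (1^n n) (K.trans (coeff₂-⟪line⟫ θ 2F n (k ℕ.∸ n)) (x-λy≈ K.1# n (k ℕ.∸ n))))
            (K.*-identityˡ (P n)))))
          (Point.moments K.1# 2F (line≈linear 2F) {k} (suc (m 2F)) {θ ⟪ line 2F ⟫}
            (value-homogeneous 2F) (θ∈D 2F) ns ∣ns∣<c)
          where
          1^n : ∀ n → K.1# ^ᴷ n K.≈ K.1#
          1^n zero    = K.refl
          1^n (suc n) = K.trans (K.*-identityˡ _) (1^n n)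

        R-moments : Moments (fieldRing K) (suc k) (suc (m 3F)) R
        R-moments ns ∣ns∣<b = K.trans (Sums.∑-cong (fieldRing K) (suc k) λ n _ → K.*-congˡ (K.*-congˡ
            (K.sym (K.trans (coeff₂-⟪line⟫ θ 3F n (k ℕ.∸ n)) (x-λy≈ t n (k ℕ.∸ n))))))
          (Point.moments t 3F (line≈linear 3F) {k} (suc (m 3F)) {θ ⟪ line 3F ⟫}
            (value-homogeneous 3F) (θ∈D 3F) ns ∣ns∣<b)

        low : ∀ n → n ℕ.< suc k → n ℕ.< suc (m 0F) → R n K.≈ t ^ᴷ suc n K.* P n
        low n _ n<a = K.trans (K.*-congˡ (K.+-congʳ fₙ≈0))
          (K.trans (solve 3 (λ u t g → u :* (con ℤ.0ℤ :- t :* g) :=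
              (t :* u) :* (con ℤ.0ℤ :- con ℤ.1ℤ :* g)) K.refl (t ^ᴷ n) t (gₙ n))
            (K.*-congˡ (K.+-congʳ (K.sym fₙ≈0))))
          where
          fₙ≈0 : fₙ n K.≈ K.0#
          fₙ≈0 = K.trans (K.sym (f≈ n (k ℕ.∸ n)))
            (x^∣⇒coeff≈0 (suc (m 0F)) {θ ⟪ line 0F ⟫} (θ∈D 0F) n (k ℕ.∸ n) n<a)

        high : ∀ n → n ℕ.< suc k → suc k ℕ.≤ n ℕ.+ suc (m 1F) → R n K.≈ t ^ᴷ n K.* P n
        high n n≤k k<n+d = K.*-congˡ (K.+-congˡ (K.-‿cong (K.trans (K.*-congˡ gₙ≈0)
          (K.trans (K.zeroʳ t) (K.sym (K.trans (K.*-congˡ gₙ≈0) (K.zeroʳ K.1#)))))))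
          where
          k∸n<d : k ℕ.∸ n ℕ.< suc (m 1F)
          k∸n<d = ℕ.+-cancelˡ-< n _ _ (ℕ.≤-<-trans (ℕ.≤-reflexive (ℕ.m+[n∸m]≡n (s≤s⁻¹ n≤k))) k<n+d)
          gₙ≈0 : gₙ n K.≈ K.0#
          gₙ≈0 = K.trans (K.sym (g≈ n (k ℕ.∸ n)))
            (y^∣⇒coeff≈0 (suc (m 1F)) {θ ⟪ line 1F ⟫} (θ∈D 1F) n (k ℕ.∸ n) k∸n<d)

        bound : ∀ H → suc (m H) ℕ.≤ suc k
        bound H = ℕ.m≤n⇒m≤1+n (multiplicity≤k H)

        total : suc k ℕ.+ suc k ℕ.≤ suc (m 0F) ℕ.+ suc (m 3F) ℕ.+ suc (m 2F) ℕ.+ suc (m 1F)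
        total = ≡.subst₂ ℕ._≤_ (lemma k) (lemma′ (m 0F) (m 1F) (m 2F) (m 3F)) (s≤s (s≤s 2k≤∣m∣+2))
          where
          lemma : ∀ k → suc (suc (k ℕ.+ k)) ≡ suc k ℕ.+ suc k
          lemma = solve-∀
          lemma′ : ∀ a b c d → suc (suc (a ℕ.+ b ℕ.+ c ℕ.+ d ℕ.+ 2)) ≡ suc a ℕ.+ suc d ℕ.+ suc c ℕ.+ suc b
          lemma′ = solve-∀

        -- The values a, b, c, d of m + 1 are those at x, x - t y, x - y and y.

        vanishing : ∀ n → n ℕ.< suc k → P n K.≈ K.0# × R n K.≈ K.0#
        vanishing = linkedVanishing (suc k) (suc (m 0F)) (suc (m 3F)) (suc (m 2F)) (suc (m 1F)) {P} {R}
          R-moments P-moments low high (bound 0F) (bound 3F) (bound 2F) (bound 1F) total (λ ()) (λ ())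
          λ (m₀ , m₃ , m₂ , m₁) → m≢0 λ
            { 0F → ℕ.suc-injective m₀ ; 1F → ℕ.suc-injective m₁
            ; 2F → ℕ.suc-injective m₂ ; 3F → ℕ.suc-injective m₃ }

        t^n≉0 : ∀ n → ¬ t ^ᴷ n K.≈ K.0#
        t^n≉0 zero    = 1≉0
        t^n≉0 (suc n) = *-nonzero t≉0 (t^n≉0 n)

        -- f - g = 0 and f - t g = 0

        gₙ≈0 : ∀ n → n ℕ.< suc k → gₙ n K.≈ K.0#
        gₙ≈0 n n≤k = *-cancelˡ-0 t-1≉0 (K.trans
          (solve 3 (λ t f g → (t :- con ℤ.1ℤ) :* g :=
              (f :- con ℤ.1ℤ :* g) :- (f :- t :* g)) K.refl t (fₙ n) (gₙ n))
          (K.trans (K.+-cong (proj₁ (vanishing n n≤k))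
              (K.-‿cong (*-cancelˡ-0 (t^n≉0 n) (proj₂ (vanishing n n≤k)))))
            (K.-‿inverseʳ K.0#)))
          where
          t-1≉0 : ¬ t K.- K.1# K.≈ K.0#
          t-1≉0 e = t≉1 (x∙y⁻¹≈ε⇒x≈y t K.1# e)

        fₙ≈0 : ∀ n → n ℕ.< suc k → fₙ n K.≈ K.0#
        fₙ≈0 n n≤k = K.trans (x∙y⁻¹≈ε⇒x≈y (fₙ n) (K.1# K.* gₙ n) (proj₁ (vanishing n n≤k)))
          (K.trans (K.*-congˡ (gₙ≈0 n n≤k)) (K.zeroʳ K.1#))

        homogeneous≈0 : ∀ {h} → Homogeneous k h → (∀ n → n ℕ.< suc k → coeff₂ h n (k ℕ.∸ n) K.≈ K.0#) →
                        h S.≈ S.0#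
        homogeneous≈0 {h} hom ≈0 = coeff₂-ext λ i j → coefficient≈0 i j (i ℕ.+ j ℕ.≟ k)
          where
          coefficient≈0 : ∀ i j → Dec (i ℕ.+ j ≡ k) → coeff₂ h i j K.≈ K.0#
          coefficient≈0 i j (no i+j≢k)  = hom i j i+j≢k
          coefficient≈0 i j (yes i+j≡k) = K.trans
            (K.reflexive (≡.cong (coeff₂ h i) (≡.trans (≡.sym (ℕ.m+n∸m≡n i j)) (≡.cong (ℕ._∸ i) i+j≡k))))
            (≈0 i (s≤s (ℕ.m+n≤o⇒m≤o i (ℕ.≤-reflexive i+j≡k))))

      noUniversal : ⊥
      noUniversal = θ≉0 λ
        { 0F → homogeneous≈0 {f} f-homogeneous fₙ≈0
        ; 1F → homogeneous≈0 {g} g-homogeneous gₙ≈0 }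

  open Universal K 2

  noNontrivialUniversal : LinkedVanishing (fieldRing K) t → (m : Multiplicity) → ¬ (∀ H → m H ≡ 0) →
    ¬ (Σ (LeftModule.Carrierᴹ (D A (m +𝟏))) λ θ → IsUniversal A m θ × ¬ (proj₁ θ ≈ᴰ θ-Euler))
  noNontrivialUniversal linkedVanishing m m≢0 ((θ , θ∈D) , universal , _) =
    noUniversal {m} {θ} θ∈D (IsUniversal.homogeneous universal)
      (∇-injective A {m} {θ} {θ∈D} universal) (∇-surjective A {m} {θ} {θ∈D} universal)
      linkedVanishing m≢0

-- Clearing denominators over ℤ[t]

module ClearDenominators {R : CommutativeRing 0ℓ 0ℓ} (isDomain : IsDomain R) where

  open Fractions isDomain
  open Fraction
  private
    module R = CommutativeRing R
    module F = CommutativeRing fractionRing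
    open IntegerSolver R
  open IsDomain isDomain

  fromBase-isHomomorphism : IsHomomorphism R fractionRing fromBase
  fromBase-isHomomorphism = record
    { cong = λ e → mk≃ (R.*-congʳ e)
    ; +-homo = λ a b → mk≃ (solve 2 (λ a b → (a :+ b) :* (con ℤ.1ℤ :* con ℤ.1ℤ)
        := (a :* con ℤ.1ℤ :+ b :* con ℤ.1ℤ) :* con ℤ.1ℤ) R.refl a b)
    ; *-homo = λ a b → mk≃ (solve 2 (λ a b → (a :* b) :* (con ℤ.1ℤ :* con ℤ.1ℤ)
        := (a :* b) :* con ℤ.1ℤ) R.refl a b)
    ; 1-homo = F.refl
    }

  open IsHomomorphism fromBase-isHomomorphism

  fromBase-injective : ∀ {a b} → fromBase a ≃ fromBase b → a R.≈ b
  fromBase-injective {a} {b} e = R.trans (R.sym (R.*-identityʳ a))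
    (R.trans (_≃_.crossProducts e) (R.*-identityʳ b))

  clear : ∀ x → fromBase (num x) ≃ fromBase (den x) * x
  clear (a / b [ _ ]) = mk≃ (solve 2 (λ a b → a :* (con ℤ.1ℤ :* b) := (b :* a) :* con ℤ.1ℤ) R.refl a b)

  -- A common denominator of the first K terms of a sequence.

  commonDenominator : ∀ K (u : ℕ → Fraction) → ∃[ D ] ¬ D R.≈ R.0# ×
    (∀ n → n ℕ.< K → ∃[ p ] fromBase p ≃ fromBase D * u n)
  commonDenominator zero    u = R.1# , 1≉0 , λ _ ()
  commonDenominator (suc K) u =
    let D , D≉0 , p = commonDenominator K u in
    den (u K) R.* D , *-nonzero (nonzero (u K)) D≉0 , λ n n<1+K → extend D p n (ℕ.m<1+n⇒m<n∨m≡n n<1+K)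
    where
    extend : ∀ D → (∀ n → n ℕ.< K → ∃[ p ] fromBase p ≃ fromBase D * u n) →
             ∀ n → n ℕ.< K ⊎ n ≡ K → ∃[ p ] fromBase p ≃ fromBase (den (u K) R.* D) * u n
    extend D p n (inj₁ n<K) = let q , e = p n n<K in den (u K) R.* q ,
      F.trans (*-homo (den (u K)) q) (F.trans (F.*-congˡ {fromBase (den (u K))} e)
        (F.trans (F.sym (F.*-assoc (fromBase (den (u K))) (fromBase D) (u n)))
          (F.*-congʳ {u n} (F.sym (*-homo (den (u K)) D)))))
    extend D p n (inj₂ ≡.refl) = D R.* num (u K) ,
      F.trans (*-homo D (num (u K))) (F.trans (F.*-congˡ {fromBase D} (clear (u K)))
        (F.trans (F.sym (F.*-assoc (fromBase D) (fromBase (den (u K))) (u K)))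
          (F.*-congʳ {u K} (F.trans (F.*-comm (fromBase D) (fromBase (den (u K))))
            (F.sym (*-homo (den (u K)) D))))))

  -- The products of E and the first K terms of u, as elements of R.

  record Numerators (K : ℕ) (E : R.Carrier) (u : ℕ → Fraction) : Set where
    field
      numerator : ℕ → R.Carrier
      numerator-≃ : ∀ n → n ℕ.< K → fromBase (numerator n) ≃ fromBase E * u n

  numerators : ∀ {K D u} E → (∀ n → n ℕ.< K → ∃[ p ] fromBase p ≃ fromBase D * u n) →
               Numerators K (E R.* D) u
  numerators {K} {D} {u} E p = record
    { numerator = λ n → select n (n ℕ.<? K)
    ; numerator-≃ = λ n n<K → select-≃ n n<K (n ℕ.<? K)
    }
    where
    select : ∀ n → Dec (n ℕ.< K) → R.Carrier
    select n (yes n<K) = E R.* proj₁ (p n n<K)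
    select n (no  _)   = R.0#
    select-≃ : ∀ n → n ℕ.< K → (d : Dec (n ℕ.< K)) → fromBase (select n d) ≃ fromBase (E R.* D) * u n
    select-≃ n n<K (no n≮K) = contradiction n<K n≮K
    select-≃ n _ (yes n<K) = F.trans (*-homo E (proj₁ (p n n<K)))
      (F.trans (F.*-congˡ {fromBase E} (proj₂ (p n n<K)))
      (F.trans (F.sym (F.*-assoc (fromBase E) (fromBase D) (u n))) (F.*-congʳ {u n} (F.sym (*-homo E D)))))

  module _ {K E u} (ν : Numerators K E u) where

    open Numerators ν

    numerator-moments : ∀ {c} → Moments fractionRing K c u → Moments R K c numerator
    numerator-moments {c} moments ns ∣ns∣<c = fromBase-injective (begin
      fromBase (Sums.∑ R K (λ n → fromℤᴿ (weight ns n) R.* numerator n))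
        ≈⟨ ∑-homo K (λ n → fromℤᴿ (weight ns n) R.* numerator n) ⟩
      Sums.∑ fractionRing K (λ n → fromBase (fromℤᴿ (weight ns n) R.* numerator n))
        ≈⟨ Sums.∑-cong fractionRing K term ⟩
      Sums.∑ fractionRing K (λ n → fromBase E * (fromℤᶠ (weight ns n) * u n))
        ≈⟨ Sums.*-distribˡ-∑ fractionRing K (fromBase E) (λ n → fromℤᶠ (weight ns n) * u n) ⟨
      fromBase E * Sums.∑ fractionRing K (λ n → fromℤᶠ (weight ns n) * u n)
        ≈⟨ F.*-congˡ {fromBase E} (moments ns ∣ns∣<c) ⟩
      fromBase E * F.0#
        ≈⟨ F.zeroʳ (fromBase E) ⟩
      F.0# ∎)
      where
      open SetoidReasoning F.setoid
      open Integers R using () renaming (fromℤ to fromℤᴿ)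
      open Integers fractionRing using () renaming (fromℤ to fromℤᶠ)
      open import Algebra.Properties.CommutativeSemigroup F.*-commutativeSemigroup using (x∙yz≈y∙xz)
      term : ∀ n → n ℕ.< K → fromBase (fromℤᴿ (weight ns n) R.* numerator n) ≃
                             fromBase E * (fromℤᶠ (weight ns n) * u n)
      term n n<K = F.trans (*-homo (fromℤᴿ (weight ns n)) (numerator n))
        (F.trans (F.*-cong (fromℤ-homo (weight ns n)) (numerator-≃ n n<K))
          (x∙yz≈y∙xz (fromℤᶠ (weight ns n)) (fromBase E) (u n)))

    numerator≈0 : ¬ E R.≈ R.0# → ∀ n → n ℕ.< K → numerator n R.≈ R.0# → u n ≃ F.0#
    numerator≈0 E≉0 n n<K e = IsDomain.*-cancelˡ-0 fraction-isDomain {fromBase E} {u n}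
      (λ E≃0 → E≉0 (≃0⇒num≈0 E≃0)) (F.trans (F.sym (numerator-≃ n n<K)) (cong e))

  module _ {K E u v} (ν : Numerators K E u) (ν′ : Numerators K E v) where

    open Numerators
    open SemiringExp R.semiring using () renaming (_^_ to _^ᴿ_)
    open SemiringExp F.semiring using () renaming (_^_ to _^ᶠ_)

    numerator-link : ∀ a w n → n ℕ.< K → v n ≃ fromBase a ^ᶠ w * u n →
                     numerator ν′ n R.≈ (a ^ᴿ w) R.* numerator ν n
    numerator-link a w n n<K e = fromBase-injective (begin
      fromBase (numerator ν′ n)                     ≈⟨ numerator-≃ ν′ n n<K ⟩
      fromBase E * v n                              ≈⟨ F.*-congˡ {fromBase E} e ⟩
      fromBase E * (fromBase a ^ᶠ w * u n)
        ≈⟨ x∙yz≈y∙xz (fromBase E) (fromBase a ^ᶠ w) (u n) ⟩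
      fromBase a ^ᶠ w * (fromBase E * u n)
        ≈⟨ F.*-cong (^-homo a w) (numerator-≃ ν n n<K) ⟨
      fromBase (a ^ᴿ w) * fromBase (numerator ν n)  ≈⟨ *-homo (a ^ᴿ w) (numerator ν n) ⟨
      fromBase ((a ^ᴿ w) R.* numerator ν n)         ∎)
      where
      open SetoidReasoning F.setoid
      open import Algebra.Properties.CommutativeSemigroup F.*-commutativeSemigroup using (x∙yz≈y∙xz)

  -- Two sequences over the same denominator.

  commonNumerators : ∀ K u v → ∃[ E ] ¬ E R.≈ R.0# × Numerators K E u × Numerators K E v
  commonNumerators K u v =
    let D , D≉0 , p = commonDenominator K u
        D′ , D′≉0 , q = commonDenominator K v
        ν = numerators {K} {D′} {v} D q
    in D′ R.* D , *-nonzero D′≉0 D≉0 , numerators {K} {D} {u} D′ p , record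
      { numerator = Numerators.numerator ν
      ; numerator-≃ = λ n n<K → F.trans (Numerators.numerator-≃ ν n n<K)
          (F.*-congʳ {v n} (cong (R.*-comm D D′)))
      }

  fraction-linkedVanishing : ∀ {a} → LinkedVanishing R a → LinkedVanishing fractionRing (fromBase a)
  fraction-linkedVanishing {α} vanishing K a b c d {P} {Q} Q-moments P-moments low high
      a≤K b≤K c≤K d≤K 2K≤ a≢0 d≢0 ¬ones n n<K =
    let E , E≉0 , ν , ν′ = commonNumerators K P Q
        p≈0 , q≈0 = vanishing K a b c d {Numerators.numerator ν} {Numerators.numerator ν′}
          (numerator-moments ν′ {b} Q-moments) (numerator-moments ν {c} P-moments)
          (λ n n<K n<a → numerator-link ν ν′ α (suc n) n n<K (low n n<K n<a))
          (λ n n<K K≤n+d → numerator-link ν ν′ α n n n<K (high n n<K K≤n+d))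
          a≤K b≤K c≤K d≤K 2K≤ a≢0 d≢0 ¬ones n n<K
    in numerator≈0 ν E≉0 n n<K p≈0 , numerator≈0 ν′ E≉0 n n<K q≈0

ℤ-ring ℤ[t] : CommutativeRing 0ℓ 0ℓ
ℤ-ring = ℤ.+-*-commutativeRing
ℤ[t] = Univariate.polynomialRing ℤ-ring

ℤ[t]-isDomain : IsDomain ℤ[t]
ℤ[t]-isDomain = polynomial-isDomain {ℤ-ring} ℤ-isDomain

private
  module ℤ[t] = CommutativeRing ℤ[t]
open Univariate ℤ-ring using (coeff; coeffs; mk≋)
open Polynomials ℤ-ring using (X; X-⊗; coeff-∑; coeff-fromℤ-⊗)

-- The coefficients of t^j inherit the vanishing of the moments.

coeff-moments : ∀ {K c u} → Moments ℤ[t] K c u → ∀ j → MomentsVanish K c (λ n → coeff (u n) j)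
coeff-moments {K} {c} {u} moments j ns ∣ns∣<c = ≡.trans
  (Sums.∑-cong ℤ-ring K λ n _ → ≡.sym (≡.trans (coeff-fromℤ-⊗ (weight ns n) (u n) j)
    (≡.cong (ℤ._* coeff (u n) j) (fromℤ≡id (weight ns n)))))
  (≡.trans (≡.sym (coeff-∑ K (λ n → Integers.fromℤ ℤ[t] (weight ns n) ℤ[t].* u n) j))
    (coeffs (moments ns ∣ns∣<c) j))
  where
  open Integers ℤ-ring using (fromℤ)
  fromℕ≡id : ∀ n → fromℤ (+ n) ≡ + n
  fromℕ≡id zero    = ≡.refl
  fromℕ≡id (suc n) = ≡.trans (1+× n ℤ.1ℤ) (≡.cong ℤ.suc (fromℕ≡id n))
    where open import Algebra.Properties.Semiring.Mult.TCOptimised (CommutativeRing.semiring ℤ-ring) using (1+×)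
  fromℤ≡id : ∀ i → fromℤ i ≡ i
  fromℤ≡id (+ n)    = fromℕ≡id n
  fromℤ≡id -[1+ n ] = ≡.cong (ℤ.-_) (fromℕ≡id (suc n))

open SemiringExp ℤ[t].semiring using (_^_)

coeff-link : ∀ w {p r} → r ℤ[t].≈ (X ^ w) ℤ[t].* p → Link (coeff p) (coeff r) w
coeff-link w {p} {r} e = record
  { shifted = λ j → ≡.trans (coeffs e (j ℕ.+ w)) (shifted w j)
  ; below   = λ j j<w → ≡.trans (coeffs e j) (below w j j<w)
  }
  where
  next : ∀ w → ((X ^ suc w) ℤ[t].* p) ℤ[t].≈ (+ 0 ∷ ((X ^ w) ℤ[t].* p))
  next w = ℤ[t].trans (ℤ[t].*-assoc X (X ^ w) p) (X-⊗ ((X ^ w) ℤ[t].* p))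
  shifted : ∀ w j → coeff ((X ^ w) ℤ[t].* p) (j ℕ.+ w) ≡ coeff p j
  shifted zero    j = ≡.trans (≡.cong (coeff (ℤ[t].1# ℤ[t].* p)) (ℕ.+-identityʳ j)) (coeffs (ℤ[t].*-identityˡ p) j)
  shifted (suc w) j = ≡.trans (≡.cong (coeff ((X ^ suc w) ℤ[t].* p)) (ℕ.+-suc j w))
    (≡.trans (coeffs (next w) (suc (j ℕ.+ w))) (shifted w j))
  below : ∀ w j → j ℕ.< w → coeff ((X ^ w) ℤ[t].* p) j ≡ ℤ.0ℤ
  below (suc w) zero    _         = coeffs (next w) 0
  below (suc w) (suc j) (s≤s j<w) = ≡.trans (coeffs (next w) (suc j)) (below w j j<w)

polynomial-linkedVanishing : LinkedVanishing ℤ[t] X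
polynomial-linkedVanishing K a b c d {P} {R} R-moments P-moments low high
    a≤K b≤K c≤K d≤K 2K≤ a≢0 d≢0 ¬ones n n<K =
  mk≋ (λ j → proj₁ (zeros n n<K j)) , mk≋ (λ j → proj₂ (zeros n n<K j))
  where
  zeros : ∀ n → n ℕ.< K → ∀ j → coeff (P n) j ≡ ℤ.0ℤ × coeff (R n) j ≡ ℤ.0ℤ
  zeros = linked⇒zero K a b c d {λ n → coeff (P n)} {λ n → coeff (R n)}
    (coeff-moments {K} {b} {R} R-moments) (coeff-moments {K} {c} {P} P-moments)
    (λ n n<K n<a → coeff-link (suc n) {P n} {R n} (low n n<K n<a))
    (λ n n<K K≤n+d → coeff-link n {P n} {R n} (high n n<K K≤n+d))
    a≤K b≤K c≤K d≤K 2K≤ a≢0 d≢0 ¬ones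

open Fractions {ℤ[t]} ℤ[t]-isDomain
open ClearDenominators {ℤ[t]} ℤ[t]-isDomain

-- The transcendental element of the field of fractions.

t : Fraction
t = fromBase X

t-linkedVanishing : LinkedVanishing fractionRing t
t-linkedVanishing = fraction-linkedVanishing {X} polynomial-linkedVanishing

t≄0 : ¬ t ≃ CommutativeRing.0# fractionRing
t≄0 e with coeffs (≃0⇒num≈0 e) 1
... | ()

t≄1 : ¬ t ≃ CommutativeRing.1# fractionRing
t≄1 e with coeffs (fromBase-injective e) 0
... | ()

theorem1p8 : Σ (HeytingField 0ℓ 0ℓ 0ℓ) λ K → CharacteristicZero K ×
    (Σ ℕ λ l → 1 ≤ l ×
    (let open Arrangements K l in
    Σ Arrangement λ A → let open Arrangement A in
    TotallyFree A ×
    ((m : Multiplicity) → ¬ (∀ H → m H ≡ 0) →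
    ¬ (Σ (LeftModule.Carrierᴹ (D A (m +𝟏))) λ θ →
    IsUniversal A m θ × ¬ (proj₁ θ ≈ᴰ θ-Euler)))))
theorem1p8 = fractionField , charZero , 2 , s≤s z≤n ,
  FourLines.A fractionField fraction-isDomain charZero inverse t t≄0 t≄1 ,
  FourLines.totallyFree fractionField fraction-isDomain charZero inverse t t≄0 t≄1 ,
  FourLines.noNontrivialUniversal fractionField fraction-isDomain charZero inverse t t≄0 t≄1
    t-linkedVanishing
  where
  charZero : CharZero fractionRing
  charZero = fraction-charZero (polynomial-charZero ℤ-ring ℤ-charZero)
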